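{- Let $m\geq 2$ and let $G_m^{M}$ be the flip graph of non-crossing perfect matchings on $2m$ points in convex position (defined in the context). Then: (i) if $m$ is odd, then $G_m^{M}$ has no $1$-rainbow cycle; (ii) if $m\in\{6,8,10\}$, then $G_m^{M}$ has no $1$-rainbow cycle; (iii) if $m\in\{2,4\}$, then $G_m^{M}$ has a $1$-rainbow cycle, and if $m\in\{6,8\}$, then $G_m^{M}$ has a $2$-rainbow cycle.
   Context: Let $n=2m$ points be in convex position (say equally spaced on a circle), labeled clockwise $1,\dots,n$. A non-crossing perfect matching is a perfect matching on these points whose edges, drawn as straight segments, do not cross. The directed graph $G_m^{M}$ has these matchings as vertices, and an arc $(M,M')$ whenever $M'$ is obtained from $M$ by replacing two edges $\{a,b\},\{c,d\}\in M$ by the edges $\{a,c\},\{b,d\}$ (a flip); this arc is labeled with the two entering edges $\{a,c\}$ and $\{b,d\}$. The set of all possible labels is $E_m=\{\{i,j\}: i,j\in[n],\ j-i \text{ odd}\}$. For an integer $r\geq 1$, an $r$-rainbow cycle in $G_m^{M}$ is a directed cycle (no repeated vertices) along which every element of $E_m$ appears exactly $r$ times among the arc labels. -}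

module Defs where

open import Data.Nat using (ℕ; zero; suc; _+_; _*_; _∸_; NonZero)
open import Data.Nat.DivMod using (_mod_)
open import Data.Fin using (Fin; toℕ; _<_; _≟_)
open import Data.List using (List; length; filter)
open import Data.List using () renaming (allFin to allFinL)
open import Data.Product using (Σ; ∃; _×_; _,_)
open import Data.Sum using (_⊎_)
open import Relation.Nullary using (¬_; Dec; yes; no)
open import Relation.Nullary.Decidable using (_×-dec_; ¬?)
open import Relation.Binary.PropositionalEquality using (_≡_; _≢_)

Odd : ℕ → Set
Odd m = ∃ λ k → m ≡ suc (2 * k)

-- The n = 2m points in convex position, labelled 0,…,2m-1 in clockwise order
-- (the paper labels them 1,…,2m; shifting by one changes nothing).
Point : ℕ → Set
Point m = Fin (2 * m)

-- Two chords {a,b} and {c,d} (a<b, c<d, four distinct points) of a convex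
-- polygon cross iff their endpoints interleave: a<c<b<d or c<a<d<b.
-- Non-crossing: if a < c < b (= partner of a) then d (= partner of c) < b.
-- A non-crossing perfect matching, given by its partner function.
record NCMatching (m : ℕ) : Set where
  field
    partner     : Point m → Point m
    involutive  : ∀ x → partner (partner x) ≡ x
    fixedFree   : ∀ x → partner x ≢ x
    nonCrossing : ∀ a c → a < partner a → c < partner c →
                  a < c → c < partner a → partner c < partner a
open NCMatching public

Flip : ∀ {m} → NCMatching m → NCMatching m → Set
Flip {m} M M' =
  Σ (Point m) λ a → Σ (Point m) λ b → Σ (Point m) λ c → Σ (Point m) λ d →
    (partner M a ≡ b) × (partner M c ≡ d) × (c ≢ a) × (c ≢ b) ×
    (partner M' a ≡ c) × (partner M' b ≡ d) ×
    (∀ x → x ≢ a → x ≢ b → x ≢ c → x ≢ d → partner M' x ≡ partner M x)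

InLabel : ∀ {m} → NCMatching m → NCMatching m → Point m → Point m → Set
InLabel M M' i j = (partner M' i ≡ j) × ¬ (partner M i ≡ j)

inLabel? : ∀ {m} (M M' : NCMatching m) (i j : Point m) → Dec (InLabel M M' i j)
inLabel? M M' i j = (partner M' i ≟ j) ×-dec ¬? (partner M i ≟ j)

csuc : ∀ {k} → Fin (suc k) → Fin (suc k)
csuc {k} i = suc (toℕ i) mod (suc k)

InE : ∀ {m} → Point m → Point m → Set
InE i j = (i < j) × Odd (toℕ j ∸ toℕ i)

record RainbowCycle (m r : ℕ) : Set where
  field
    k        : ℕ
    C        : Fin (suc k) → NCMatching m
    distinct : ∀ s t → (∀ x → partner (C s) x ≡ partner (C t) x) → s ≡ t
    arcs     : ∀ t → Flip (C t) (C (csuc t))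
    rainbow  : ∀ i j → InE {m} i j →
               length (filter (λ t → inLabel? (C t) (C (csuc t)) i j) (allFinL (suc k))) ≡ r

{-# OPTIONS --safe #-}

-- Every point meets m edges, so along a 1-rainbow cycle its partner changes m times.  A flip changes the
-- partners of four points, hence a cycle of K flips has 4K = 2m², which excludes odd m.
--
-- Let m be even and weigh each change of a partner by the lengths of the old and of the new edge.  The four
-- sides of the quadrilateral of a flip have lengths at most its four gaps, which add up to 2m, with equality
-- if and only if the quadrilateral contains the centre.  The total weight of the cycle is the maximal one, so all
-- flips are centred: they only involve edges of the face containing the centre, and the edges hidden behind
-- an edge of that face stay as they are while it is present.  For m = 6, 8, 10 the sequences of centred
-- flips are searched exhaustively, guessing the hidden edges only when they are uncovered.  A branch is cut
-- if an edge enters twice; if an edge of length 1 leaves before the edge of length 3 around it has been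
-- there; or if an edge that has left returns before all other edges at its endpoint have been there.
-- All this is invariant under rotation and under shifting time, so the types of flips (the lengths of the four
-- sides) can be excluded one by one, each exclusion helping the next, until the edges of some length cannot enter.
module Submission where

open import Defs
import Data.Nat as ℕ
open import Data.Nat hiding (_≟_; parity)
open import Data.Nat.Properties hiding (_≟_)
open import Data.Nat.DivMod
open import Data.Nat.Divisibility using (m∣m*n; n∣m*n)
open import Data.Nat.Tactic.RingSolver using (solve-∀)
open import Data.Bool using (Bool; true; false; T; _∧_; _∨_; not; if_then_else_)
open import Data.Fin using (Fin; zero; suc; toℕ; fromℕ; inject₁; _≟_)
open import Data.Fin.Properties using (toℕ<n; toℕ-fromℕ<; toℕ-injective; toℕ-inject₁; toℕ-fromℕ; all?)
open import Data.List using (List; []; _∷_; _++_; map; length; filter; tabulate; allFin)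
open import Data.List.Properties using (++-assoc; ++-identityʳ)
open import Data.List.Membership.Propositional using (_∈_)
open import Data.List.Membership.Propositional.Properties using (∈-map⁺; ∈-++⁺ˡ; ∈-++⁺ʳ)
open import Data.List.Relation.Unary.All using (All; []; _∷_)
open import Data.List.Relation.Unary.All.Properties using (++⁺; ++⁻ʳ)
open import Data.List.Relation.Unary.Any using (here; there)
open import Data.Product using (∃; _×_; _,_; proj₁; proj₂)
open import Data.Sum using (_⊎_; inj₁; inj₂)
open import Data.Vec using (Vec; []; _∷_; lookup)
open import Data.Empty using (⊥; ⊥-elim)
open import Data.Unit using (⊤; tt)
open import Function using (_∘_; id)
open import Relation.Nullary using (¬_; Dec; yes; no; does)
open import Relation.Nullary.Decidable using (True; toWitness; _×-dec_; _→-dec_; ¬?)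
open import Relation.Binary.Definitions using (tri<; tri≈; tri>)
open import Relation.Binary.PropositionalEquality
open import Algebra.Properties.CommutativeMonoid.Sum +-0-commutativeMonoid using (sum; sum-cong-≗; ∑-distrib-+; ∑-comm; sum-init-last)

-- The searches for `m = 6, 8, 10` are run by the type checker: each is a `refl` stating that a
-- Boolean function returns `true`. This shapes everything else. The search knows nothing of
-- matchings; it handles trees of levels and two sets of edges stored as binary numbers, and its
-- soundness is proved separately, once for all `h ≤ 5`. That proof works in a `FlipSystem`, where
-- positions and times are natural numbers, read modulo `n` and `K`. Any flip may then be placed at
-- position 0 and any moment taken as the start, so a type that is excluded once is excluded at all
-- places and times. No branch is followed beyond one period, since an edge is known to enter only
-- once just within `K` consecutive steps.

szl : List ℕ → ℕ
szl [] = 0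
szl (l ∷ ls) = suc l + szl ls

-- Arithmetic modulo `N` with natural numbers as representatives

module Residues (N : ℕ) .{{_ : NonZero N}} where

  pt : ℕ → Fin N
  pt x = x mod N

  toℕ-pt : ∀ x → toℕ (pt x) ≡ x % N
  toℕ-pt x = toℕ-fromℕ< (m%n<n x N)

  pt-cong : ∀ {x y} → x % N ≡ y % N → pt x ≡ pt y
  pt-cong {x} {y} eq = toℕ-injective (trans (toℕ-pt x) (trans eq (sym (toℕ-pt y))))

  pt-% : ∀ {x y} → pt x ≡ pt y → x % N ≡ y % N
  pt-% {x} {y} eq = trans (sym (toℕ-pt x)) (trans (cong toℕ eq) (toℕ-pt y))

  toℕ-pt-small : ∀ {x} → x < N → toℕ (pt x) ≡ x
  toℕ-pt-small {x} x<N = trans (toℕ-pt x) (m<n⇒m%n≡m x<N)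

  pt-toℕ : ∀ q → pt (toℕ q) ≡ q
  pt-toℕ q = toℕ-injective (toℕ-pt-small (toℕ<n q))

  pt-+N : ∀ x → pt (x + N) ≡ pt x
  pt-+N x = pt-cong ([m+n]%n≡m%n x N)

  pt-N+ : ∀ x → pt (N + x) ≡ pt x
  pt-N+ x = trans (cong pt (+-comm N x)) (pt-+N x)

  %-+ʳ : ∀ c {x y} → x % N ≡ y % N → (c + x) % N ≡ (c + y) % N
  %-+ʳ c {x} {y} eq = trans (%-distribˡ-+ c x N) (trans (cong (λ z → (c % N + z) % N) eq) (sym (%-distribˡ-+ c y N)))

  pt-+-cong : ∀ c {x y} → pt x ≡ pt y → pt (x + c) ≡ pt (y + c)
  pt-+-cong c {x} {y} eq = pt-cong (subst₂ (λ u v → u % N ≡ v % N) (+-comm c x) (+-comm c y) (%-+ʳ c (pt-% eq)))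

  pt-%N : ∀ x → pt (x % N) ≡ pt x
  pt-%N x = pt-cong (m%n%n≡m%n x N)

  neg : ℕ → ℕ
  neg x = N ∸ x % N

  neg-+ : ∀ x u → (neg x + (x + u)) % N ≡ u % N
  neg-+ x u = trans (%-congˡ {o = N} eq) ([m+kn]%n≡m%n u (suc (x / N)) N)
    where
    open ≡-Reasoning
    assoc′ : ∀ c r q u → c + (r + q + u) ≡ u + (c + r + q)
    assoc′ = solve-∀
    eq : neg x + (x + u) ≡ u + (N + x / N * N)
    eq = begin
      neg x + (x + u)                         ≡⟨ cong (λ y → neg x + (y + u)) (m≡m%n+[m/n]*n x N) ⟩
      neg x + (x % N + x / N * N + u)         ≡⟨ assoc′ (neg x) (x % N) (x / N * N) u ⟩
      u + (N ∸ x % N + x % N + x / N * N)     ≡⟨ cong (λ y → u + (y + x / N * N)) (m∸n+n≡m (m%n≤n x N)) ⟩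
      u + (N + x / N * N)                     ∎

  -- Adding `neg x` cancels the base point. Together with `pt-sur` this makes the offsets below `N`
  -- from any `x` a system of coordinates, so every point can serve as the origin.
  pt-inj : ∀ x {u w} → u < N → w < N → pt (x + u) ≡ pt (x + w) → u ≡ w
  pt-inj x {u} {w} u<N w<N eq = begin
    u                          ≡⟨ m<n⇒m%n≡m u<N ⟨
    u % N                      ≡⟨ neg-+ x u ⟨
    (neg x + (x + u)) % N      ≡⟨ %-+ʳ (neg x) (pt-% eq) ⟩
    (neg x + (x + w)) % N      ≡⟨ neg-+ x w ⟩
    w % N                      ≡⟨ m<n⇒m%n≡m w<N ⟩
    w                          ∎
    where open ≡-Reasoning

  pt-sur : ∀ x q → ∃ λ u → u < N × pt (x + u) ≡ q
  pt-sur x q = u , m%n<n (neg x + toℕ q) N , trans (pt-cong eq) (pt-toℕ q)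
    where
    u = (neg x + toℕ q) % N
    swap : ∀ a b c → a + (b + c) ≡ b + (a + c)
    swap = solve-∀
    eq : (x + u) % N ≡ toℕ q % N
    eq = begin
      (x + u) % N                     ≡⟨ %-+ʳ x (m%n%n≡m%n (neg x + toℕ q) N) ⟩
      (x + (neg x + toℕ q)) % N       ≡⟨ %-congˡ {o = N} (swap x (neg x) (toℕ q)) ⟩
      (neg x + (x + toℕ q)) % N       ≡⟨ neg-+ x (toℕ q) ⟩
      toℕ q % N                       ∎
      where open ≡-Reasoning

-- Points are natural numbers modulo n, which makes every statement invariant under rotation;
-- Arc P x ℓ says that the partner of x is ℓ steps clockwise from x.
module Circle (n : ℕ) .{{_ : NonZero n}} where
  open Residues n public

  -- Crossing is expressed by offsets `u < v < w` from an arbitrary base point instead of the linear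
  -- order of the labels; this is what makes it invariant under rotation.
  record Planar (P : Fin n → Fin n) : Set where
    field
      inv     : ∀ q → P (P q) ≡ q
      nofix   : ∀ q → P q ≢ q
      uncross : ∀ x {u v w} → 0 < u → u < v → v < w → w < n →
                P (pt x) ≡ pt (x + v) → P (pt (x + u)) ≡ pt (x + w) → ⊥

  Arc : (Fin n → Fin n) → ℕ → ℕ → Set
  Arc P x ℓ = P (pt x) ≡ pt (x + ℓ)

  Arc-cong : ∀ P {x y} ℓ → pt x ≡ pt y → Arc P x ℓ → Arc P y ℓ
  Arc-cong P {x} {y} ℓ eq a = trans (cong P (sym eq)) (trans a (pt-+-cong ℓ eq))

  -- A row of edges side by side. An edge of level `l` has length `2l + 1` and takes up `2(l + 1)`
  -- points with what lies behind it, so a row takes up `2 * szl ls` points.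
  Arcs : (Fin n → Fin n) → ℕ → List ℕ → Set
  Arcs P y [] = ⊤
  Arcs P y (l ∷ ls) = Arc P y (suc (2 * l)) × Arcs P (y + 2 * suc l) ls

  module _ {P} (pl : Planar P) where
    open Planar pl

    arc-unique : ∀ x {u w} → u < n → w < n → Arc P x u → Arc P x w → u ≡ w
    arc-unique x u< w< a b = pt-inj x u< w< (trans (sym a) b)

    arc-back : ∀ x ℓ → Arc P x ℓ → P (pt (x + ℓ)) ≡ pt x
    arc-back x ℓ a = trans (cong P (sym a)) (inv (pt x))

    -- The partner is neither end of the arc, because these are matched to each other, nor a point
    -- beyond it, because of `uncross`.
    inside : ∀ x {u v} → 0 < u → u < v → v < n → Arc P x v →
             ∃ λ w → 0 < w × w < v × P (pt (x + u)) ≡ pt (x + w)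
    inside x {u} {v} 0<u u<v v<n a with pt-sur x (P (pt (x + u)))
    ... | w , w<n , eq with <-cmp w v
    ...   | tri≈ _ refl _ = ⊥-elim (<⇒≢ 0<u (sym (pt-inj x (<-trans u<v v<n) (≤-<-trans z≤n v<n)
                              (trans (trans (sym (inv _)) (trans (cong P (sym eq)) (arc-back x v a))) (cong pt (sym (+-identityʳ x)))))))
    ...   | tri> _ _ v<w = ⊥-elim (uncross x 0<u u<v v<w w<n a (sym eq))
    inside x {u} {v} 0<u u<v v<n a | zero , w<n , eq | tri< w<v _ _ =
      ⊥-elim (<⇒≢ u<v (pt-inj x (<-trans u<v v<n) v<n
        (trans (sym (inv _)) (trans (cong P (trans (sym eq) (cong pt (+-identityʳ x)))) a))))
    inside x {u} {v} 0<u u<v v<n a | suc w , w<n , eq | tri< w<v _ _ = suc w , z<s , w<v , sym eq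

    Closed : ℕ → ℕ → Set
    Closed y k = ∀ u → u < k → ∃ λ w → w < k × P (pt (y + u)) ≡ pt (y + w)

    arc-closed : ∀ x {v} → suc v < n → Arc P x (suc v) → Closed (suc x) v
    arc-closed x {v} v<n a u u<v with inside x {suc u} z<s (s<s u<v) v<n a
    ... | suc w , _ , w<v , eq = w , s<s⁻¹ w<v ,
      trans (cong (λ z → P (pt z)) (sym (+-suc x u))) (trans eq (cong pt (+-suc x w)))

    -- A partner at or before `y + ℓ` would be an end of the arc, which is matched to the other end,
    -- or lie behind the arc, where `inside` keeps its own partner. Neither leads back to a point
    -- past the arc.
    closed-rest : ∀ y ℓ j → Closed y (suc ℓ + j) → suc ℓ + j ≤ n → Arc P y ℓ → Closed (y + suc ℓ) j
    closed-rest y ℓ j cl k≤n a u u<j with cl (suc ℓ + u) (+-monoʳ-< (suc ℓ) u<j)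
    ... | w , w<k , eq with w ≤? ℓ
    ...   | no w≰ℓ = w ∸ suc ℓ , +-cancelˡ-< (suc ℓ) _ _ (subst (_< suc ℓ + j) (sym e) w<k) ,
        trans (cong (λ z → P (pt z)) (+-assoc y (suc ℓ) u)) (trans eq (cong pt (trans (cong (y +_) (sym e)) (sym (+-assoc y (suc ℓ) _)))))
      where e : suc ℓ + (w ∸ suc ℓ) ≡ w
            e = m+[n∸m]≡n (≰⇒> w≰ℓ)
    ...   | yes w≤ℓ = ⊥-elim (bad w w≤ℓ eq)
      where
      ℓ<n : ℓ < n
      ℓ<n = <-≤-trans (s≤s (m≤m+n ℓ j)) k≤n
      v : ℕ
      v = suc ℓ + u
      ℓ<v : ℓ < v
      ℓ<v = s≤s (m≤m+n ℓ u)
      v<n : v < n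
      v<n = <-≤-trans (+-monoʳ-< (suc ℓ) u<j) k≤n
      bad : ∀ w → w ≤ ℓ → P (pt (y + v)) ≡ pt (y + w) → ⊥
      bad w w≤ℓ eq with trans (sym (inv _)) (cong P eq) | m≤n⇒m<n∨m≡n w≤ℓ
      bad w w≤ℓ eq | back | inj₂ refl = <⇒≢ (≤-<-trans z≤n ℓ<v)
        (sym (pt-inj y v<n (≤-<-trans z≤n v<n) (trans (trans back (arc-back y w a)) (cong pt (sym (+-identityʳ y))))))
      bad zero w≤ℓ eq | back | inj₁ w<ℓ = <⇒≢ ℓ<v (pt-inj y ℓ<n v<n
        (trans (sym a) (trans (cong (λ z → P (pt z)) (sym (+-identityʳ y))) (sym back))))
      bad (suc w) w≤ℓ eq | back | inj₁ w<ℓ with inside y {suc w} z<s w<ℓ ℓ<n a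
      ... | w′ , _ , w′<ℓ , eq′ = <⇒≢ (<-trans w′<ℓ ℓ<v) (pt-inj y (<-trans w′<ℓ ℓ<n) v<n (trans (sym eq′) (sym back)))

    private
      -- Peel off the arc at the first point: the part behind it and the part after it are both
      -- closed. The recursion on the part behind only supplies the level of the arc. The bound `f`
      -- is there because these two intervals are shorter but not structurally smaller.
      decomp′ : ∀ f y k → k ≤ f → k ≤ n → Closed y k → ∃ λ ls → k ≡ 2 * szl ls × Arcs P y ls
      decomp′ f y zero _ _ _ = [] , refl , tt
      decomp′ (suc f) y (suc k) (s≤s k≤f) k<n cl with cl 0 z<s
      ... | zero , _ , eq = ⊥-elim (nofix (pt (y + 0)) eq)
      ... | suc w , s≤s w<k , eq′ with decomp′ f (suc y) w (≤-trans (n≤1+n w) (≤-trans w<k k≤f)) (≤-trans (n≤1+n w) (≤-trans w<k (≤-trans (n≤1+n k) k<n)))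
             (arc-closed y (≤-<-trans w<k k<n) (trans (cong (λ z → P (pt z)) (sym (+-identityʳ y))) eq′))
      ...   | in′ , w≡ , _ with decomp′ f (y + suc (suc w)) (k ∸ suc w) (≤-trans (m∸n≤m k (suc w)) k≤f) (≤-trans (m∸n≤m k (suc w)) (≤-trans (n≤1+n k) k<n))
               (closed-rest y (suc w) (k ∸ suc w) (subst (Closed y) (sym e) cl) (subst (_≤ n) (sym e) k<n) a)
               where
               e : suc (suc w) + (k ∸ suc w) ≡ suc k
               e = cong suc (m+[n∸m]≡n w<k)
               a : Arc P y (suc w)
               a = trans (cong (λ z → P (pt z)) (sym (+-identityʳ y))) eq′
      ...     | out , r≡ , arcs = szl in′ ∷ out , k≡ ,
                  subst (λ z → Arc P y (suc z)) w≡ (trans (cong (λ z → P (pt z)) (sym (+-identityʳ y))) eq′) ,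
                  subst (λ z → Arcs P (y + z) out) (trans (cong (λ z → suc (suc z)) w≡) (sym (*-suc 2 (szl in′)))) arcs
        where
        k≡ : suc k ≡ 2 * (suc (szl in′) + szl out)
        k≡ = begin
          suc k                                  ≡⟨ cong suc (m+[n∸m]≡n w<k) ⟨
          suc (suc w + (k ∸ suc w))              ≡⟨ cong₂ (λ p q → suc (suc p + q)) w≡ r≡ ⟩
          suc (suc (2 * szl in′) + 2 * szl out)  ≡⟨ double (szl in′) (szl out) ⟩
          2 * (suc (szl in′) + szl out)          ∎
          where
          open ≡-Reasoning
          double : ∀ a b → suc (suc (2 * a) + 2 * b) ≡ 2 * (suc a + b)
          double = solve-∀

    pocket : ∀ x {v} → suc v < n → Arc P x (suc v) → ∃ λ ls → v ≡ 2 * szl ls × Arcs P (suc x) ls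
    pocket x {v} v<n a = decomp′ v (suc x) v ≤-refl (≤-trans (n≤1+n v) (<⇒≤ v<n)) (arc-closed x v<n a)

    arc-odd : ∀ x {v} → v < n → Arc P x v → ∃ λ l → v ≡ suc (2 * l)
    arc-odd x {zero} _ a = ⊥-elim (nofix (pt x) (trans a (cong pt (+-identityʳ x))))
    arc-odd x {suc v} v<n a with pocket x v<n a
    ... | ls , eq , _ = szl ls , cong suc eq

  wrap : ∀ {y} → n ≤ y → y < n + n → ∃ λ e → e < n × y ≡ n + e × toℕ (pt y) ≡ e
  wrap {y} n≤y y<2n = e , e<n , y≡ , trans (cong toℕ (trans (cong pt y≡) (pt-N+ e))) (toℕ-pt-small e<n)
    where
    e = y ∸ n
    y≡ : y ≡ n + e
    y≡ = sym (m+[n∸m]≡n n≤y)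
    e<n : e < n
    e<n = +-cancelˡ-< n e n (subst (_< n + n) y≡ y<2n)

-- From linear to cyclic non-crossing

module _ {m : ℕ} .{{_ : NonZero (2 * m)}} (M : NCMatching m) where
  open Circle (2 * m)
  private
    n = 2 * m
    P = partner M

  planar : Planar P
  planar = record { inv = involutive M ; nofix = fixedFree M ; uncross = uncross }
    where
    lin : ∀ {a b c d : Fin n} → P a ≡ b → P c ≡ d → toℕ a < toℕ c → toℕ c < toℕ b → toℕ b < toℕ d → ⊥
    lin {a} {b} {c} {d} refl refl a<c c<b b<d =
      <-asym b<d (nonCrossing M a c (<-trans a<c c<b) (<-trans c<b b<d) a<c c<b)

    flipP : ∀ {a b} → P a ≡ b → P b ≡ a
    flipP {a} refl = involutive M a

    -- Wherever the numbering wraps around, the four points still interleave linearly.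
    uncross : ∀ x {u v w} → 0 < u → u < v → v < w → w < n →
              P (pt x) ≡ pt (x + v) → P (pt (x + u)) ≡ pt (x + w) → ⊥
    uncross x {u} {v} {w} 0<u u<v v<w w<n ab cd = go
      where
      i = x % n
      i<n : i < n
      i<n = m%n<n x n
      red : ∀ z → pt (x + z) ≡ pt (i + z)
      red z = pt-+-cong z (sym (pt-%N x))
      i<2n : ∀ {z} → z < n → i + z < n + n
      i<2n z<n = +-mono-< i<n z<n
      ab′ : P (pt i) ≡ pt (i + v)
      ab′ = trans (cong P (pt-%N x)) (trans ab (red v))
      cd′ : P (pt (i + u)) ≡ pt (i + w)
      cd′ = trans (cong P (sym (red u))) (trans cd (red w))
      I = toℕ-pt-small i<n
      i<iu = m<m+n i 0<u
      iu<iv = +-monoʳ-< i u<v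
      iv<iw = +-monoʳ-< i v<w
      v<n = <-trans v<w w<n
      u<n = <-trans u<v v<n
      low : ∀ {z e} → z < n → i + z ≡ n + e → e < i
      low {z} {e} z<n eq = +-cancelʳ-< n e i (subst (_< i + n) (trans eq (+-comm n e)) (+-monoʳ-< i z<n))
      lt : ∀ {y z e f} → y < z → y ≡ n + e → z ≡ n + f → e < f
      lt {e = e} {f} y<z refl refl = +-cancelˡ-< n e f y<z
      go : ⊥
      go with i + u <? n | i + v <? n | i + w <? n
      ... | yes p | yes q | yes r = lin ab′ cd′
              (subst₂ _<_ (sym I) (sym (toℕ-pt-small p)) i<iu) (subst₂ _<_ (sym (toℕ-pt-small p)) (sym (toℕ-pt-small q)) iu<iv)
              (subst₂ _<_ (sym (toℕ-pt-small q)) (sym (toℕ-pt-small r)) iv<iw)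
      ... | yes p | yes q | no ¬r with wrap (≮⇒≥ ¬r) (i<2n w<n)
      ...   | e , _ , eq , E = lin (flipP cd′) ab′
              (subst₂ _<_ (sym E) (sym I) (low w<n eq)) (subst₂ _<_ (sym I) (sym (toℕ-pt-small p)) i<iu)
              (subst₂ _<_ (sym (toℕ-pt-small p)) (sym (toℕ-pt-small q)) iu<iv)
      go | yes p | no ¬q | yes r = ⊥-elim (¬q (<-trans iv<iw r))
      go | yes p | no ¬q | no ¬r with wrap (≮⇒≥ ¬q) (i<2n v<n) | wrap (≮⇒≥ ¬r) (i<2n w<n)
      ...   | e , _ , eq , E | f , _ , eq′ , F = lin (flipP ab′) (flipP cd′)
              (subst₂ _<_ (sym E) (sym F) (lt iv<iw eq eq′)) (subst₂ _<_ (sym F) (sym I) (low w<n eq′))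
              (subst₂ _<_ (sym I) (sym (toℕ-pt-small p)) i<iu)
      go | no ¬p | yes q | _ = ⊥-elim (¬p (<-trans iu<iv q))
      go | no ¬p | no ¬q | yes r = ⊥-elim (¬q (<-trans iv<iw r))
      go | no ¬p | no ¬q | no ¬r with wrap (≮⇒≥ ¬p) (i<2n u<n) | wrap (≮⇒≥ ¬q) (i<2n v<n) | wrap (≮⇒≥ ¬r) (i<2n w<n)
      ...   | d , _ , eq , D | e , _ , eq′ , E | f , _ , eq″ , F = lin cd′ (flipP ab′)
              (subst₂ _<_ (sym D) (sym E) (lt iu<iv eq eq′)) (subst₂ _<_ (sym E) (sym F) (lt iv<iw eq′ eq″))
              (subst₂ _<_ (sym F) (sym I) (low w<n eq″))

-- Indicators and finite sums

ind : ∀ {A : Set} → Dec A → ℕ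
ind d = if does d then 1 else 0

ind-yes : ∀ {A : Set} (d : Dec A) → A → ind d ≡ 1
ind-yes (yes _) _ = refl
ind-yes (no ¬a) a = ⊥-elim (¬a a)

ind-no : ∀ {A : Set} (d : Dec A) → ¬ A → ind d ≡ 0
ind-no (yes a) ¬a = ⊥-elim (¬a a)
ind-no (no _) _ = refl

ind≢0 : ∀ {A : Set} (d : Dec A) → ind d ≢ 0 → A
ind≢0 (yes a) _ = a
ind≢0 (no _) ne = ⊥-elim (ne refl)

ind-⇔ : ∀ {A B : Set} (d : Dec A) (e : Dec B) → (A → B) → (B → A) → ind d ≡ ind e
ind-⇔ (yes a) e f g = sym (ind-yes e (f a))
ind-⇔ (no ¬a) e f g = sym (ind-no e (¬a ∘ g))

length-filter-tabulate : ∀ {A : Set} {Q : A → Set} (Q? : ∀ x → Dec (Q x)) {k} (f : Fin k → A) →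
                         length (filter Q? (tabulate f)) ≡ sum (λ i → ind (Q? (f i)))
length-filter-tabulate Q? {zero} f = refl
length-filter-tabulate Q? {suc k} f with does (Q? (f zero))
... | true  = cong suc (length-filter-tabulate Q? (f ∘ suc))
... | false = length-filter-tabulate Q? (f ∘ suc)

sum-0 : ∀ {k} (f : Fin k → ℕ) → (∀ i → f i ≡ 0) → sum f ≡ 0
sum-0 {zero} f z = refl
sum-0 {suc k} f z = cong₂ _+_ (z zero) (sum-0 (f ∘ suc) (z ∘ suc))

sum-single : ∀ {k} (f : Fin k → ℕ) a → (∀ i → i ≢ a → f i ≡ 0) → sum f ≡ f a
sum-single f zero z = trans (cong (f zero +_) (sum-0 (f ∘ suc) (λ i → z (suc i) λ ()))) (+-identityʳ _)
sum-single f (suc a) z = trans (cong (_+ sum (f ∘ suc)) (z zero λ ()))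
                               (sum-single (f ∘ suc) a (λ i i≢a → z (suc i) λ { refl → i≢a refl }))

sum-const : ∀ {k} c → sum {k} (λ _ → c) ≡ k * c
sum-const {zero} c = refl
sum-const {suc k} c = cong (c +_) (sum-const {k} c)

sum-*ʳ : ∀ {k} (f : Fin k → ℕ) c → sum (λ i → f i * c) ≡ sum f * c
sum-*ʳ {zero} f c = refl
sum-*ʳ {suc k} f c = trans (cong (f zero * c +_) (sum-*ʳ (f ∘ suc) c)) (sym (*-distribʳ-+ c (f zero) _))

term≤sum : ∀ {k} (f : Fin k → ℕ) i → f i ≤ sum f
term≤sum f zero = m≤m+n _ _
term≤sum f (suc i) = ≤-trans (term≤sum (f ∘ suc) i) (m≤n+m _ _)

two-terms≤sum : ∀ {k} (f : Fin k → ℕ) {i j} → i ≢ j → f i + f j ≤ sum f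
two-terms≤sum f {zero} {zero} i≢j = ⊥-elim (i≢j refl)
two-terms≤sum f {zero} {suc j} i≢j = +-monoʳ-≤ (f zero) (term≤sum (f ∘ suc) j)
two-terms≤sum f {suc i} {zero} i≢j = ≤-trans (≤-reflexive (+-comm _ (f zero))) (+-monoʳ-≤ (f zero) (term≤sum (f ∘ suc) i))
two-terms≤sum f {suc i} {suc j} i≢j = ≤-trans (two-terms≤sum (f ∘ suc) (λ e → i≢j (cong suc e))) (m≤n+m _ _)

nonzero-term : ∀ {k} (f : Fin k → ℕ) → sum f ≢ 0 → ∃ λ i → f i ≢ 0
nonzero-term {zero} f nz = ⊥-elim (nz refl)
nonzero-term {suc k} f nz with f zero in eq
... | suc c = zero , λ e → 1+n≢0 (trans (sym eq) e)
... | zero with nonzero-term (f ∘ suc) nz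
...   | i , ne = suc i , ne

+-tight : ∀ {a a′ b b′} → a ≤ a′ → b ≤ b′ → a + b ≡ a′ + b′ → a ≡ a′ × b ≡ b′
+-tight {a} {a′} {b} {b′} a≤ b≤ eq =
  ≤-antisym a≤ (+-cancelʳ-≤ b′ a′ a (≤-trans (≤-reflexive (sym eq)) (+-monoʳ-≤ a b≤))) ,
  ≤-antisym b≤ (+-cancelˡ-≤ a′ b′ b (≤-trans (≤-reflexive (sym eq)) (+-monoˡ-≤ b a≤)))

sum≤ : ∀ {k} (f : Fin k → ℕ) c → (∀ i → f i ≤ c) → sum f ≤ k * c
sum≤ {zero} f c b = z≤n
sum≤ {suc k} f c b = +-mono-≤ (b zero) (sum≤ (f ∘ suc) c (b ∘ suc))

sum-tight : ∀ {k} (f : Fin k → ℕ) c → (∀ i → f i ≤ c) → sum f ≡ k * c → ∀ i → f i ≡ c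
sum-tight {suc k} f c b eq zero = proj₁ (+-tight (b zero) (sum≤ (f ∘ suc) c (b ∘ suc)) eq)
sum-tight {suc k} f c b eq (suc i) =
  sum-tight (f ∘ suc) c (b ∘ suc) (proj₂ (+-tight (b zero) (sum≤ (f ∘ suc) c (b ∘ suc)) eq)) i

csuc-inject₁ : ∀ {k} (i : Fin k) → csuc (inject₁ i) ≡ suc i
csuc-inject₁ {k} i = toℕ-injective (trans (Residues.toℕ-pt (suc k) (suc (toℕ (inject₁ i))))
  (trans (cong (λ z → suc z % suc k) (toℕ-inject₁ i)) (m<n⇒m%n≡m (s<s (toℕ<n i)))))

csuc-fromℕ : ∀ k → csuc (fromℕ k) ≡ zero
csuc-fromℕ k = toℕ-injective (trans (Residues.toℕ-pt (suc k) (suc (toℕ (fromℕ k))))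
  (trans (cong (λ z → suc z % suc k) (toℕ-fromℕ k)) (n%n≡0 (suc k))))

sum-csuc : ∀ {k} (f : Fin (suc k) → ℕ) → sum (f ∘ csuc) ≡ sum f
sum-csuc {k} f = begin
  sum (f ∘ csuc)                                      ≡⟨ sum-init-last (f ∘ csuc) ⟩
  sum (f ∘ csuc ∘ inject₁) + f (csuc (fromℕ k))       ≡⟨ cong₂ _+_ (sum-cong-≗ (λ i → cong f (csuc-inject₁ i))) (cong f (csuc-fromℕ k)) ⟩
  sum (f ∘ suc) + f zero                              ≡⟨ +-comm _ (f zero) ⟩
  sum f                                               ∎
  where open ≡-Reasoning

-- Flips as quadrilaterals

module Quads (n : ℕ) .{{_ : NonZero n}} where
  open Circle n public

  -- The points `a`, `b`, `c`, `d` of a `Flip` come in no particular cyclic order. Here the corners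
  -- are listed clockwise from `x`, so that old and new sides alternate and the gaps `g₁`, ..., `g₄`
  -- go round the circle once.
  record Quad (P P′ : Fin n → Fin n) (x g₁ g₂ g₃ g₄ : ℕ) : Set where
    field
      old₁  : Arc P x g₁
      new₁  : Arc P′ (x + g₁) g₂
      old₂  : Arc P (x + g₁ + g₂) g₃
      new₂  : Arc P′ (x + g₁ + g₂ + g₃) g₄
      total : g₁ + g₂ + g₃ + g₄ ≡ n
      pos₁  : 0 < g₁
      pos₂  : 0 < g₂
      pos₃  : 0 < g₃
      pos₄  : 0 < g₄
      same  : ∀ q → q ≢ pt x → q ≢ pt (x + g₁) → q ≢ pt (x + g₁ + g₂) → q ≢ pt (x + g₁ + g₂ + g₃) → P′ q ≡ P q

  module _ {P P′ : Fin n → Fin n} where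

    loop : ∀ x {g₁ g₂ g₃ g₄} → g₁ + g₂ + g₃ + g₄ ≡ n → pt (x + g₁ + g₂ + g₃ + g₄) ≡ pt x
    loop x {g₁} {g₂} {g₃} {g₄} tot = trans (cong pt (trans (assoc₄ x g₁ g₂ g₃ g₄) (cong (x +_) tot))) (pt-+N x)
      where
      assoc₄ : ∀ x a b c d → x + a + b + c + d ≡ x + (a + b + c + d)
      assoc₄ = solve-∀

    -- Starting one corner later exchanges old and new sides, which amounts to reading the flip
    -- backwards in time. Two turns restore the direction of time and give the second description of
    -- the same flip.
    turn : ∀ {x g₁ g₂ g₃ g₄} → Quad P′ P x g₁ g₂ g₃ g₄ → Quad P P′ (x + g₁) g₂ g₃ g₄ g₁
    turn {x} {g₁} {g₂} {g₃} {g₄} Q = record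
      { old₁ = new₁ ; new₁ = old₂ ; old₂ = new₂
      ; new₂ = Arc-cong P′ g₁ (sym lp) old₁
      ; total = trans (rot g₁ g₂ g₃ g₄) total
      ; pos₁ = pos₂ ; pos₂ = pos₃ ; pos₃ = pos₄ ; pos₄ = pos₁
      ; same = λ q a b c d → sym (same q (λ e → d (trans e (sym lp))) a b c) }
      where
      open Quad Q
      lp = loop x total
      rot : ∀ a b c d → b + c + d + a ≡ a + b + c + d
      rot = solve-∀

  turn² : ∀ {P P′ x g₁ g₂ g₃ g₄} → Quad P P′ x g₁ g₂ g₃ g₄ → Quad P P′ (x + g₁ + g₂) g₃ g₄ g₁ g₂
  turn² Q = turn (turn Q)

  module _ {P P′ : Fin n → Fin n} (pl : Planar P) (pl′ : Planar P′) where

    -- The new edge from offset 0 to `γ` confines the new partner of `β`, so `δ < γ`; the old edge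
    -- from 0 to `β` keeps it out, so `β < δ`. The cyclic order is therefore `0, β, δ, γ`.
    quad-from : ∀ x {β γ δ} → 0 < β → β < γ → γ < n → δ < n →
                Arc P x β → P (pt (x + γ)) ≡ pt (x + δ) → Arc P′ x γ → P′ (pt (x + β)) ≡ pt (x + δ) →
                (∀ q → q ≢ pt x → q ≢ pt (x + β) → q ≢ pt (x + γ) → q ≢ pt (x + δ) → P′ q ≡ P q) →
                ∃ λ g₁ → ∃ λ g₂ → ∃ λ g₃ → ∃ λ g₄ → Quad P P′ x g₁ g₂ g₃ g₄
    quad-from x {β} {γ} {δ} 0<β β<γ γ<n δ<n ab cd ac bd same
      with Planar.inv pl | inside pl′ x 0<β β<γ γ<n ac
    ... | inv | w , 0<w , w<γ , bw with pt-inj x (<-trans w<γ γ<n) δ<n (trans (sym bw) bd)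
    ... | refl with β<δ
      where
      β<n = <-trans β<γ γ<n
      dc : P (pt (x + w)) ≡ pt (x + γ)
      dc = trans (cong P (sym cd)) (inv _)
      β<δ : β < w
      β<δ with <-cmp w β
      ... | tri> _ _ β<w = β<w
      ... | tri≈ _ refl _ = ⊥-elim (<⇒≢ (<-trans 0<β β<γ) (pt-inj x (≤-<-trans z≤n β<n) γ<n
              (trans (cong pt (+-identityʳ x)) (trans (sym (arc-back pl x w ab)) dc))))
      ... | tri< w<β _ _ with inside pl x 0<w w<β β<n ab
      ...   | v , _ , v<β , dv = ⊥-elim (<-irrefl (pt-inj x (<-trans v<β β<n) γ<n (trans (sym dv) dc)) (<-trans v<β β<γ))
    ... | β<w with m≤n⇒∃[o]m+o≡n (<⇒≤ β<w) | m≤n⇒∃[o]m+o≡n (<⇒≤ w<γ) | m≤n⇒∃[o]m+o≡n (<⇒≤ γ<n)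
    ... | g₂ , refl | g₃ , refl | g₄ , tot = β , g₂ , g₃ , g₄ , record
      { old₁ = ab
      ; new₁ = trans bd (cong pt (sym e₂))
      ; old₂ = trans (cong (λ z → P (pt z)) e₂) (trans (trans (cong P (sym cd)) (inv _)) (cong pt (sym e₃)))
      ; new₂ = trans (cong (λ z → P′ (pt z)) e₃) (trans (arc-back pl′ x _ ac) (sym (loop {P = P} {P′ = P′} x tot)))
      ; total = tot
      ; pos₁ = 0<β
      ; pos₂ = +-cancelˡ-< β 0 g₂ (subst (_< β + g₂) (sym (+-identityʳ β)) β<w)
      ; pos₃ = +-cancelˡ-< (β + g₂) 0 g₃ (subst (_< β + g₂ + g₃) (sym (+-identityʳ _)) w<γ)
      ; pos₄ = +-cancelˡ-< (β + g₂ + g₃) 0 g₄ (subst₂ _<_ (sym (+-identityʳ _)) (sym tot) γ<n)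
      ; same = λ q a b c d → same q a b (λ e → d (trans e (cong pt (sym e₃)))) (λ e → c (trans e (cong pt (sym e₂)))) }
      where
      e₂ : x + β + g₂ ≡ x + (β + g₂)
      e₂ = +-assoc x β g₂
      e₃ : x + β + g₂ + g₃ ≡ x + (β + g₂ + g₃)
      e₃ = trans (cong (_+ g₃) e₂) (+-assoc x (β + g₂) g₃)

  changed : (P P′ : Fin n → Fin n) → Fin n → ℕ
  changed P P′ q = ind (¬? (P q ≟ P′ q))

  private
    positive : ∀ x u {q} → pt (x + u) ≡ q → q ≢ pt x → 0 < u
    positive x zero e ne = ⊥-elim (ne (trans (sym e) (cong pt (+-identityʳ x))))
    positive x (suc u) _ _ = z<s

  module _ {P P′ : Fin n → Fin n} (pl : Planar P) (pl′ : Planar P′) where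

    private
      Some : ℕ → Set
      Some x = ∃ λ g₁ → ∃ λ g₂ → ∃ λ g₃ → ∃ λ g₄ → Quad P P′ x g₁ g₂ g₃ g₄

      turn-some : ∀ {x} → (∃ λ g₁ → ∃ λ g₂ → ∃ λ g₃ → ∃ λ g₄ → Quad P′ P x g₁ g₂ g₃ g₄) → ∃ Some
      turn-some {x} (g₁ , g₂ , g₃ , g₄ , Q) = x + g₁ , g₂ , g₃ , g₄ , g₁ , turn Q

      quad-at : ∀ x {β γ δ} → β < n → γ < n → δ < n → Arc P x β → P (pt (x + γ)) ≡ pt (x + δ) →
                pt (x + γ) ≢ pt x → pt (x + γ) ≢ pt (x + β) → Arc P′ x γ → P′ (pt (x + β)) ≡ pt (x + δ) →
                (∀ q → q ≢ pt x → q ≢ pt (x + β) → q ≢ pt (x + γ) → q ≢ pt (x + δ) → P′ q ≡ P q) → ∃ Some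
      quad-at x {β} {γ} β<n γ<n δ<n ab cd c≢a c≢b ac bd same with <-cmp β γ
      ... | tri≈ _ refl _ = ⊥-elim (c≢b refl)
      ... | tri< β<γ _ _ = x ,
              quad-from pl pl′ x (positive x β refl (λ e → Planar.nofix pl (pt x) (trans ab e))) β<γ γ<n δ<n ab cd ac bd same
      -- Now the new partner comes before the old one: apply the other case to the reversed flip and
      -- turn once to restore the direction of time.
      ... | tri> _ _ γ<β = turn-some (quad-from pl′ pl x (positive x γ refl c≢a) γ<β β<n δ<n ac bd ab cd
                                       (λ q a b c d → sym (same q a c b d)))

      quad-any : ∀ {a b c d} x {β γ δ} → pt x ≡ a → β < n → pt (x + β) ≡ b → γ < n → pt (x + γ) ≡ c → δ < n → pt (x + δ) ≡ d →
                 P a ≡ b → P c ≡ d → c ≢ a → c ≢ b → P′ a ≡ c → P′ b ≡ d →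
                 (∀ q → q ≢ a → q ≢ b → q ≢ c → q ≢ d → P′ q ≡ P q) → ∃ Some
      quad-any x refl β<n refl γ<n refl δ<n refl ab cd c≢a c≢b ac bd same = quad-at x β<n γ<n δ<n ab cd c≢a c≢b ac bd same

    quad-exists : ∀ {a b c d} → P a ≡ b → P c ≡ d → c ≢ a → c ≢ b → P′ a ≡ c → P′ b ≡ d →
                  (∀ q → q ≢ a → q ≢ b → q ≢ c → q ≢ d → P′ q ≡ P q) →
                  ∃ λ x → ∃ λ g₁ → ∃ λ g₂ → ∃ λ g₃ → ∃ λ g₄ → Quad P P′ x g₁ g₂ g₃ g₄
    quad-exists {a} {b} {c} {d} ab cd c≢a c≢b ac bd same =
      let (_ , β<n , b≡) = pt-sur (toℕ a) b
          (_ , γ<n , c≡) = pt-sur (toℕ a) c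
          (_ , δ<n , d≡) = pt-sur (toℕ a) d
      in quad-any (toℕ a) (pt-toℕ a) β<n b≡ γ<n c≡ δ<n d≡ ab cd c≢a c≢b ac bd same

  module _ {P P′ : Fin n → Fin n} (pl : Planar P) (pl′ : Planar P′) {x g₁ g₂ g₃ g₄} (Q : Quad P P′ x g₁ g₂ g₃ g₄) where
    open Quad Q

    private
      o₂ = g₁ + g₂
      o₃ = g₁ + g₂ + g₃
      e₂ : x + g₁ + g₂ ≡ x + o₂
      e₂ = +-assoc x g₁ g₂
      e₃ : x + g₁ + g₂ + g₃ ≡ x + o₃
      e₃ = trans (cong (_+ g₃) e₂) (+-assoc x o₂ g₃)

    g₁<o₂ : g₁ < g₁ + g₂
    g₁<o₂ = m<m+n g₁ pos₂

    o₂<o₃ : g₁ + g₂ < g₁ + g₂ + g₃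
    o₂<o₃ = m<m+n o₂ pos₃

    o₃<n : g₁ + g₂ + g₃ < n
    o₃<n = subst (o₃ <_) total (m<m+n o₃ pos₄)

    o₂<n : g₁ + g₂ < n
    o₂<n = <-trans o₂<o₃ o₃<n

    g₁<n : g₁ < n
    g₁<n = <-trans g₁<o₂ o₂<n

    data Corner (q : Fin n) : Set where
      at₀  : q ≡ pt x → Corner q
      at₁  : q ≡ pt (x + g₁) → Corner q
      at₂  : q ≡ pt (x + g₁ + g₂) → Corner q
      at₃  : q ≡ pt (x + g₁ + g₂ + g₃) → Corner q
      else : q ≢ pt x → q ≢ pt (x + g₁) → q ≢ pt (x + g₁ + g₂) → q ≢ pt (x + g₁ + g₂ + g₃) → Corner q

    corner : ∀ q → Corner q
    corner q with q ≟ pt x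
    ... | yes e = at₀ e
    ... | no a with q ≟ pt (x + g₁)
    ... | yes e = at₁ e
    ... | no b with q ≟ pt (x + g₁ + g₂)
    ... | yes e = at₂ e
    ... | no c with q ≟ pt (x + g₁ + g₂ + g₃)
    ... | yes e = at₃ e
    ... | no d = else a b c d

    0≢₁ : pt x ≢ pt (x + g₁)
    0≢₁ e = <⇒≢ pos₁ (pt-inj x (≤-<-trans z≤n g₁<n) g₁<n (trans (cong pt (+-identityʳ x)) e))
    0≢₂ : pt x ≢ pt (x + g₁ + g₂)
    0≢₂ e = <⇒≢ (<-trans pos₁ g₁<o₂) (pt-inj x (≤-<-trans z≤n g₁<n) o₂<n (trans (cong pt (+-identityʳ x)) (trans e (cong pt e₂))))
    0≢₃ : pt x ≢ pt (x + g₁ + g₂ + g₃)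
    0≢₃ e = <⇒≢ (<-trans pos₁ (<-trans g₁<o₂ o₂<o₃)) (pt-inj x (≤-<-trans z≤n g₁<n) o₃<n (trans (cong pt (+-identityʳ x)) (trans e (cong pt e₃))))
    1≢₂ : pt (x + g₁) ≢ pt (x + g₁ + g₂)
    1≢₂ e = <⇒≢ g₁<o₂ (pt-inj x g₁<n o₂<n (trans e (cong pt e₂)))
    1≢₃ : pt (x + g₁) ≢ pt (x + g₁ + g₂ + g₃)
    1≢₃ e = <⇒≢ (<-trans g₁<o₂ o₂<o₃) (pt-inj x g₁<n o₃<n (trans e (cong pt e₃)))
    2≢₃ : pt (x + g₁ + g₂) ≢ pt (x + g₁ + g₂ + g₃)
    2≢₃ e = <⇒≢ o₂<o₃ (pt-inj x o₂<n o₃<n (trans (cong pt (sym e₂)) (trans e (cong pt e₃))))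

    P₁ : P (pt (x + g₁)) ≡ pt x
    P₁ = arc-back pl x g₁ old₁
    P₃ : P (pt (x + g₁ + g₂ + g₃)) ≡ pt (x + g₁ + g₂)
    P₃ = arc-back pl (x + g₁ + g₂) g₃ old₂
    P′₂ : P′ (pt (x + g₁ + g₂)) ≡ pt (x + g₁)
    P′₂ = arc-back pl′ (x + g₁) g₂ new₁
    P′₀ : P′ (pt x) ≡ pt (x + g₁ + g₂ + g₃)
    P′₀ = trans (cong P′ (sym (loop {P = P} {P′ = P′} x total))) (arc-back pl′ (x + g₁ + g₂ + g₃) g₄ new₂)
    P′₃ : P′ (pt (x + g₁ + g₂ + g₃)) ≡ pt x
    P′₃ = trans new₂ (loop {P = P} {P′ = P′} x total)

    private
      single : Fin n → ℕ → Fin n → ℕ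
      single a v q = ind (q ≟ a) * v
      sum-single′ : ∀ a v → sum (single a v) ≡ v
      sum-single′ a v = trans (sum-single (single a v) a (λ i i≢a → cong (_* v) (ind-no (i ≟ a) i≢a)))
                              (trans (cong (_* v) (ind-yes (a ≟ a) refl)) (+-identityʳ v))
      sg-no : ∀ {q a} v → q ≢ a → single a v q ≡ 0
      sg-no {q} {a} v ne = cong (_* v) (ind-no (q ≟ a) ne)
      sg-yes : ∀ q v → single q v q ≡ v
      sg-yes q v = trans (cong (_* v) (ind-yes (q ≟ q) refl)) (+-identityʳ v)
      ch-yes : ∀ {q a b} (φ : Fin n → ℕ) → P q ≡ a → P′ q ≡ b → a ≢ b → changed P P′ q * φ q ≡ φ q
      ch-yes {q} φ refl refl ne = trans (cong (_* φ q) (ind-yes (¬? (P q ≟ P′ q)) ne)) (+-identityʳ _)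
      add₄ : ∀ {a b c d a′ b′ c′ d′ : ℕ} → a ≡ a′ → b ≡ b′ → c ≡ c′ → d ≡ d′ → a + b + c + d ≡ a′ + b′ + c′ + d′
      add₄ refl refl refl refl = refl

    -- Exactly the corners change their partner, and they are distinct; the change indicator is thus
    -- a sum of four point masses.
    sum-changed : ∀ (φ : Fin n → ℕ) → sum (λ q → changed P P′ q * φ q) ≡
      φ (pt x) + φ (pt (x + g₁)) + φ (pt (x + g₁ + g₂)) + φ (pt (x + g₁ + g₂ + g₃))
    sum-changed φ = begin
      sum (λ q → changed P P′ q * φ q)                             ≡⟨ sum-cong-≗ split ⟩
      sum (λ q → s₀ q + s₁ q + s₂ q + s₃ q)                   ≡⟨ ∑-distrib-+ (λ q → s₀ q + s₁ q + s₂ q) s₃ ⟩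
      sum (λ q → s₀ q + s₁ q + s₂ q) + sum s₃                 ≡⟨ cong (_+ sum s₃) (∑-distrib-+ (λ q → s₀ q + s₁ q) s₂) ⟩
      sum (λ q → s₀ q + s₁ q) + sum s₂ + sum s₃               ≡⟨ cong (λ z → z + sum s₂ + sum s₃) (∑-distrib-+ s₀ s₁) ⟩
      sum s₀ + sum s₁ + sum s₂ + sum s₃                       ≡⟨ add₄ (sum-single′ _ _) (sum-single′ _ _) (sum-single′ _ _) (sum-single′ _ _) ⟩
      φ (pt x) + φ (pt (x + g₁)) + φ (pt (x + g₁ + g₂)) + φ (pt (x + g₁ + g₂ + g₃)) ∎
      where
      open ≡-Reasoning
      s₀ s₁ s₂ s₃ : Fin n → ℕ
      s₀ = single (pt x) (φ (pt x))
      s₁ = single (pt (x + g₁)) (φ (pt (x + g₁)))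
      s₂ = single (pt (x + g₁ + g₂)) (φ (pt (x + g₁ + g₂)))
      s₃ = single (pt (x + g₁ + g₂ + g₃)) (φ (pt (x + g₁ + g₂ + g₃)))
      split : ∀ q → changed P P′ q * φ q ≡ s₀ q + s₁ q + s₂ q + s₃ q
      split q with corner q
      ... | at₀ refl = trans (ch-yes φ old₁ P′₀ 1≢₃)
              (sym (trans (add₄ (sg-yes (pt x) _) (sg-no _ 0≢₁) (sg-no _ 0≢₂) (sg-no _ 0≢₃)) (clean (φ (pt x)))))
        where clean : ∀ a → a + 0 + 0 + 0 ≡ a
              clean = solve-∀
      ... | at₁ refl = trans (ch-yes φ P₁ new₁ 0≢₂)
              (sym (trans (add₄ (sg-no _ (≢-sym 0≢₁)) (sg-yes (pt (x + g₁)) _) (sg-no _ 1≢₂) (sg-no _ 1≢₃)) (clean (φ (pt (x + g₁))))))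
        where clean : ∀ a → 0 + a + 0 + 0 ≡ a
              clean = solve-∀
      ... | at₂ refl = trans (ch-yes φ old₂ P′₂ (≢-sym 1≢₃))
              (sym (trans (add₄ (sg-no _ (≢-sym 0≢₂)) (sg-no _ (≢-sym 1≢₂)) (sg-yes (pt (x + g₁ + g₂)) _) (sg-no _ 2≢₃)) (clean (φ (pt (x + g₁ + g₂))))))
        where clean : ∀ a → 0 + 0 + a + 0 ≡ a
              clean = solve-∀
      ... | at₃ refl = trans (ch-yes φ P₃ P′₃ (≢-sym 0≢₂))
              (sym (add₄ (sg-no _ (≢-sym 0≢₃)) (sg-no _ (≢-sym 1≢₃)) (sg-no _ (≢-sym 2≢₃)) (sg-yes (pt (x + g₁ + g₂ + g₃)) _)))
      ... | else a b c d = trans (cong (_* φ q) (ind-no (¬? (P q ≟ P′ q)) (λ ne → ne (sym (same q a b c d)))))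
              (sym (add₄ (sg-no _ a) (sg-no _ b) (sg-no _ c) (sg-no _ d)))

-- Counting

-- Indicator of opposite parity, that is, of the pairs that can be edges; being a number it also
-- serves as the multiplicity of a pair.
opp : ∀ {k} → Fin k → Fin k → ℕ
opp i j = (toℕ i + toℕ j) % 2

odd%2 : ∀ x l → (x + (x + suc (2 * l))) % 2 ≡ 1
odd%2 x l = trans (cong (_% 2) (rearrange x l)) ([m+kn]%n≡m%n 1 (x + l) 2)
  where
  rearrange : ∀ x l → x + (x + suc (2 * l)) ≡ 1 + (x + l) * 2
  rearrange = solve-∀

opp-pt : ∀ m .{{_ : NonZero (2 * m)}} x l → let open Residues (2 * m) in opp (pt x) (pt (x + suc (2 * l))) ≡ 1
opp-pt m x l = begin
  (toℕ (pt x) + toℕ (pt y)) % 2       ≡⟨ %-distribˡ-+ (toℕ (pt x)) (toℕ (pt y)) 2 ⟩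
  (toℕ (pt x) % 2 + toℕ (pt y) % 2) % 2   ≡⟨ cong₂ (λ a b → (a + b) % 2) (pt%2 x) (pt%2 y) ⟩
  (x % 2 + y % 2) % 2                 ≡⟨ %-distribˡ-+ x y 2 ⟨
  (x + y) % 2                         ≡⟨ odd%2 x l ⟩
  1                                   ∎
  where
  open ≡-Reasoning
  open Residues (2 * m)
  y = x + suc (2 * l)
  pt%2 : ∀ z → toℕ (pt z) % 2 ≡ z % 2
  pt%2 z = trans (cong (_% 2) (toℕ-pt z)) (m∣n⇒o%n%m≡o%m 2 (2 * m) z (m∣m*n m))

module _ {m : ℕ} .{{_ : NonZero (2 * m)}} (M : NCMatching m) where
  open Circle (2 * m)

  partner-opp : ∀ {i j} → partner M i ≡ j → opp i j ≡ 1
  partner-opp {i} {j} ij with pt-sur (toℕ i) j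
  ... | v , v<n , eq with arc-odd (planar M) (toℕ i) v<n (trans (cong (partner M) (pt-toℕ i)) (trans ij (sym eq)))
  ...   | l , refl = subst₂ (λ i j → opp i j ≡ 1) (pt-toℕ i) eq (opp-pt m (toℕ i) l)

opp⇒Odd : ∀ {a b} → a < b → (a + b) % 2 ≡ 1 → Odd (b ∸ a)
opp⇒Odd {a} {b} a<b eq = (b ∸ a) / 2 , (begin
  b ∸ a                                ≡⟨ m≡m%n+[m/n]*n (b ∸ a) 2 ⟩
  (b ∸ a) % 2 + (b ∸ a) / 2 * 2        ≡⟨ cong₂ _+_ d%2 (*-comm ((b ∸ a) / 2) 2) ⟩
  suc (2 * ((b ∸ a) / 2))              ∎)
  where
  open ≡-Reasoning
  rearrange : ∀ a d → a + (a + d) ≡ d + a * 2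
  rearrange = solve-∀
  d%2 : (b ∸ a) % 2 ≡ 1
  d%2 = begin
    (b ∸ a) % 2                ≡⟨ [m+kn]%n≡m%n (b ∸ a) a 2 ⟨
    (b ∸ a + a * 2) % 2        ≡⟨ cong (_% 2) (rearrange a (b ∸ a)) ⟨
    (a + (a + (b ∸ a))) % 2    ≡⟨ cong (λ z → (a + z) % 2) (m+[n∸m]≡n (<⇒≤ a<b)) ⟩
    (a + b) % 2                ≡⟨ eq ⟩
    1                          ∎

sum-parity : ∀ m c → sum {2 * m} (λ j → (c + toℕ j) % 2) ≡ m
sum-parity m c = subst (λ k → sum {k} (λ j → (c + toℕ j) % 2) ≡ m) (cong (m +_) (sym (+-identityʳ m))) (go m c)
  where
  pair : ∀ c → c % 2 + suc c % 2 ≡ 1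
  pair zero = refl
  pair (suc zero) = refl
  pair (suc (suc c)) = trans (cong₂ _+_ (step c) (step (suc c))) (pair c)
    where step : ∀ c → suc (suc c) % 2 ≡ c % 2
          step c = trans (cong (_% 2) (+-comm 2 c)) ([m+n]%n≡m%n c 2)
  two : ∀ k c → sum {suc (suc k)} (λ j → (c + toℕ j) % 2) ≡ 1 + sum {k} (λ j → (suc (suc c) + toℕ j) % 2)
  two k c = trans (cong₂ (λ a b → a % 2 + (b % 2 + sum {k} (λ j → (c + suc (suc (toℕ j))) % 2))) (+-identityʳ c) (+-comm c 1))
    (trans (sym (+-assoc (c % 2) (suc c % 2) _)) (cong₂ _+_ (pair c)
      (sum-cong-≗ {k} (λ j → cong (_% 2) (trans (+-suc c (suc (toℕ j))) (cong suc (+-suc c (toℕ j))))))))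
  go : ∀ m c → sum {m + m} (λ j → (c + toℕ j) % 2) ≡ m
  go zero c = refl
  go (suc m) c = trans (cong (λ k → sum {suc k} (λ j → (c + toℕ j) % 2)) (+-suc m m))
                       (trans (two (m + m) c) (cong suc (go m (suc (suc c)))))

module Lengths (n : ℕ) .{{_ : NonZero n}} where
  open Residues n

  L : ℕ → ℕ
  L g = g ⊓ (n ∸ g)

  len : Fin n → Fin n → ℕ
  len i j = L ((neg (toℕ i) + toℕ j) % n)

  len-fwd : ∀ x {g} → g < n → len (pt x) (pt (x + g)) ≡ L g
  len-fwd x {g} g<n = cong L (begin
    (neg (toℕ (pt x)) + toℕ (pt (x + g))) % n   ≡⟨ cong₂ (λ a b → (a + b) % n) (cong (n ∸_) (trans (cong (_% n) (toℕ-pt x)) (m%n%n≡m%n x n))) (toℕ-pt (x + g)) ⟩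
    (neg x + (x + g) % n) % n                   ≡⟨ %-+ʳ (neg x) (m%n%n≡m%n (x + g) n) ⟩
    (neg x + (x + g)) % n                       ≡⟨ neg-+ x g ⟩
    g % n                                       ≡⟨ m<n⇒m%n≡m g<n ⟩
    g                                           ∎)
    where open ≡-Reasoning

  len-bwd : ∀ x {g} → 0 < g → g < n → len (pt (x + g)) (pt x) ≤ g
  len-bwd x {g} 0<g g<n = begin
    len (pt (x + g)) (pt x)                       ≡⟨ cong (len (pt (x + g))) (sym (trans (cong pt back) (pt-+N x))) ⟩
    len (pt (x + g)) (pt (x + g + (n ∸ g)))       ≡⟨ len-fwd (x + g) (∸-monoʳ-< 0<g (<⇒≤ g<n)) ⟩
    L (n ∸ g)                                     ≤⟨ m⊓n≤n (n ∸ g) _ ⟩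
    n ∸ (n ∸ g)                                   ≡⟨ m∸[m∸n]≡n (<⇒≤ g<n) ⟩
    g                                             ∎
    where
    open ≤-Reasoning
    back : x + g + (n ∸ g) ≡ x + n
    back = trans (+-assoc x g (n ∸ g)) (cong (x +_) (m+[n∸m]≡n (<⇒≤ g<n)))

module Count {m : ℕ} .{{_ : NonZero (2 * m)}} (R : RainbowCycle m 1) where
  open RainbowCycle R public
  open Quads (2 * m) public
  open Lengths (2 * m) public
  n K : ℕ
  n = 2 * m
  K = suc k

  Now Next : Fin K → Fin n → Fin n
  Now t = partner (C t)
  Next t = partner (C (csuc t))

  quad : ∀ t → ∃ λ x → ∃ λ g₁ → ∃ λ g₂ → ∃ λ g₃ → ∃ λ g₄ → Quad (Now t) (Next t) x g₁ g₂ g₃ g₄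
  quad t with arcs t
  ... | a , b , c , d , ab , cd , c≢a , c≢b , ac , bd , same =
    quad-exists (planar (C t)) (planar (C (csuc t))) ab cd c≢a c≢b ac bd same

  enters : Fin K → Fin n → Fin n → ℕ
  enters t i j = ind (inLabel? (C t) (C (csuc t)) i j)

  enters-sym : ∀ t i j → enters t i j ≡ enters t j i
  enters-sym t i j = ind-⇔ (inLabel? (C t) (C (csuc t)) i j) (inLabel? (C t) (C (csuc t)) j i) swap swap
    where
    mirror : ∀ {i j} (M : NCMatching m) → partner M i ≡ j → partner M j ≡ i
    mirror M refl = involutive M _
    swap : ∀ {i j} → InLabel (C t) (C (csuc t)) i j → InLabel (C t) (C (csuc t)) j i
    swap (p , ¬q) = mirror (C (csuc t)) p , λ q → ¬q (mirror (C t) q)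

  -- `rainbow` speaks only of `i < j`; the other order follows by symmetry. Pairs of equal parity,
  -- the diagonal included, never occur in a matching.
  sum-enters : ∀ i j → sum (λ t → enters t i j) ≡ opp i j
  sum-enters i j with opp i j in eq
  ... | suc (suc c) = ⊥-elim (<⇒≱ (m%n<n (toℕ i + toℕ j) 2) (subst (2 ≤_) (sym eq) (s≤s (s≤s z≤n))))
  ... | zero = sum-0 _ (λ t → ind-no (inLabel? (C t) (C (csuc t)) i j)
                                (λ l → 1+n≢0 (trans (sym (partner-opp (C (csuc t)) (proj₁ l))) eq)))
  ... | suc zero with <-cmp (toℕ i) (toℕ j)
  ...   | tri< i<j _ _ = trans (sym (length-filter-tabulate (λ t → inLabel? (C t) (C (csuc t)) i j) id))
                               (rainbow i j (i<j , opp⇒Odd i<j eq))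
  ...   | tri> _ _ j<i = trans (trans (sum-cong-≗ (λ t → enters-sym t i j)) (sym (length-filter-tabulate (λ t → inLabel? (C t) (C (csuc t)) j i) id)))
                               (rainbow j i (j<i , opp⇒Odd j<i (trans (cong (_% 2) (+-comm (toℕ j) (toℕ i))) eq)))
  ...   | tri≈ _ i≡j _ = ⊥-elim (0≢1+n (trans (sym (trans (cong (_% 2) even) ([m+kn]%n≡m%n 0 (toℕ i) 2))) eq))
    where even : toℕ i + toℕ j ≡ toℕ i * 2
          even = trans (cong (toℕ i +_) (sym i≡j)) (trans (cong (toℕ i +_) (sym (+-identityʳ (toℕ i)))) (*-comm 2 (toℕ i)))

  Δ : Fin K → Fin n → ℕ
  Δ t = changed (Now t) (Next t)

  -- Double counting: every label enters once, so the total over all new edges, each seen from both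
  -- ends, depends on `w` but not on the cycle. The weight 1 counts the flips, and `len` measures
  -- them.
  weigh-new : ∀ (w : Fin n → Fin n → ℕ) →
    sum (λ t → sum (λ i → Δ t i * w i (Next t i))) ≡ sum (λ i → sum (λ j → opp i j * w i j))
  weigh-new w = begin
    sum (λ t → sum (λ i → Δ t i * w i (Next t i)))           ≡⟨ sum-cong-≗ (λ t → sum-cong-≗ (λ i → spread t i)) ⟩
    sum (λ t → sum (λ i → sum (λ j → enters t i j * w i j)))  ≡⟨ ∑-comm (λ t i → sum (λ j → enters t i j * w i j)) ⟩
    sum (λ i → sum (λ t → sum (λ j → enters t i j * w i j)))  ≡⟨ sum-cong-≗ (λ i → ∑-comm (λ t j → enters t i j * w i j)) ⟩
    sum (λ i → sum (λ j → sum (λ t → enters t i j * w i j)))  ≡⟨ sum-cong-≗ (λ i → sum-cong-≗ (λ j →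
                                                                  trans (sum-*ʳ (λ t → enters t i j) (w i j)) (cong (_* w i j) (sum-enters i j)))) ⟩
    sum (λ i → sum (λ j → opp i j * w i j))                   ∎
    where
    open ≡-Reasoning
    spread : ∀ t i → Δ t i * w i (Next t i) ≡ sum (λ j → enters t i j * w i j)
    spread t i = sym (trans (sum-single _ (Next t i) (λ j j≢ → cong (_* w i j) (ind-no (inLabel? (C t) (C (csuc t)) i j) (λ l → j≢ (sym (proj₁ l))))))
      (cong (_* w i (Next t i)) (ind-⇔ (inLabel? (C t) (C (csuc t)) i (Next t i)) (¬? (Now t i ≟ Next t i)) proj₂ (refl ,_))))

  K*4 : K * 4 ≡ n * m
  K*4 = begin
    K * 4                                            ≡⟨ sum-const {K} 4 ⟨
    sum {K} (λ _ → 4)                                ≡⟨ sum-cong-≗ four ⟨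
    sum (λ t → sum (λ i → Δ t i * 1))                ≡⟨ weigh-new (λ _ _ → 1) ⟩
    sum {n} (λ i → sum {n} (λ j → opp i j * 1))      ≡⟨ sum-cong-≗ {n} (λ i → trans (sum-cong-≗ {n} (λ j → *-identityʳ (opp i j))) (sum-parity m (toℕ i))) ⟩
    sum {n} (λ _ → m)                                ≡⟨ sum-const {n} m ⟩
    n * m                                            ∎
    where
    open ≡-Reasoning
    four : ∀ t → sum (λ i → Δ t i * 1) ≡ 4
    four t with quad t
    ... | x , g₁ , g₂ , g₃ , g₄ , Q = sum-changed (planar (C t)) (planar (C (csuc t))) Q (λ _ → 1)

  ¬odd : ¬ Odd m
  ¬odd (j , refl) = 0≢1+n (begin
      0                                ≡⟨ m*n%n≡0 K 2 ⟨
      K * 2 % 2                        ≡⟨ cong (_% 2) 2K ⟩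
      (suc (2 * j) * suc (2 * j)) % 2  ≡⟨ cong (_% 2) (square j) ⟩
      (1 + (2 * j * j + 2 * j) * 2) % 2 ≡⟨ [m+kn]%n≡m%n 1 (2 * j * j + 2 * j) 2 ⟩
      1                                ∎)
    where
    open ≡-Reasoning
    square : ∀ j → suc (2 * j) * suc (2 * j) ≡ 1 + (2 * j * j + 2 * j) * 2
    square = solve-∀
    halve : ∀ a → a * 4 ≡ 2 * (a * 2)
    halve = solve-∀
    2K : K * 2 ≡ suc (2 * j) * suc (2 * j)
    2K = *-cancelˡ-≡ (K * 2) (suc (2 * j) * suc (2 * j)) 2
           (trans (sym (halve K)) (trans K*4 (*-assoc 2 (suc (2 * j)) (suc (2 * j)))))

  -- The sum runs over points, so each side of the quadrilateral counts at both of its ends; the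
  -- bound for one flip is therefore `2 * n`.
  weight : Fin K → ℕ
  weight t = sum (λ i → Δ t i * (len i (Now t i) + len i (Next t i)))

  module _ {t x g₁ g₂ g₃ g₄} (Q : Quad (Now t) (Next t) x g₁ g₂ g₃ g₄) where
    open Quad Q
    private
      pl = planar (C t)
      pl′ = planar (C (csuc t))
      x₁ = x + g₁
      x₂ = x₁ + g₂
      x₃ = x₂ + g₃
      g₁<n′ = g₁<n pl pl′ Q
      g₂<n′ = ≤-<-trans (m≤n+m g₂ g₁) (o₂<n pl pl′ Q)
      g₃<n′ = ≤-<-trans (m≤n+m g₃ (g₁ + g₂)) (o₃<n pl pl′ Q)
      g₄<n′ : g₄ < n
      g₄<n′ = subst (g₄ <_) total (m<n+m g₄ (<-trans pos₁ (<-trans (g₁<o₂ pl pl′ Q) (o₂<o₃ pl pl′ Q))))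
      φ : Fin n → ℕ
      φ i = len i (Now t i) + len i (Next t i)
      fwd : ∀ {P : Fin n → Fin n} y {g} → g < n → Arc P y g → len (pt y) (P (pt y)) ≡ L g
      fwd y g<n a = trans (cong (len (pt y)) a) (len-fwd y g<n)
      bwd : ∀ {P : Fin n → Fin n} y {g} → 0 < g → g < n → P (pt (y + g)) ≡ pt y → len (pt (y + g)) (P (pt (y + g))) ≤ g
      bwd y {g} 0<g g<n e = subst (λ q → len (pt (y + g)) q ≤ g) (sym e) (len-bwd y 0<g g<n)
      L≤ : ∀ g → L g ≤ g
      L≤ g = m⊓n≤m g _
      b₄ : len (pt x) (Next t (pt x)) ≤ g₄
      b₄ = subst (λ q → len q (Next t q) ≤ g₄) (loop {P = Now t} {P′ = Next t} x total)
             (bwd {Next t} x₃ pos₄ g₄<n′ (trans (cong (Next t) (loop {P = Now t} {P′ = Next t} x total)) (P′₀ pl pl′ Q)))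
      f₀ : φ (pt x) ≤ g₁ + g₄
      f₀ = +-mono-≤ (≤-trans (≤-reflexive (fwd {Now t} x g₁<n′ old₁)) (L≤ g₁)) b₄
      f₁ : φ (pt x₁) ≤ g₁ + g₂
      f₁ = +-mono-≤ (bwd {Now t} x pos₁ g₁<n′ (P₁ pl pl′ Q)) (≤-trans (≤-reflexive (fwd {Next t} x₁ g₂<n′ new₁)) (L≤ g₂))
      f₂ : φ (pt x₂) ≤ g₃ + g₂
      f₂ = +-mono-≤ (≤-trans (≤-reflexive (fwd {Now t} x₂ g₃<n′ old₂)) (L≤ g₃)) (bwd {Next t} x₁ pos₂ g₂<n′ (P′₂ pl pl′ Q))
      f₃ : φ (pt x₃) ≤ g₃ + g₄
      f₃ = +-mono-≤ (bwd {Now t} x₂ pos₃ g₃<n′ (P₃ pl pl′ Q)) (≤-trans (≤-reflexive (fwd {Next t} x₃ g₄<n′ new₂)) (L≤ g₄))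
      collect : ∀ a b c d → a + d + (a + b) + (c + b) + (c + d) ≡ 2 * (a + b + c + d)
      collect = solve-∀
      bound : g₁ + g₄ + (g₁ + g₂) + (g₃ + g₂) + (g₃ + g₄) ≡ 2 * n
      bound = trans (collect g₁ g₂ g₃ g₄) (cong (2 *_) total)
      L-small : ∀ {g a} → a ≡ L g → a ≡ g → g ≤ n ∸ g
      L-small {g} refl eq = subst (_≤ n ∸ g) eq (m⊓n≤n g (n ∸ g))
      weight≡ : weight t ≡ φ (pt x) + φ (pt x₁) + φ (pt x₂) + φ (pt x₃)
      weight≡ = sum-changed pl pl′ Q φ

    weight≤ : weight t ≤ 2 * n
    weight≤ = ≤-trans (≤-reflexive weight≡) (≤-trans (+-mono-≤ (+-mono-≤ (+-mono-≤ f₀ f₁) f₂) f₃) (≤-reflexive bound))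

    -- `+-tight` carries the equality down to the single sides, and `L g ≡ g` means that a side is
    -- measured along its own gap.
    centred : weight t ≡ 2 * n → g₁ ≤ n ∸ g₁ × g₂ ≤ n ∸ g₂ × g₃ ≤ n ∸ g₃ × g₄ ≤ n ∸ g₄
    centred eq =
      let s₁ = ≤-trans (≤-reflexive (fwd {Now t} x g₁<n′ old₁)) (L≤ g₁)
          s₂ = ≤-trans (≤-reflexive (fwd {Next t} x₁ g₂<n′ new₁)) (L≤ g₂)
          s₃ = ≤-trans (≤-reflexive (fwd {Now t} x₂ g₃<n′ old₂)) (L≤ g₃)
          s₄ = ≤-trans (≤-reflexive (fwd {Next t} x₃ g₄<n′ new₂)) (L≤ g₄)
          (e₀₁₂ , e₃) = +-tight (+-mono-≤ (+-mono-≤ f₀ f₁) f₂) f₃ (trans (sym weight≡) (trans eq (sym bound)))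
          (e₀₁ , e₂) = +-tight (+-mono-≤ f₀ f₁) f₂ e₀₁₂
          (e₀ , e₁) = +-tight f₀ f₁ e₀₁
      in L-small (fwd {Now t} x g₁<n′ old₁) (proj₁ (+-tight s₁ b₄ e₀)) ,
         L-small (fwd {Next t} x₁ g₂<n′ new₁) (proj₂ (+-tight (bwd {Now t} x pos₁ g₁<n′ (P₁ pl pl′ Q)) s₂ e₁)) ,
         L-small (fwd {Now t} x₂ g₃<n′ old₂) (proj₁ (+-tight s₃ (bwd {Next t} x₁ pos₂ g₂<n′ (P′₂ pl pl′ Q)) e₂)) ,
         L-small (fwd {Next t} x₃ g₄<n′ new₂) (proj₂ (+-tight (bwd {Now t} x₂ pos₃ g₃<n′ (P₃ pl pl′ Q)) s₄ e₃))

  -- Along a closed walk the total length of the matching returns to its initial value, so as much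
  -- length is lost as is gained, and the gain is known from `weigh-new`.
  sum-weight : sum weight ≡ 2 * sum (λ i → sum (λ j → opp i j * len i j))
  sum-weight = begin
    sum weight                                          ≡⟨ sum-cong-≗ (λ t → trans (sum-cong-≗ (λ i → *-distribˡ-+ (Δ t i) (len i (Now t i)) (len i (Next t i))))
                                                                                     (∑-distrib-+ (λ i → Δ t i * len i (Now t i)) (λ i → Δ t i * len i (Next t i)))) ⟩
    sum (λ t → lost t + gained t)                       ≡⟨ ∑-distrib-+ lost gained ⟩
    sum lost + sum gained                               ≡⟨ cong (_+ sum gained) balance ⟩
    sum gained + sum gained                             ≡⟨ cong (sum gained +_) (+-identityʳ (sum gained)) ⟨
    2 * sum gained                                      ≡⟨ cong (2 *_) (weigh-new len) ⟩
    2 * sum (λ i → sum (λ j → opp i j * len i j))       ∎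
    where
    open ≡-Reasoning
    lost gained full : Fin K → ℕ
    lost t = sum (λ i → Δ t i * len i (Now t i))
    gained t = sum (λ i → Δ t i * len i (Next t i))
    full t = sum (λ i → len i (Now t i))
    exchange : ∀ t i → len i (Next t i) + Δ t i * len i (Now t i) ≡ len i (Now t i) + Δ t i * len i (Next t i)
    exchange t i with Now t i ≟ Next t i
    ... | yes e = cong (_+ 0) (cong (len i) (sym e))
    ... | no _ = trans (cong (len i (Next t i) +_) (+-identityʳ (len i (Now t i))))
                   (trans (+-comm (len i (Next t i)) _) (cong (len i (Now t i) +_) (sym (+-identityʳ (len i (Next t i))))))
    step : ∀ t → full (csuc t) + lost t ≡ full t + gained t
    step t = trans (sym (∑-distrib-+ (λ i → len i (Next t i)) (λ i → Δ t i * len i (Now t i))))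
      (trans (sum-cong-≗ (exchange t)) (∑-distrib-+ (λ i → len i (Now t i)) (λ i → Δ t i * len i (Next t i))))
    balance : sum lost ≡ sum gained
    balance = +-cancelˡ-≡ (sum full) (sum lost) (sum gained) (begin
      sum full + sum lost                  ≡⟨ cong (_+ sum lost) (sum-csuc full) ⟨
      sum (full ∘ csuc) + sum lost         ≡⟨ ∑-distrib-+ (full ∘ csuc) lost ⟨
      sum (λ t → full (csuc t) + lost t)   ≡⟨ sum-cong-≗ step ⟩
      sum (λ t → full t + gained t)        ≡⟨ ∑-distrib-+ full gained ⟩
      sum full + sum gained                ∎)

-- Even m: all flips are centred

module Dynamics (h : ℕ) .{{_ : NonZero (2 * (2 * h))}} (P : ℕ → Fin (2 * (2 * h)) → Fin (2 * (2 * h))) where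
  open Quads (2 * (2 * h))

  -- As `m = 2h`, half the circle is `2h` steps, an even number, while edges have odd length. No
  -- edge is a diameter, and each runs clockwise with a level `l < h` from exactly one of its ends;
  -- so `a` modulo `n` and `l < h` name an edge.
  record Enter (v a l : ℕ) : Set where
    constructor _,_
    field
      before : ¬ Arc (P v) a (suc (2 * l))
      after  : Arc (P (suc v)) a (suc (2 * l))

  record Exit (v a l : ℕ) : Set where
    constructor _,_
    field
      before : Arc (P v) a (suc (2 * l))
      after  : ¬ Arc (P (suc v)) a (suc (2 * l))

  record CentredFlip (t x li l₁ lj l₂ : ℕ) : Set where
    field
      quad : Quad (P t) (P (suc t)) x (suc (2 * li)) (suc (2 * l₁)) (suc (2 * lj)) (suc (2 * l₂))
      li<h : li < h
      l₁<h : l₁ < h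
      lj<h : lj < h
      l₂<h : l₂ < h

-- The interface between the counting and the search. Time is unbounded and periodic, and every
-- window of `K` steps contains exactly one entry of each edge, wherever the window begins.
record FlipSystem (h K : ℕ) .{{nz : NonZero (2 * (2 * h))}} : Set where
  field
    P       : ℕ → Fin (2 * (2 * h)) → Fin (2 * (2 * h))
    planarP : ∀ t → Circle.Planar (2 * (2 * h)) (P t)
    flip    : ∀ t → ∃ λ x → ∃ λ li → ∃ λ l₁ → ∃ λ lj → ∃ λ l₂ → Dynamics.CentredFlip h P t x li l₁ lj l₂
    period  : ∀ t q → P (K + t) q ≡ P t q
    ent     : ∀ t₀ a {l} → l < h → ∃ λ v → t₀ ≤ v × v < t₀ + K × Dynamics.Enter h P v a l
    once    : ∀ {v v′ a l} → l < h → Dynamics.Enter h P v a l → Dynamics.Enter h P v′ a l → v < v′ → v′ < v + K → ⊥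

gap-level : ∀ h {l} → suc (2 * l) ≤ 2 * (2 * h) ∸ suc (2 * l) → l < h
gap-level h {l} g≤ = ≰⇒> λ h≤l → <-irrefl refl (begin-strict
  2 * (2 * h)                                         ≤⟨ *-monoʳ-≤ 2 (*-monoʳ-≤ 2 h≤l) ⟩
  2 * (2 * l)                                         <⟨ *-monoʳ-< 2 (n<1+n (2 * l)) ⟩
  2 * suc (2 * l)                                     ≡⟨ cong (suc (2 * l) +_) (+-identityʳ (suc (2 * l))) ⟩
  suc (2 * l) + suc (2 * l)                           ≤⟨ +-monoʳ-≤ (suc (2 * l)) g≤ ⟩
  suc (2 * l) + (2 * (2 * h) ∸ suc (2 * l))           ≡⟨ m+[n∸m]≡n (≤-trans g≤ (m∸n≤m _ (suc (2 * l)))) ⟩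
  2 * (2 * h)                                         ∎)
  where open ≤-Reasoning

module EvenCycle (h : ℕ) .{{nz : NonZero (2 * (2 * h))}}
         -- Each of the `4h` points has two possible edges of every length `1, 3, …, 2h - 1`, and
         -- these lengths add up to `h²`; hence `4h * 2h²`. For a given numeral `h` the equation
         -- holds by evaluation.
         (total-length : sum (λ i → sum (λ j → opp i j * Lengths.len (2 * (2 * h)) i j)) ≡ 8 * (h * h * h))
         (R : RainbowCycle (2 * h) 1) where
  open Count R
  private module Time = Residues K

  K≡ : K ≡ 2 * (h * h)
  K≡ = *-cancelʳ-≡ K (2 * (h * h)) 4 (trans K*4 (ring h))
    where ring : ∀ h → 2 * (2 * h) * (2 * h) ≡ 2 * (h * h) * 4
          ring = solve-∀

  -- The weights of the `2h²` flips add up to `16h³`. The average `8h` equals the bound `2 * n` for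
  -- a single flip, so every flip attains it.
  tight : ∀ t → weight t ≡ 2 * n
  tight = sum-tight weight (2 * n) (λ t → weight≤ (proj₂ (proj₂ (proj₂ (proj₂ (proj₂ (quad t)))))))
    (trans sum-weight (trans (cong (2 *_) total-length) (trans (ring h) (cong (_* (2 * n)) (sym K≡)))))
    where ring : ∀ h → 2 * (8 * (h * h * h)) ≡ 2 * (h * h) * (2 * (2 * (2 * h)))
          ring = solve-∀

  at : ℕ → NCMatching (2 * h)
  at t = C (Time.pt t)

  csuc-pt : ∀ t → csuc (Time.pt t) ≡ Time.pt (suc t)
  csuc-pt t = Time.pt-cong {suc (toℕ (Time.pt t))} {suc t} (trans (cong (λ z → suc z % K) (Time.toℕ-pt t)) (Time.%-+ʳ 1 {t % K} {t} (m%n%n≡m%n t K)))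

  private
    odd-gap : ∀ {P} → Planar P → ∀ y {g} → g ≤ n ∸ g → Arc P y g → ∃ λ l → g ≡ suc (2 * l)
    odd-gap pl y {zero} _ a = ⊥-elim (Planar.nofix pl (pt y) (trans a (cong pt (+-identityʳ y))))
    odd-gap pl y {suc g} c a = arc-odd pl y (≰⇒> λ n≤g → <⇒≱ z<s (≤-trans c (≤-reflexive (m≤n⇒m∸n≡0 n≤g)))) a

    Levelled : (P P′ : Fin n → Fin n) → Set
    Levelled P P′ = ∃ λ x → ∃ λ li → ∃ λ l₁ → ∃ λ lj → ∃ λ l₂ →
      Quad P P′ x (suc (2 * li)) (suc (2 * l₁)) (suc (2 * lj)) (suc (2 * l₂)) × li < h × l₁ < h × lj < h × l₂ < h

    levelled : ∀ {P P′ x g₁ g₂ g₃ g₄} → Planar P → Planar P′ → Quad P P′ x g₁ g₂ g₃ g₄ →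
               g₁ ≤ n ∸ g₁ × g₂ ≤ n ∸ g₂ × g₃ ≤ n ∸ g₃ × g₄ ≤ n ∸ g₄ → Levelled P P′
    levelled {x = x} {g₁} {g₂} {g₃} {g₄} pl pl′ Q (c₁ , c₂ , c₃ , c₄)
      with odd-gap pl x c₁ (Quad.old₁ Q) | odd-gap pl′ (x + g₁) c₂ (Quad.new₁ Q)
         | odd-gap pl (x + g₁ + g₂) c₃ (Quad.old₂ Q) | odd-gap pl′ (x + g₁ + g₂ + g₃) c₄ (Quad.new₂ Q)
    ... | li , refl | l₁ , refl | lj , refl | l₂ , refl =
      x , li , l₁ , lj , l₂ , Q , gap-level h c₁ , gap-level h c₂ , gap-level h c₃ , gap-level h c₄

    levelled-at : ∀ t → Levelled (Now t) (Next t)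
    levelled-at t = levelled (planar (C t)) (planar (C (csuc t))) Q (centred Q (tight t))
      where Q = proj₂ (proj₂ (proj₂ (proj₂ (proj₂ (quad t)))))

  orbit : ℕ → Fin n → Fin n
  orbit t = partner (at t)

  open Dynamics h orbit

  private
    flips : ∀ t → ∃ λ x → ∃ λ li → ∃ λ l₁ → ∃ λ lj → ∃ λ l₂ → CentredFlip t x li l₁ lj l₂
    flips t = repack (subst (λ s → Levelled (orbit t) (partner (C s))) (csuc-pt t) (levelled-at (Time.pt t)))
      where
      repack : Levelled (orbit t) (orbit (suc t)) → ∃ λ x → ∃ λ li → ∃ λ l₁ → ∃ λ lj → ∃ λ l₂ → CentredFlip t x li l₁ lj l₂
      repack (x , li , l₁ , lj , l₂ , Q , b₁ , b₂ , b₃ , b₄) = x , li , l₁ , lj , l₂ , record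
        { quad = Q ; li<h = b₁ ; l₁<h = b₂ ; lj<h = b₃ ; l₂<h = b₄ }

    enter⇒ : ∀ {v a l} → Enter v a l → enters (Time.pt v) (pt a) (pt (a + suc (2 * l))) ≡ 1
    enter⇒ {v} {a} {l} (¬p , q) = ind-yes (inLabel? (C (Time.pt v)) (C (csuc (Time.pt v))) (pt a) (pt (a + suc (2 * l))))
      (subst (λ s → partner (C s) (pt a) ≡ pt (a + suc (2 * l))) (sym (csuc-pt v)) q , ¬p)

    sum-enters≡1 : ∀ a l → sum (λ t → enters t (pt a) (pt (a + suc (2 * l)))) ≡ 1
    sum-enters≡1 a l = trans (sum-enters (pt a) (pt (a + suc (2 * l)))) (opp-pt (2 * h) a l)

    label⇒enter : ∀ v {t a l} → Time.pt v ≡ t → enters t (pt a) (pt (a + suc (2 * l))) ≢ 0 → Enter v a l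
    label⇒enter v {a = a} {l} refl ne with ind≢0 (inLabel? (C (Time.pt v)) (C (csuc (Time.pt v))) (pt a) (pt (a + suc (2 * l)))) ne
    ... | q , ¬p = ¬p , subst (λ s → partner (C s) (pt a) ≡ pt (a + suc (2 * l))) (csuc-pt v) q

    entries : ∀ t₀ a {l} → l < h → ∃ λ v → t₀ ≤ v × v < t₀ + K × Enter v a l
    entries t₀ a {l} _ = t₀ + u , m≤m+n t₀ u , +-monoʳ-< t₀ (proj₁ (proj₂ sur)) , label⇒enter (t₀ + u) (proj₂ (proj₂ sur)) (proj₂ hit)
      where
      hit : ∃ λ t → enters t (pt a) (pt (a + suc (2 * l))) ≢ 0
      hit = nonzero-term (λ t → enters t (pt a) (pt (a + suc (2 * l)))) (λ z → 0≢1+n (trans (sym z) (sum-enters≡1 a l)))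
      sur = Time.pt-sur t₀ (proj₁ hit)
      u = proj₁ sur

    entry-unique : ∀ {v v′ a l} → l < h → Enter v a l → Enter v′ a l → v < v′ → v′ < v + K → ⊥
    entry-unique {v} {v′} {a} {l} _ e e′ v<v′ v′<v+K with Time.pt v ≟ Time.pt v′
    ... | no ne = 1+n≰n (≤-trans (≤-reflexive (sym (cong₂ _+_ (enter⇒ e) (enter⇒ e′))))
                    (≤-trans (two-terms≤sum (λ t → enters t (pt a) (pt (a + suc (2 * l)))) ne) (≤-reflexive (sum-enters≡1 a l))))
    ... | yes eq with m≤n⇒∃[o]m+o≡n (<⇒≤ v<v′)
    ... | d , refl = <-irrefl (trans (sym (+-identityʳ v)) (cong (v +_) (Time.pt-inj v z<s (+-cancelˡ-< v d K v′<v+K)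
                        (trans (cong Time.pt (+-identityʳ v)) eq)))) v<v′

  system : FlipSystem h (2 * (h * h))
  system = subst (λ k → FlipSystem h k) K≡ record
    { P = orbit ; planarP = λ t → planar (at t) ; flip = flips
    ; period = λ t q → cong (λ s → partner (C s) q) (Time.pt-N+ t)
    ; ent = entries ; once = entry-unique }

-- The search

-- An edge of level l has length 2l + 1 and hides l other edges between itself and the boundary.
-- hid l is an edge of level l behind which nothing is known; opn l ks has ks directly behind it.
data Tree : Set where
  hid : ℕ → Tree
  opn : ℕ → List Tree → Tree

lv : Tree → ℕ
lv (hid l) = l
lv (opn l _) = l

sz : List Tree → ℕ
sz [] = 0
sz (T ∷ ts) = suc (lv T) + sz ts

sz-++ : ∀ ts us → sz (ts ++ us) ≡ sz ts + sz us
sz-++ [] us = refl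
sz-++ (T ∷ ts) us = trans (cong (suc (lv T) +_) (sz-++ ts us)) (sym (+-assoc (suc (lv T)) (sz ts) (sz us)))

incHead : List ℕ → List ℕ
incHead [] = []
incHead (x ∷ xs) = suc x ∷ xs

-- The lists `ls` with `szl ls ≡ l` are the compositions of `l` with every part lowered by one. A
-- composition of the next number arises by prepending a part 1, here level 0, or by enlarging the
-- first part.
comps : ℕ → List (List ℕ)
comps zero = [] ∷ []
comps (suc zero) = (0 ∷ []) ∷ []
comps (suc (suc l)) = map (0 ∷_) (comps (suc l)) ++ map incHead (comps (suc l))

comps-complete : ∀ l ls → szl ls ≡ l → ls ∈ comps l
comps-complete zero [] _ = here refl
comps-complete (suc zero) (zero ∷ []) _ = here refl
comps-complete (suc (suc l)) (zero ∷ ls) eq = ∈-++⁺ˡ (∈-map⁺ (0 ∷_) (comps-complete (suc l) ls (suc-injective eq)))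
comps-complete (suc (suc l)) (suc x ∷ ls) eq =
  ∈-++⁺ʳ (map (0 ∷_) (comps (suc l))) (∈-map⁺ incHead (comps-complete (suc l) (x ∷ ls) (suc-injective eq)))

-- The first equations agree with the last one; they only spare the evaluator the recomputation.
kids : Tree → List (List Tree)
kids (hid 0) = ([]) ∷ []
kids (hid 1) = (hid 0 ∷ []) ∷ []
kids (hid 2) = (hid 0 ∷ hid 0 ∷ []) ∷ (hid 1 ∷ []) ∷ []
kids (hid 3) = (hid 0 ∷ hid 0 ∷ hid 0 ∷ []) ∷ (hid 0 ∷ hid 1 ∷ []) ∷ (hid 1 ∷ hid 0 ∷ []) ∷ (hid 2 ∷ []) ∷ []
kids (hid 4) =
  (hid 0 ∷ hid 0 ∷ hid 0 ∷ hid 0 ∷ []) ∷ (hid 0 ∷ hid 0 ∷ hid 1 ∷ []) ∷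
  (hid 0 ∷ hid 1 ∷ hid 0 ∷ []) ∷ (hid 0 ∷ hid 2 ∷ []) ∷ (hid 1 ∷ hid 0 ∷ hid 0 ∷ []) ∷
  (hid 1 ∷ hid 1 ∷ []) ∷ (hid 2 ∷ hid 0 ∷ []) ∷ (hid 3 ∷ []) ∷ []
kids (hid l) = map (map hid) (comps l)
kids (opn _ ks) = ks ∷ []

kids-hid : ∀ l → kids (hid l) ≡ map (map hid) (comps l)
kids-hid 0 = refl
kids-hid 1 = refl
kids-hid 2 = refl
kids-hid 3 = refl
kids-hid 4 = refl
kids-hid (suc (suc (suc (suc (suc l))))) = refl

every : {A : Set} → (A → Bool) → List A → Bool
every f [] = true
every f (x ∷ xs) = f x ∧ every f xs

true≢false : true ≢ false
true≢false ()

≡true⇒T : ∀ {b} → b ≡ true → T b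
≡true⇒T refl = tt

∧-true : ∀ {a b} → a ∧ b ≡ true → a ≡ true × b ≡ true
∧-true {true} eq = refl , eq

∨-true : ∀ {a b} → a ∨ b ≡ true → a ≡ true ⊎ b ≡ true
∨-true {true} eq = inj₁ refl
∨-true {false} eq = inj₂ eq

or-⊥ : ∀ {a b} → (a ≡ true → ⊥) → (b ≡ true → ⊥) → a ∨ b ≡ true → ⊥
or-⊥ {true} f g _ = f refl
or-⊥ {false} f g eq = g eq

not-true : ∀ {a} → not a ≡ true → a ≡ false
not-true {false} _ = refl

every-∈ : ∀ {A : Set} (f : A → Bool) {xs x} → every f xs ≡ true → x ∈ xs → f x ≡ true
every-∈ f eq (here refl) = proj₁ (∧-true eq)
every-∈ f eq (there x∈) = every-∈ f (proj₂ (∧-true eq)) x∈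

module _ {A : Set} (d : A) where
  get : List A → ℕ → A
  get [] _ = d
  get (x ∷ xs) zero = x
  get (x ∷ xs) (suc k) = get xs k

  upd : (A → A) → List A → ℕ → List A
  upd f [] zero = f d ∷ []
  upd f [] (suc k) = d ∷ upd f [] k
  upd f (x ∷ xs) zero = f x ∷ xs
  upd f (x ∷ xs) (suc k) = x ∷ upd f xs k

  get-upd : ∀ f xs k → get (upd f xs k) k ≡ f (get xs k)
  get-upd f [] zero = refl
  get-upd f [] (suc k) = get-upd f [] k
  get-upd f (x ∷ xs) zero = refl
  get-upd f (x ∷ xs) (suc k) = get-upd f xs k

  get-upd-≢ : ∀ f xs {j k} → j ≢ k → get (upd f xs k) j ≡ get xs j
  get-upd-≢ f [] {zero} {zero} j≢k = ⊥-elim (j≢k refl)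
  get-upd-≢ f [] {zero} {suc k} j≢k = refl
  get-upd-≢ f [] {suc j} {zero} j≢k = refl
  get-upd-≢ f [] {suc j} {suc k} j≢k = get-upd-≢ f [] (j≢k ∘ cong suc)
  get-upd-≢ f (x ∷ xs) {zero} {zero} j≢k = ⊥-elim (j≢k refl)
  get-upd-≢ f (x ∷ xs) {zero} {suc k} j≢k = refl
  get-upd-≢ f (x ∷ xs) {suc j} {zero} j≢k = refl
  get-upd-≢ f (x ∷ xs) {suc j} {suc k} j≢k = get-upd-≢ f xs (j≢k ∘ cong suc)

-- Sets of edges as binary numbers

abstract
  -- Opaque, so that powers outside the table below do not unfold during type checking. Positions
  -- are below 20, hence the table suffices for the searches.
  pow32′ : ℕ → ℕ
  pow32′ a = 32 ^ a

  pow32′≡ : ∀ a → pow32′ a ≡ 32 ^ a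
  pow32′≡ a = refl

-- The numerals tabulate powers, which lets the evaluator read them off.
pow32 pow2 : ℕ → ℕ
pow32 0 = 1
pow32 1 = 32
pow32 2 = 1024
pow32 3 = 32768
pow32 4 = 1048576
pow32 5 = 33554432
pow32 6 = 1073741824
pow32 7 = 34359738368
pow32 8 = 1099511627776
pow32 9 = 35184372088832
pow32 10 = 1125899906842624
pow32 11 = 36028797018963968
pow32 12 = 1152921504606846976
pow32 13 = 36893488147419103232
pow32 14 = 1180591620717411303424
pow32 15 = 37778931862957161709568
pow32 16 = 1208925819614629174706176
pow32 17 = 38685626227668133590597632
pow32 18 = 1237940039285380274899124224
pow32 19 = 39614081257132168796771975168
pow32 a = pow32′ a
pow2 0 = 1
pow2 1 = 2
pow2 2 = 4
pow2 3 = 8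
pow2 4 = 16
pow2 l = 2 ^ l

pow32≡ : ∀ a → pow32 a ≡ 32 ^ a
pow32≡ 0 = refl
pow32≡ 1 = refl
pow32≡ 2 = refl
pow32≡ 3 = refl
pow32≡ 4 = refl
pow32≡ 5 = refl
pow32≡ 6 = refl
pow32≡ 7 = refl
pow32≡ 8 = refl
pow32≡ 9 = refl
pow32≡ 10 = refl
pow32≡ 11 = refl
pow32≡ 12 = refl
pow32≡ 13 = refl
pow32≡ 14 = refl
pow32≡ 15 = refl
pow32≡ 16 = refl
pow32≡ 17 = refl
pow32≡ 18 = refl
pow32≡ 19 = refl
pow32≡ (suc (suc (suc (suc (suc (suc (suc (suc (suc (suc (suc (suc (suc (suc (suc (suc (suc (suc (suc (suc a)))))))))))))))))))) = pow32′≡ _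

pow2≡ : ∀ l → pow2 l ≡ 2 ^ l
pow2≡ 0 = refl
pow2≡ 1 = refl
pow2≡ 2 = refl
pow2≡ 3 = refl
pow2≡ 4 = refl
pow2≡ (suc (suc (suc (suc (suc l))))) = refl

bit : ℕ → ℕ → Bool
bit g i = (g / 2 ^ i) {{m^n≢0 2 i}} % 2 ≡ᵇ 1

bit-suc : ∀ g i → bit g (suc i) ≡ bit (g / 2) i
bit-suc g i = cong (λ q → q % 2 ≡ᵇ 1) (sym (m/n/o≡m/[n*o] g 2 (2 ^ i) {{_}} {{m^n≢0 2 i}} {{m^n≢0 2 (suc i)}}))

bit-zero : ∀ g → bit g 0 ≡ (g % 2 ≡ᵇ 1)
bit-zero g = cong (λ q → q % 2 ≡ᵇ 1) (n/1≡n g)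

private
  half : ∀ g k → (g + 2 * k) / 2 ≡ g / 2 + k
  half g k = trans (+-distrib-/-∣ʳ g (m∣m*n k)) (cong (g / 2 +_) (trans (cong (_/ 2) (*-comm 2 k)) (m*n/n≡m k 2)))

  %2-+ : ∀ g k → (g + 2 * k) % 2 ≡ g % 2
  %2-+ g k = trans (cong (λ z → (g + z) % 2) (*-comm 2 k)) ([m+kn]%n≡m%n g k 2)

  even : ∀ g → (g % 2 ≡ᵇ 1) ≡ false → g ≡ g / 2 * 2
  even g eq with g % 2 | m≡m%n+[m/n]*n g 2 | m%n<n g 2
  ... | zero | e | _ = e
  ... | suc (suc _) | _ | s≤s (s≤s ())

  even-suc : ∀ g → g ≡ g / 2 * 2 → (g + 1) / 2 ≡ g / 2 × (g + 1) % 2 ≡ 1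
  even-suc g e = trans (cong (λ z → (z + 1) / 2) e) (trans (cong (_/ 2) (+-comm (g / 2 * 2) 1)) (trans (+-distrib-/-∣ʳ 1 {g / 2 * 2} {2} (n∣m*n (g / 2))) (m*n/n≡m (g / 2) 2))) ,
                 trans (cong (λ z → (z + 1) % 2) e) (trans (cong (_% 2) (+-comm (g / 2 * 2) 1)) ([m+kn]%n≡m%n 1 (g / 2) 2))

-- Adding `2 ^ j` to a number whose digit `j` is 0 causes no carry; for the same reason `bit-other`
-- holds. The induction on `j` halves `g`.
bit-set : ∀ g j → bit g j ≡ false → bit (g + 2 ^ j) j ≡ true
bit-set g zero eq = trans (bit-zero (g + 1)) (cong (_≡ᵇ 1) (proj₂ (even-suc g (even g (trans (sym (bit-zero g)) eq)))))
bit-set g (suc j) eq = trans (bit-suc (g + 2 ^ suc j) j) (trans (cong (λ z → bit z j) (half g (2 ^ j)))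
  (bit-set (g / 2) j (trans (sym (bit-suc g j)) eq)))

bit-other : ∀ g j i → bit g j ≡ false → i ≢ j → bit (g + 2 ^ j) i ≡ bit g i
bit-other g zero zero eq i≢j = ⊥-elim (i≢j refl)
bit-other g zero (suc i) eq i≢j = trans (bit-suc (g + 1) i) (trans (cong (λ z → bit z i)
  (proj₁ (even-suc g (even g (trans (sym (bit-zero g)) eq))))) (sym (bit-suc g i)))
bit-other g (suc j) zero eq i≢j = trans (bit-zero (g + 2 ^ suc j)) (trans (cong (_≡ᵇ 1) (%2-+ g (2 ^ j))) (sym (bit-zero g)))
bit-other g (suc j) (suc i) eq i≢j = trans (bit-suc (g + 2 ^ suc j) i) (trans (cong (λ z → bit z i) (half g (2 ^ j)))
  (trans (bit-other (g / 2) j i (trans (sym (bit-suc g j)) eq) (i≢j ∘ cong suc)) (sym (bit-suc g i))))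

-- A set of pairs (a , l) with l < 5, stored as the number whose binary digit 5a + l says whether (a , l) belongs to it.
Grid : Set
Grid = ℕ

weight : ℕ → ℕ → ℕ
weight a l = pow32 a * pow2 l

weight≡ : ∀ a l → weight a l ≡ 2 ^ (5 * a + l)
weight≡ a l = trans (cong₂ _*_ (trans (pow32≡ a) (^-*-assoc 2 5 a)) (pow2≡ l)) (sym (^-distribˡ-+-* 2 (5 * a) l))

weight≢0 : ∀ a l → NonZero (weight a l)
weight≢0 a l = subst NonZero (sym (weight≡ a l)) (m^n≢0 2 (5 * a + l))

mem : Grid → ℕ → ℕ → Bool
mem g a l = (g / weight a l) {{weight≢0 a l}} % 2 ≡ᵇ 1

-- The test is essential: adding the weight of a digit that is already 1 would carry into the next
-- digit.
ins : Grid → ℕ → ℕ → Grid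
ins g a l = if mem g a l then g else g + weight a l

mem≡bit : ∀ g a l → mem g a l ≡ bit g (5 * a + l)
mem≡bit g a l = cong (λ q → q % 2 ≡ᵇ 1) (/-congʳ {{weight≢0 a l}} {{m^n≢0 2 (5 * a + l)}} (weight≡ a l))

digit-injective : ∀ {a b l k} → l < 5 → k < 5 → 5 * b + k ≡ 5 * a + l → b ≡ a × k ≡ l
digit-injective {a} {b} {l} {k} l<5 k<5 eq = *-cancelˡ-≡ b a 5 (+-cancelʳ-≡ l (5 * b) (5 * a) (subst (λ z → 5 * b + z ≡ 5 * a + l) k≡l eq)) , k≡l
  where
  low : ∀ a {l} → l < 5 → (5 * a + l) % 5 ≡ l
  low a {l} l<5 = trans (cong (_% 5) (trans (+-comm (5 * a) l) (cong (l +_) (*-comm 5 a)))) (trans ([m+kn]%n≡m%n l a 5) (m<n⇒m%n≡m l<5))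
  k≡l : k ≡ l
  k≡l = trans (sym (low b k<5)) (trans (cong (_% 5) eq) (low a l<5))

mem-0 : ∀ a l → mem 0 a l ≡ false
mem-0 a l = cong (λ q → q % 2 ≡ᵇ 1) (0/n≡0 (weight a l) {{weight≢0 a l}})

mem-ins : ∀ g a l → mem (ins g a l) a l ≡ true
mem-ins g a l with mem g a l in eq
... | true = eq
... | false = trans (mem≡bit (g + weight a l) a l) (trans (cong (λ w → bit (g + w) (5 * a + l)) (weight≡ a l))
                (bit-set g (5 * a + l) (trans (sym (mem≡bit g a l)) eq)))

mem-ins-other : ∀ g a l b k → 5 * b + k ≢ 5 * a + l → mem (ins g a l) b k ≡ mem g b k
mem-ins-other g a l b k ne with mem g a l in eq
... | true = refl
... | false = trans (mem≡bit (g + weight a l) b k) (trans (cong (λ w → bit (g + w) (5 * b + k)) (weight≡ a l))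
                (trans (bit-other g (5 * a + l) (5 * b + k) (trans (sym (mem≡bit g a l)) eq) ne) (sym (mem≡bit g b k))))

mem-ins⁻ : ∀ g a {l} b {k} → l < 5 → k < 5 → mem (ins g a l) b k ≡ true → mem g b k ≡ true ⊎ (b ≡ a × k ≡ l)
mem-ins⁻ g a {l} b {k} l<5 k<5 eq with 5 * b + k ℕ.≟ 5 * a + l
... | yes e = inj₂ (digit-injective l<5 k<5 e)
... | no ne = inj₁ (trans (sym (mem-ins-other g a l b k ne)) eq)

mem-ins⁺ : ∀ g a l b k → mem g b k ≡ true → mem (ins g a l) b k ≡ true
mem-ins⁺ g a l b k eq with mem g a l in eq′
... | true = eq
... | false with 5 * b + k ℕ.≟ 5 * a + l
...   | no ne = trans (unset ne) eq
  where unset : 5 * b + k ≢ 5 * a + l → mem (g + weight a l) b k ≡ mem g b k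
        unset ne = trans (mem≡bit (g + weight a l) b k) (trans (cong (λ w → bit (g + w) (5 * b + k)) (weight≡ a l))
          (trans (bit-other g (5 * a + l) (5 * b + k) (trans (sym (mem≡bit g a l)) eq′) ne) (sym (mem≡bit g b k))))
...   | yes e = ⊥-elim (true≢false (trans (sym eq) (trans (mem≡bit g b k) (trans (cong (bit g) e) (trans (sym (mem≡bit g a l)) eq′)))))

-- Holds the excluded flip types, each given by three levels.
Cube : Set
Cube = List (List (List Bool))

on : Bool → Bool
on _ = true

mem3 : Cube → ℕ → ℕ → ℕ → Bool
mem3 c i a l = get false (get [] (get [] c i) a) l

ins3 : Cube → ℕ → ℕ → ℕ → Cube
ins3 c i a l = upd [] (λ g → upd [] (λ r → upd false on r l) g a) c i

mem3-ins3⁻ : ∀ c i a l {j b k} → mem3 (ins3 c i a l) j b k ≡ true → mem3 c j b k ≡ true ⊎ (j ≡ i × b ≡ a × k ≡ l)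
mem3-ins3⁻ c i a l {j} {b} {k} eq with j ℕ.≟ i
... | no j≢i = inj₁ (trans (cong (λ g → get false (get [] g b) k) (sym (get-upd-≢ [] _ c j≢i))) eq)
... | yes refl with b ℕ.≟ a
...   | no b≢a = inj₁ (trans (sym (trans (cong (λ g → get false (get [] g b) k) (get-upd [] _ c i))
                   (cong (λ r → get false r k) (get-upd-≢ [] _ (get [] c i) b≢a)))) eq)
...   | yes refl with k ℕ.≟ l
...     | yes refl = inj₂ (refl , refl , refl)
...     | no k≢l = inj₁ (trans (sym (trans (cong (λ g → get false (get [] g b) k) (get-upd [] _ c i))
                     (trans (cong (λ r → get false r k) (get-upd [] _ (get [] c i) a)) (get-upd-≢ false on (get [] (get [] c i) a) k≢l)))) eq)

module Run (h n : ℕ) .{{_ : NonZero n}} where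

  -- Four sides of lengths `2l + 1` add up to `4h`, so their levels add up to `2h - 2`.
  fourth : ℕ → ℕ → ℕ → ℕ
  fourth li l₁ lj = (h + h ∸ 2) ∸ (li + l₁ + lj)

  -- With `k = h` the row consists of the edges of level below `h` running clockwise from `a`; the
  -- edge of level `l` itself is exempt.
  rowFull : Grid → ℕ → ℕ → ℕ → Bool
  rowFull I a l zero = true
  rowFull I a l (suc k) = ((l ≡ᵇ k) ∨ mem I a k) ∧ rowFull I a l k

  -- I and O are the sets of edges that have entered and left so far.
  dies : Grid → ℕ → ℕ → Bool
  dies I a zero = mem I (a % n) 0 ∧ not (mem I ((a + (n ∸ 1)) % n) 1)
  dies I a (suc _) = false

  reenters : Grid → Grid → ℕ → ℕ → Bool
  reenters O I a l = mem O a l ∧ not (rowFull I a l h)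

  -- The edges E and E′ of the centre cell pre ++ E ∷ mid ++ E′ ∷ post, with E starting at z, are flipped: the new edge
  -- from x₁ hides mid, the new edge from x₃ hides post ++ pre, and what was behind E and E′ becomes visible.
  module Moves (forb : Cube) (k : ℕ → List Tree → Grid → Grid → Bool) (I O : Grid) where

    -- `∨` stops at the first rule that closes the branch, so what lies behind `E` and `E′` is
    -- guessed only if all rules fail. The type is looked up in `forb` in both of its readings.
    try₂ : List Tree → Tree → ℕ → ℕ → ℕ → List Tree → ℕ → Tree → List Tree → ℕ → ℕ → ℕ → ℕ → Bool
    try₂ pre E z li x₁ mid l₁ E′ post lj l₂ x₂ x₃ =
      mem I x₃ l₂ ∨ dies I z li ∨ dies I x₂ lj ∨ mem3 forb li l₁ lj ∨ mem3 forb lj l₂ li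
      ∨ reenters O I x₁ l₁ ∨ reenters O I x₃ l₂
      -- The new cell is read from `suc z`, the first point formerly behind `E`. The parts that
      -- become hidden are kept as `opn`, so they need not be guessed when they are uncovered again.
      ∨ every (λ c → every (λ c′ → k (suc z % n) (c ++ opn l₁ mid ∷ c′ ++ opn l₂ (post ++ pre) ∷ [])
                                     (ins (ins I x₁ l₁) x₃ l₂) (ins (ins O (z % n) li) (x₂ % n) lj))
                           (kids E′))
              (kids E)

    try : List Tree → Tree → ℕ → ℕ → ℕ → List Tree → ℕ → Tree → List Tree → ℕ → Bool
    try pre E z li x₁ mid l₁ E′ post lj =
      -- If `li + l₁ + lj + 2 ≤ h`, the fourth side would have level at least `h` and the flip would
      -- not be centred.
      (suc (li + l₁ + lj) <ᵇ h) ∨ mem I (x₁ % n) l₁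
      ∨ try₂ pre E z li (x₁ % n) mid l₁ E′ post lj (fourth li l₁ lj)
             (x₁ + suc (2 * l₁)) ((x₁ + suc (2 * l₁) + suc (2 * lj)) % n)

    inner : List Tree → Tree → ℕ → ℕ → ℕ → List Tree → ℕ → List Tree → Bool
    inner pre E z li x₁ mid l₁ [] = true
    inner pre E z li x₁ mid l₁ (E′ ∷ post) =
      (h ≤ᵇ l₁) ∨ (try pre E z li x₁ mid l₁ E′ post (lv E′) ∧ inner pre E z li x₁ (mid ++ E′ ∷ []) (l₁ + suc (lv E′)) post)

    outer : List Tree → ℕ → List Tree → Bool
    outer pre z [] = true
    outer pre z (E ∷ rest) =
      inner pre E z (lv E) (z + suc (2 * lv E)) [] 0 rest ∧ outer (pre ++ E ∷ []) (z + 2 * suc (lv E)) rest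

    inner-split : ∀ pre E z li x₁ mid l₁ m {E′ post} → inner pre E z li x₁ mid l₁ (m ++ E′ ∷ post) ≡ true → l₁ + sz m < h →
                  try pre E z li x₁ (mid ++ m) (l₁ + sz m) E′ post (lv E′) ≡ true
    inner-split pre E z li x₁ mid l₁ [] {E′} {post} eq b with ∨-true {h ≤ᵇ l₁} eq
    ... | inj₁ c = ⊥-elim (<⇒≱ b (≤-trans (≤ᵇ⇒≤ h l₁ (≡true⇒T c)) (m≤m+n l₁ 0)))
    ... | inj₂ c = subst₂ (λ a l → try pre E z li x₁ a l E′ post (lv E′) ≡ true) (sym (++-identityʳ mid)) (sym (+-identityʳ l₁)) (proj₁ (∧-true c))
    inner-split pre E z li x₁ mid l₁ (T ∷ m) {E′} {post} eq b with ∨-true {h ≤ᵇ l₁} eq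
    ... | inj₁ c = ⊥-elim (<⇒≱ b (≤-trans (≤ᵇ⇒≤ h l₁ (≡true⇒T c)) (m≤m+n l₁ (sz (T ∷ m)))))
    ... | inj₂ c = subst₂ (λ a l → try pre E z li x₁ a l E′ post (lv E′) ≡ true) (++-assoc mid (T ∷ []) m) (+-assoc l₁ (suc (lv T)) (sz m))
        (inner-split pre E z li x₁ (mid ++ T ∷ []) (l₁ + suc (lv T)) m (proj₂ (∧-true {try pre E z li x₁ mid l₁ T (m ++ E′ ∷ post) (lv T)} c))
          (subst (_< h) (sym (+-assoc l₁ (suc (lv T)) (sz m))) b))

    outer-split : ∀ pre z p {E rest} → outer pre z (p ++ E ∷ rest) ≡ true →
                  inner (pre ++ p) E (z + 2 * sz p) (lv E) (z + 2 * sz p + suc (2 * lv E)) [] 0 rest ≡ true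
    outer-split pre z [] {E} {rest} eq =
      subst₂ (λ a y → inner a E y (lv E) (y + suc (2 * lv E)) [] 0 rest ≡ true) (sym (++-identityʳ pre)) (sym (+-identityʳ z)) (proj₁ (∧-true eq))
    outer-split pre z (T ∷ p) {E} {rest} eq =
      subst₂ (λ a y → inner a E y (lv E) (y + suc (2 * lv E)) [] 0 rest ≡ true) (++-assoc pre (T ∷ []) p)
        (trans (+-assoc z _ _) (cong (z +_) (sym (*-distribˡ-+ 2 (suc (lv T)) (sz p)))))
        (outer-split (pre ++ T ∷ []) (z + 2 * suc (lv T)) p (proj₂ (∧-true {inner pre T z (lv T) (z + suc (2 * lv T)) [] 0 (p ++ E ∷ rest)} eq)))

    split-try : ∀ z p E m E′ q → outer [] z (p ++ E ∷ m ++ E′ ∷ q) ≡ true → sz m < h →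
                try p E (z + 2 * sz p) (lv E) (z + 2 * sz p + suc (2 * lv E)) m (sz m) E′ q (lv E′) ≡ true
    split-try z p E m E′ q eq b = inner-split p E _ (lv E) _ [] 0 m (outer-split [] z p eq) b

  refute : Cube → ℕ → ℕ → List Tree → Grid → Grid → Bool
  -- Running out of fuel is no refutation; `true` always stands for a completed search.
  refute forb zero z cen I O = false
  refute forb (suc f) z cen I O = Moves.outer forb (refute forb f) I O [] z cen

  -- The flip of the given type is taken as the first one, at position 0, and the search starts just
  -- after it: nothing is known behind its two new edges, and all possibilities behind its two old
  -- edges are tried.
  refuteType : Cube → ℕ → ℕ → ℕ → ℕ → Bool
  refuteType forb f li l₁ lj =
    every (λ c → every (λ c′ → refute forb f (1 % n) (c ++ hid l₁ ∷ c′ ++ hid (fourth li l₁ lj) ∷ [])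
                                 (ins (ins 0 (x₁ % n) l₁) (x₃ % n) (fourth li l₁ lj)) (ins (ins 0 (0 % n) li) (x₂ % n) lj))
                       (kids (hid lj)))
          (kids (hid li))
    where
    x₁ = 0 + suc (2 * li)
    x₂ = x₁ + suc (2 * l₁)
    x₃ = x₂ + suc (2 * lj)

  -- A flip type is given by the levels of three consecutive sides: old, new, old.
  elim : ℕ → Cube → List (ℕ × ℕ × ℕ) → Cube
  elim f forb [] = forb
  elim f forb ((li , l₁ , lj) ∷ qs) with refuteType forb f li l₁ lj
  ... | true = elim f (ins3 forb li l₁ lj) qs
  ... | false = elim f forb qs

  allBelow : ℕ → (ℕ → Bool) → Bool
  allBelow zero f = true
  allBelow (suc k) f = f k ∧ allBelow k f

  allBelow-< : ∀ k f {i} → allBelow k f ≡ true → i < k → f i ≡ true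
  allBelow-< (suc k) f eq i<k with m≤n⇒m<n∨m≡n (s≤s⁻¹ i<k)
  ... | inj₁ i<k′ = allBelow-< k f (proj₂ (∧-true {f k} eq)) i<k′
  ... | inj₂ refl = proj₁ (∧-true eq)

  -- No type outside forb lets an edge of level lev enter.
  coveredAt : ℕ → Cube → ℕ → ℕ → Bool
  coveredAt lev forb li lj = (h + h ∸ 2 <ᵇ li + lev + lj) ∨ (suc (li + lev + lj) <ᵇ h)
    ∨ mem3 forb li lev lj ∨ mem3 forb lj (fourth li lev lj) li

  covered : ℕ → Cube → Bool
  covered lev forb = allBelow h (λ li → allBelow h (coveredAt lev forb li))

  covered-sound : ∀ lev forb {li lj} → li < h → lj < h → covered lev forb ≡ true → coveredAt lev forb li lj ≡ true
  covered-sound lev forb {li} li<h lj<h eq = allBelow-< h (coveredAt lev forb li) (allBelow-< h _ eq li<h) lj<h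

-- Soundness of the search

module Cells (n : ℕ) .{{_ : NonZero n}} where
  open Quads n public

  mutual
    GoodT : (Fin n → Fin n) → ℕ → Tree → Set
    GoodT Q y (hid l) = Arc Q y (suc (2 * l))
    GoodT Q y (opn l ks) = Arc Q y (suc (2 * l)) × sz ks ≡ l × Good Q (suc y) ks

    Good : (Fin n → Fin n) → ℕ → List Tree → Set
    Good Q y [] = ⊤
    Good Q y (T ∷ ts) = GoodT Q y T × Good Q (y + 2 * suc (lv T)) ts

  good-arc : ∀ {Q y} T → GoodT Q y T → Arc Q y (suc (2 * lv T))
  good-arc (hid l) g = g
  good-arc (opn l ks) (g , _) = g

  next : ∀ y l s → y + 2 * suc l + 2 * s ≡ y + 2 * (suc l + s)
  next = solve-∀

  good-++ : ∀ {Q y} ts {us} → Good Q y ts → Good Q (y + 2 * sz ts) us → Good Q y (ts ++ us)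
  good-++ {Q} {y} [] {us} _ g = subst (λ z → Good Q z us) (+-identityʳ y) g
  good-++ {Q} {y} (T ∷ ts) {us} (a , b) g = a , good-++ ts b (subst (λ z → Good Q z us) (sym (next y (lv T) (sz ts))) g)

  good-++⁻ : ∀ {Q y} ts {us} → Good Q y (ts ++ us) → Good Q y ts × Good Q (y + 2 * sz ts) us
  good-++⁻ {Q} {y} [] {us} g = tt , subst (λ z → Good Q z us) (sym (+-identityʳ y)) g
  good-++⁻ {Q} {y} (T ∷ ts) {us} (a , b) with good-++⁻ ts b
  ... | c , d = (a , c) , subst (λ z → Good Q z us) (next y (lv T) (sz ts)) d

  mutual
    good-move : ∀ {Q y y′} ts → pt y ≡ pt y′ → Good Q y ts → Good Q y′ ts
    good-move [] eq _ = tt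
    good-move (T ∷ ts) eq (a , b) = goodT-move T eq a , good-move ts (pt-+-cong (2 * suc (lv T)) eq) b

    goodT-move : ∀ {Q y y′} T → pt y ≡ pt y′ → GoodT Q y T → GoodT Q y′ T
    goodT-move {Q} (hid l) eq a = Arc-cong Q (suc (2 * l)) eq a
    goodT-move {Q} {y} {y′} (opn l ks) eq (a , s , b) = Arc-cong Q (suc (2 * l)) eq a , s ,
      good-move ks (subst₂ (λ u v → pt u ≡ pt v) (+-comm y 1) (+-comm y′ 1) (pt-+-cong 1 eq)) b

  mutual
    -- A row speaks only of the points that it takes up. Therefore hidden edges can be carried along
    -- unchanged while flips happen elsewhere.
    good-keep : ∀ {Q Q′} y ts → (∀ u → u < 2 * sz ts → Q′ (pt (y + u)) ≡ Q (pt (y + u))) → Good Q y ts → Good Q′ y ts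
    good-keep y [] same _ = tt
    good-keep {Q} {Q′} y (T ∷ ts) same (a , b) =
      goodT-keep y T (λ u u< → same u (<-≤-trans u< (*-monoʳ-≤ 2 (m≤m+n (suc (lv T)) (sz ts))))) a ,
      good-keep (y + 2 * suc (lv T)) ts (λ u u< → subst (λ z → Q′ (pt z) ≡ Q (pt z)) (sym (+-assoc y _ u))
        (same (2 * suc (lv T) + u) (subst (2 * suc (lv T) + u <_) (sym (*-distribˡ-+ 2 (suc (lv T)) (sz ts))) (+-monoʳ-< (2 * suc (lv T)) u<)))) b

    goodT-keep : ∀ {Q Q′} y T → (∀ u → u < 2 * suc (lv T) → Q′ (pt (y + u)) ≡ Q (pt (y + u))) → GoodT Q y T → GoodT Q′ y T
    goodT-keep {Q} {Q′} y (hid l) same a = arc-keep Q Q′ y {l} same a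
    goodT-keep {Q} {Q′} y (opn l ks) same (a , s , b) = arc-keep Q Q′ y {l} same a , s ,
      good-keep (suc y) ks (λ u u< → subst (λ z → Q′ (pt z) ≡ Q (pt z)) (+-suc y u)
        (same (suc u) (subst (suc u <_) (sym (*-suc 2 l)) (s<s (<-trans (subst (λ k → u < 2 * k) s u<) (n<1+n (2 * l))))))) b

    arc-keep : ∀ Q Q′ y {l ℓ} → (∀ u → u < 2 * suc l → Q′ (pt (y + u)) ≡ Q (pt (y + u))) → Arc Q y ℓ → Arc Q′ y ℓ
    arc-keep Q Q′ y same a = trans (subst (λ z → Q′ (pt z) ≡ Q (pt z)) (+-identityʳ y) (same 0 z<s)) a

  arcs⇒good : ∀ {Q} y ls → Arcs Q y ls → Good Q y (map hid ls)
  arcs⇒good y [] _ = tt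
  arcs⇒good y (l ∷ ls) (a , b) = a , arcs⇒good (y + 2 * suc l) ls b

  sz-hid : ∀ ls → sz (map hid ls) ≡ szl ls
  sz-hid [] = refl
  sz-hid (l ∷ ls) = cong (suc l +_) (sz-hid ls)

  kids-exist : ∀ {Q} → Planar Q → ∀ y T → suc (2 * lv T) < n → GoodT Q y T →
               ∃ λ c → c ∈ kids T × sz c ≡ lv T × Good Q (suc y) c
  kids-exist pl y (hid l) b g with pocket pl y b g
  ... | ls , eq , arcs = map hid ls , subst (map hid ls ∈_) (sym (kids-hid l)) (∈-map⁺ (map hid) (comps-complete l ls (sym l≡))) ,
        trans (sz-hid ls) (sym l≡) , arcs⇒good (suc y) ls arcs
    where l≡ : l ≡ szl ls
          l≡ = *-cancelˡ-≡ l (szl ls) 2 eq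
  kids-exist pl y (opn l ks) b (_ , s , g) = ks , here refl , s , g

  Small : ℕ → List Tree → Set
  Small h = All (λ T → lv T < h)

  small-sz : ∀ {h} ts → sz ts ≤ h → Small h ts
  small-sz [] _ = []
  small-sz (T ∷ ts) b = ≤-trans (m≤m+n _ _) b ∷ small-sz ts (≤-trans (m≤n+m _ _) b)

  -- The position either starts an edge of the row, or lies behind one or at its far end. At the
  -- corners where `find` is applied, `not-covered` rules out the second case.
  find : ∀ {Q h} z ts o → o < 2 * sz ts → Good Q z ts → Small h ts →
         (∃ λ p → ∃ λ E → ∃ λ q → ts ≡ p ++ E ∷ q × o ≡ 2 * sz p) ⊎
         (∃ λ y → ∃ λ l → ∃ λ d → Arc Q y (suc (2 * l)) × l < h × 0 < d × d ≤ suc (2 * l) × z + o ≡ y + d)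
  find z (T ∷ ts) zero _ _ _ = inj₁ ([] , T , ts , refl , refl)
  find {Q} z (T ∷ ts) (suc o) b (g , gs) (s ∷ ss) with suc o <? 2 * suc (lv T)
  ... | yes o< = inj₂ (z , lv T , suc o , good-arc T g , s , z<s , s≤s⁻¹ (subst (suc o <_) (*-suc 2 (lv T)) o<) , refl)
  ... | no o≮ with m≤n⇒∃[o]m+o≡n (≮⇒≥ o≮)
  ... | o′ , eq with find (z + 2 * suc (lv T)) ts o′ (+-cancelˡ-< (2 * suc (lv T)) o′ _
                       (subst₂ _<_ (sym eq) (*-distribˡ-+ 2 (suc (lv T)) (sz ts)) b)) gs ss
  ...   | inj₁ (p , E , q , refl , o≡) = inj₁ (T ∷ p , E , q , refl , trans (sym eq) (trans (cong (2 * suc (lv T) +_) o≡) (sym (*-distribˡ-+ 2 (suc (lv T)) (sz p)))))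
  ...   | inj₂ (y , l , d , a , s′ , p , q , e) = inj₂ (y , l , d , a , s′ , p , q , trans (cong (z +_) (sym eq)) (trans (sym (+-assoc z (2 * suc (lv T)) o′)) e))

  quad-move : ∀ {P P′ x y g₁ g₂ g₃ g₄} → pt x ≡ pt y → Quad P P′ x g₁ g₂ g₃ g₄ → Quad P P′ y g₁ g₂ g₃ g₄
  quad-move {P} {P′} {x} {y} {g₁} {g₂} {g₃} {g₄} eq Q = record
    { old₁ = Arc-cong P g₁ eq old₁ ; new₁ = Arc-cong P′ g₂ c₁ new₁ ; old₂ = Arc-cong P g₃ c₂ old₂ ; new₂ = Arc-cong P′ g₄ c₃ new₂
    ; total = total ; pos₁ = pos₁ ; pos₂ = pos₂ ; pos₃ = pos₃ ; pos₄ = pos₄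
    ; same = λ q a b c d → same q (λ e → a (trans e eq)) (λ e → b (trans e c₁)) (λ e → c (trans e c₂)) (λ e → d (trans e c₃)) }
    where
    open Quad Q
    c₁ = pt-+-cong g₁ eq
    c₂ = pt-+-cong g₂ c₁
    c₃ = pt-+-cong g₃ c₂

  module _ {P P′ : Fin n → Fin n} (pl : Planar P) (pl′ : Planar P′) {x g₁ g₂ g₃ g₄} (Q : Quad P P′ x g₁ g₂ g₃ g₄) where
    open Quad Q
    private
      e₂ : x + g₁ + g₂ ≡ x + (g₁ + g₂)
      e₂ = +-assoc x g₁ g₂
      e₃ : x + g₁ + g₂ + g₃ ≡ x + (g₁ + g₂ + g₃)
      e₃ = trans (cong (_+ g₃) e₂) (+-assoc x (g₁ + g₂) g₃)

    off-corners : ∀ {e} → e < n → e ≢ 0 → e ≢ g₁ → e ≢ g₁ + g₂ → e ≢ g₁ + g₂ + g₃ → P′ (pt (x + e)) ≡ P (pt (x + e))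
    off-corners e<n a b c d = same _
      (λ eq → a (pt-inj x e<n (≤-<-trans z≤n e<n) (trans eq (cong pt (sym (+-identityʳ x))))))
      (λ eq → b (pt-inj x e<n (g₁<n pl pl′ Q) eq))
      (λ eq → c (pt-inj x e<n (o₂<n pl pl′ Q) (trans eq (cong pt e₂))))
      (λ eq → d (pt-inj x e<n (o₃<n pl pl′ Q) (trans eq (cong pt e₃))))

    gap₁ : ∀ {e} → 0 < e → e < g₁ → P′ (pt (x + e)) ≡ P (pt (x + e))
    gap₁ 0<e e< = off-corners (<-trans e< (g₁<n pl pl′ Q)) (>⇒≢ 0<e) (<⇒≢ e<) (<⇒≢ e<₂) (<⇒≢ (<-trans e<₂ (o₂<o₃ pl pl′ Q)))
      where e<₂ = <-trans e< (g₁<o₂ pl pl′ Q)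

    gap₂ : ∀ {e} → g₁ < e → e < g₁ + g₂ → P′ (pt (x + e)) ≡ P (pt (x + e))
    gap₂ <e e< = off-corners (<-trans e< (o₂<n pl pl′ Q)) (>⇒≢ (≤-<-trans z≤n <e)) (>⇒≢ <e) (<⇒≢ e<) (<⇒≢ (<-trans e< (o₂<o₃ pl pl′ Q)))

    gap₃ : ∀ {e} → g₁ + g₂ < e → e < g₁ + g₂ + g₃ → P′ (pt (x + e)) ≡ P (pt (x + e))
    gap₃ <e e< = off-corners (<-trans e< (o₃<n pl pl′ Q)) (>⇒≢ (≤-<-trans z≤n <e)) (>⇒≢ (<-trans (g₁<o₂ pl pl′ Q) <e)) (>⇒≢ <e) (<⇒≢ e<)

    gap₄ : ∀ {e} → g₁ + g₂ + g₃ < e → e < n → P′ (pt (x + e)) ≡ P (pt (x + e))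
    gap₄ <e e<n = off-corners e<n (>⇒≢ (≤-<-trans z≤n <e)) (>⇒≢ (<-trans (g₁<o₂ pl pl′ Q) <₂)) (>⇒≢ <₂) (>⇒≢ <e)
      where <₂ = <-trans (o₂<o₃ pl pl′ Q) <e

    -- Otherwise the whole quadrilateral would lie behind the edge from y, and one of its sides would exceed n/2.
    module _ {H} (n≡ : n ≡ H + H) (b₁ : g₁ < H) (b₂ : g₂ < H) (b₃ : g₃ < H) (b₄ : g₄ < H) where

      not-covered : ∀ {y ℓ d} → Arc P y ℓ → ℓ < H → 0 < d → d ≤ ℓ → pt x ≡ pt (y + d) → ⊥
      not-covered {y} {ℓ} {d} a ℓ<H 0<d d≤ℓ xy = go (m≤n⇒m<n∨m≡n d≤ℓ)
        where
        <n : ∀ {u v} → u < H → v < H → u + v < n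
        <n p q = subst (_ <_) (sym n≡) (+-mono-< p q)
        ℓ<n : ℓ < n
        ℓ<n = ≤-<-trans (m≤m+n ℓ 0) (<n ℓ<H (≤-<-trans z≤n ℓ<H))
        0<n : 0 < n
        0<n = ≤-<-trans z≤n ℓ<n
        d₁ = d + g₁
        d₂ = d + g₁ + g₂
        d₃ = d + g₁ + g₂ + g₃
        c₁ : pt (x + g₁) ≡ pt (y + d₁)
        c₁ = trans (pt-+-cong g₁ xy) (cong pt (+-assoc y d g₁))
        c₂ : pt (x + g₁ + g₂) ≡ pt (y + d₂)
        c₂ = trans (pt-+-cong g₂ c₁) (cong pt (+-assoc y d₁ g₂))
        c₃ : pt (x + g₁ + g₂ + g₃) ≡ pt (y + d₃)
        c₃ = trans (pt-+-cong g₃ c₂) (cong pt (+-assoc y d₂ g₃))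
        zero-off : ∀ {u} → 0 < u → u < n → pt y ≡ pt (y + u) → ⊥
        zero-off 0<u u<n eq = <⇒≢ 0<u (pt-inj y 0<n u<n (trans (cong pt (+-identityʳ y)) eq))
        go : d < ℓ ⊎ d ≡ ℓ → ⊥
        go (inj₂ refl) = zero-off (<-≤-trans 0<d (m≤m+n d g₁)) (<n ℓ<H b₁)
          (trans (sym (arc-back pl y d a)) (trans (cong P (sym xy)) (trans old₁ c₁)))
        go (inj₁ d<ℓ) with inside pl y 0<d d<ℓ ℓ<n a
        ... | w , _ , w<ℓ , e with pt-inj y (<-trans w<ℓ ℓ<n) (<n (<-trans d<ℓ ℓ<H) b₁) (trans (sym e) (trans (cong P (sym xy)) (trans old₁ c₁)))
        ... | refl = go₂ (corner pl pl′ Q (pt y))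
          where
          0<d₁ : 0 < d₁
          0<d₁ = <-≤-trans 0<d (m≤m+n d g₁)
          d₂<n : d₂ < n
          d₂<n = <n (<-trans w<ℓ ℓ<H) b₂
          go₂ : Corner pl pl′ Q (pt y) → ⊥
          go₂ (at₀ eq) = zero-off 0<d (<-trans d<ℓ ℓ<n) (trans eq xy)
          go₂ (at₁ eq) = zero-off 0<d₁ (<-trans w<ℓ ℓ<n) (trans eq c₁)
          go₂ (at₂ eq) = zero-off (<-≤-trans 0<d₁ (m≤m+n d₁ g₂)) d₂<n (trans eq c₂)
          go₂ (at₃ eq) with pt-inj y ℓ<n d₂<n (trans (sym a) (trans (cong P eq) (trans (P₃ pl pl′ Q) c₂)))
          ... | refl = zero-off (<-≤-trans (<-≤-trans 0<d₁ (m≤m+n d₁ g₂)) (m≤m+n d₂ g₃)) (<n ℓ<H b₃) (trans eq c₃)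
          -- If `y` is no corner, its edge survives the flip and confines the sides one after
          -- another, alternately in `P′` and `P`. Three gaps then fit behind it, and with the
          -- fourth below `H` they cannot make a full turn.
          go₂ (else p q r s) with inside pl′ y 0<d₁ w<ℓ ℓ<n (trans (same (pt y) p q r s) a)
          ... | w₂ , _ , w₂<ℓ , e₂′ with pt-inj y (<-trans w₂<ℓ ℓ<n) d₂<n (trans (sym e₂′) (trans (cong P′ (sym c₁)) (trans new₁ c₂)))
          ... | refl with inside pl y (<-≤-trans 0<d₁ (m≤m+n d₁ g₂)) w₂<ℓ ℓ<n a
          ... | w₃ , _ , w₃<ℓ , e₃′ with pt-inj y (<-trans w₃<ℓ ℓ<n) (<n (<-trans w₂<ℓ ℓ<H) b₃) (trans (sym e₃′) (trans (cong P (sym c₂)) (trans old₂ c₃)))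
          ... | refl = <-irrefl total (<n (<-trans (≤-<-trans below w₃<ℓ) ℓ<H) b₄)
            where
            below : g₁ + g₂ + g₃ ≤ d₃
            below = +-monoˡ-≤ g₃ (+-monoˡ-≤ g₂ (m≤n+m g₁ d))

module Sound {h K : ℕ} .{{nz : NonZero (2 * (2 * h))}} (S : FlipSystem h K) (1<h : 1 < h) (h≤5 : h ≤ 5) where
  private
    n H : ℕ
    n = 2 * (2 * h)
    H = 2 * h
  open Cells n
  open FlipSystem S
  open Dynamics h P
  open Run h n

  n≡H+H : n ≡ H + H
  n≡H+H = cong (H +_) (+-identityʳ H)

  odd<H : ∀ {l} → l < h → suc (2 * l) < H
  odd<H {l} l<h = subst (_≤ H) (*-suc 2 l) (*-monoʳ-≤ 2 l<h)

  odd<n : ∀ {l} → l < h → suc (2 * l) < n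
  odd<n l<h = <-≤-trans (odd<H l<h) (subst (H ≤_) (sym n≡H+H) (m≤m+n H H))

  flp-turn : ∀ {t x li l₁ lj l₂} → CentredFlip t x li l₁ lj l₂ → CentredFlip t (x + suc (2 * li) + suc (2 * l₁)) lj l₂ li l₁
  flp-turn F = record { quad = turn² quad ; li<h = lj<h ; l₁<h = l₂<h ; lj<h = li<h ; l₂<h = l₁<h }
    where open CentredFlip F

  flp-move : ∀ {t x y li l₁ lj l₂} → pt x ≡ pt y → CentredFlip t x li l₁ lj l₂ → CentredFlip t y li l₁ lj l₂
  flp-move eq F = record { quad = quad-move eq quad ; li<h = li<h ; l₁<h = l₁<h ; lj<h = lj<h ; l₂<h = l₂<h }
    where open CentredFlip F

  levels : ∀ {t x li l₁ lj l₂} → CentredFlip t x li l₁ lj l₂ → 2 + (li + l₁ + lj + l₂) ≡ H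
  levels {li = li} {l₁} {lj} {l₂} F = *-cancelˡ-≡ _ H 2 (trans (ring li l₁ lj l₂) (Quad.total (CentredFlip.quad F)))
    where ring : ∀ a b c d → 2 * (2 + (a + b + c + d)) ≡ suc (2 * a) + suc (2 * b) + suc (2 * c) + suc (2 * d)
          ring = solve-∀

  fourth≡ : ∀ {t x li l₁ lj l₂} → CentredFlip t x li l₁ lj l₂ → l₂ ≡ fourth li l₁ lj
  fourth≡ {li = li} {l₁} {lj} {l₂} F = sym (begin
    (h + h ∸ 2) ∸ (li + l₁ + lj)                     ≡⟨ cong (λ z → (z ∸ 2) ∸ (li + l₁ + lj)) (trans (cong (h +_) (sym (+-identityʳ h))) (sym (levels F))) ⟩
    (li + l₁ + lj + l₂) ∸ (li + l₁ + lj)             ≡⟨ m+n∸m≡n (li + l₁ + lj) l₂ ⟩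
    l₂                                               ∎)
    where open ≡-Reasoning

  covered-⊥ : ∀ {t x li l₁ lj l₂ y l d} → CentredFlip t x li l₁ lj l₂ → Arc (P t) y (suc (2 * l)) → l < h →
              0 < d → d ≤ suc (2 * l) → pt x ≡ pt (y + d) → ⊥
  covered-⊥ {t} F a l<h 0<d d≤ eq = not-covered (planarP t) (planarP (suc t)) (CentredFlip.quad F) n≡H+H
    (odd<H (CentredFlip.li<h F)) (odd<H (CentredFlip.l₁<h F)) (odd<H (CentredFlip.lj<h F)) (odd<H (CentredFlip.l₂<h F)) a (odd<H l<h) 0<d d≤ eq

  same-level : ∀ {t x l l′} → l < h → l′ < h → Arc (P t) x (suc (2 * l)) → Arc (P t) x (suc (2 * l′)) → l ≡ l′
  same-level {t} {x} {l} {l′} b b′ a a′ =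
    *-cancelˡ-≡ l l′ 2 (suc-injective (arc-unique (planarP t) x (odd<n b) (odd<n b′) a a′))

  record Found (t z : ℕ) (cen : List Tree) : Set where
    field
      {p m q} : List Tree
      {E E′}  : Tree
      {l₂}    : ℕ
      shape   : cen ≡ p ++ E ∷ m ++ E′ ∷ q
      flp     : CentredFlip t (z + 2 * sz p) (lv E) (sz m) (lv E′) l₂

  -- Both old sides must start at edges of the cell, since a corner hidden behind another edge
  -- contradicts `covered-⊥`. The last hypothesis puts the start of the second old side before the
  -- end of the reading, so `E′` comes after `E`.
  locate-from : ∀ {t z cen li l₁ lj l₂} o → Good (P t) z cen → Small h cen → sz cen ≡ H →
                CentredFlip t (z + o) li l₁ lj l₂ → o + suc (2 * li) + suc (2 * l₁) < n → Found t z cen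
  locate-from {t} {z} {cen} {li} {l₁} {lj} {l₂} o G sm size F room
    with find z cen o (subst (o <_) (cong (2 *_) (sym size)) (≤-<-trans (≤-trans (m≤m+n o _) (m≤m+n _ _)) room)) G sm
  ... | inj₂ (y , l , d , a , l<h , 0<d , d≤ , eq) = ⊥-elim (covered-⊥ F a l<h 0<d d≤ (cong pt eq))
  ... | inj₁ (p , E , rest , refl , refl) with good-++⁻ p G | ++⁻ʳ p sm
  ... | _ , gE , gs | E<h ∷ ss with same-level E<h (CentredFlip.li<h F) (good-arc E gE) (Quad.old₁ (CentredFlip.quad F))
  ... | refl with find (z + 2 * sz p + 2 * suc (lv E)) rest (2 * l₁) fits gs ss
    where
    ring₁ : ∀ a e l → 2 * a + suc (2 * e) + suc (2 * l) ≡ 2 * a + 2 * suc e + 2 * l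
    ring₁ = solve-∀
    ring₂ : ∀ a e r → 2 * (a + (suc e + r)) ≡ 2 * a + 2 * suc e + 2 * r
    ring₂ = solve-∀
    fits : 2 * l₁ < 2 * sz rest
    fits = +-cancelˡ-< (2 * sz p + 2 * suc (lv E)) _ _ (subst₂ _<_ (ring₁ (sz p) (lv E) l₁)
             (trans (cong (2 *_) (trans (sym size) (sz-++ p (E ∷ rest)))) (ring₂ (sz p) (lv E) (sz rest))) room)
  ... | inj₂ (y , l , d , a , l<h , 0<d , d≤ , eq) = ⊥-elim (covered-⊥ (flp-turn F) a l<h 0<d d≤ (cong pt (trans (ring z (sz p) (lv E) l₁) eq)))
    where ring : ∀ z a e l → z + 2 * a + suc (2 * e) + suc (2 * l) ≡ z + 2 * a + 2 * suc e + 2 * l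
          ring = solve-∀
  ... | inj₁ (m , E′ , q , refl , eq) with *-cancelˡ-≡ l₁ (sz m) 2 eq
  ... | refl with good-++⁻ m gs | ++⁻ʳ m ss
  ... | _ , gE′ , _ | E′<h ∷ _ with same-level {x = z + 2 * sz p + 2 * suc (lv E) + 2 * sz m} E′<h (CentredFlip.lj<h F) (good-arc E′ gE′)
                                   (subst (λ y → Arc (P t) y (suc (2 * lj))) (ring z (sz p) (lv E) (sz m)) (Quad.old₂ (CentredFlip.quad F)))
    where ring : ∀ z a e l → z + 2 * a + suc (2 * e) + suc (2 * l) ≡ z + 2 * a + 2 * suc e + 2 * l
          ring = solve-∀
  ... | refl = record { shape = refl ; flp = F }

  -- Of the two descriptions of a flip, at least one meets its old sides in reading order: if the
  -- first two gaps from offset `o` reach past the origin `z`, then the opposite old side starts at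
  -- `o′`, and from there two gaps lead to `o < n`.
  locate : ∀ {t z cen} → Good (P t) z cen → Small h cen → sz cen ≡ H → Found t z cen
  locate {t} {z} {cen} G sm size with flip t
  ... | x , li , l₁ , lj , l₂ , F with pt-sur z (pt x)
  ... | o , o<n , eq with o + suc (2 * li) + suc (2 * l₁) <? n
  ...   | yes room = locate-from o G sm size (flp-move (sym eq) F) room
  ...   | no full with m≤n⇒∃[o]m+o≡n (≮⇒≥ full)
  ...     | o′ , o≡ = locate-from o′ G sm size (flp-move moved (flp-turn F)) room
    where
    moved : pt (x + suc (2 * li) + suc (2 * l₁)) ≡ pt (z + o′)
    moved = begin
      pt (x + suc (2 * li) + suc (2 * l₁))         ≡⟨ pt-+-cong (suc (2 * l₁)) (pt-+-cong (suc (2 * li)) (sym eq)) ⟩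
      pt (z + o + suc (2 * li) + suc (2 * l₁))     ≡⟨ cong pt (assoc z o (suc (2 * li)) (suc (2 * l₁))) ⟩
      pt (z + (o + suc (2 * li) + suc (2 * l₁)))   ≡⟨ cong (λ y → pt (z + y)) (sym o≡) ⟩
      pt (z + (n + o′))                            ≡⟨ cong pt (swap z n o′) ⟩
      pt (z + o′ + n)                              ≡⟨ pt-+N (z + o′) ⟩
      pt (z + o′)                                  ∎
      where
      open ≡-Reasoning
      assoc : ∀ a b c d → a + b + c + d ≡ a + (b + c + d)
      assoc = solve-∀
      swap : ∀ a b c → a + (b + c) ≡ a + c + b
      swap = solve-∀
    room : o′ + suc (2 * lj) + suc (2 * l₂) < n
    room = +-cancelˡ-< n _ n (subst (_< n + n) (sym shift) (+-monoˡ-< n o<n))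
      where
      open ≡-Reasoning
      assoc₁ : ∀ a b c d → a + (b + c + d) ≡ a + b + c + d
      assoc₁ = solve-∀
      assoc₂ : ∀ o a b c d → o + a + b + c + d ≡ o + (a + b + c + d)
      assoc₂ = solve-∀
      shift : n + (o′ + suc (2 * lj) + suc (2 * l₂)) ≡ o + n
      shift = begin
        n + (o′ + suc (2 * lj) + suc (2 * l₂))                               ≡⟨ assoc₁ n o′ (suc (2 * lj)) (suc (2 * l₂)) ⟩
        n + o′ + suc (2 * lj) + suc (2 * l₂)                                 ≡⟨ cong (λ y → y + suc (2 * lj) + suc (2 * l₂)) o≡ ⟩
        o + suc (2 * li) + suc (2 * l₁) + suc (2 * lj) + suc (2 * l₂)        ≡⟨ assoc₂ o (suc (2 * li)) (suc (2 * l₁)) (suc (2 * lj)) (suc (2 * l₂)) ⟩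
        o + (suc (2 * li) + suc (2 * l₁) + suc (2 * lj) + suc (2 * l₂))      ≡⟨ cong (o +_) (Quad.total (CentredFlip.quad F)) ⟩
        o + n                                                                ∎

  record Cell (t z : ℕ) (cen : List Tree) : Set where
    field
      good  : Good (P t) z cen
      size  : sz cen ≡ H
      small : Small h cen

  -- After a flip the centre cell consists of the two new edges and of the edges that the two old ones covered.
  new-cell : ∀ {t X} c F₁ c′ F₂ → CentredFlip t X (sz c) (lv F₁) (sz c′) (lv F₂) →
             Good (P t) (suc X) c → Good (P t) (suc (X + suc (2 * sz c) + suc (2 * lv F₁))) c′ →
             GoodT (P (suc t)) (X + suc (2 * sz c)) F₁ →
             GoodT (P (suc t)) (X + suc (2 * sz c) + suc (2 * lv F₁) + suc (2 * sz c′)) F₂ →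
             Cell (suc t) (suc X) (c ++ F₁ ∷ c′ ++ F₂ ∷ [])
  new-cell {t} {X} c F₁ c′ F₂ F gc gc′ g₁ g₂ = record { good = good ; size = size ; small = small }
    where
    open CentredFlip F
    a = suc (2 * sz c)
    b = suc (2 * lv F₁)
    pl = planarP t
    pl′ = planarP (suc t)
    kc : Good (P (suc t)) (suc X) c
    kc = good-keep (suc X) c (λ u u< → subst (λ y → P (suc t) (pt y) ≡ P t (pt y)) (+-suc X u) (gap₁ pl pl′ quad z<s (s<s u<))) gc
    kc′ : Good (P (suc t)) (suc (X + a + b)) c′
    kc′ = good-keep (suc (X + a + b)) c′ (λ u u< → subst (λ y → P (suc t) (pt y) ≡ P t (pt y)) (ring X a b u)
            (gap₃ pl pl′ quad (m<m+n (a + b) z<s) (+-monoʳ-< (a + b) (s<s u<)))) gc′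
      where ring : ∀ x a b u → x + (a + b + suc u) ≡ suc (x + a + b) + u
            ring = solve-∀
    good : Good (P (suc t)) (suc X) (c ++ F₁ ∷ c′ ++ F₂ ∷ [])
    good = good-++ c kc (subst (λ y → Good (P (suc t)) y (F₁ ∷ c′ ++ F₂ ∷ [])) (+-suc X (2 * sz c))
      (g₁ , subst (λ y → Good (P (suc t)) y (c′ ++ F₂ ∷ [])) (ring₁ X a (lv F₁))
        (good-++ c′ kc′ (subst (λ y → Good (P (suc t)) y (F₂ ∷ [])) (+-suc (X + a + b) (2 * sz c′)) (g₂ , tt)))))
      where ring₁ : ∀ x a l → suc (x + a + suc (2 * l)) ≡ x + a + 2 * suc l
            ring₁ = solve-∀
    size : sz (c ++ F₁ ∷ c′ ++ F₂ ∷ []) ≡ H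
    size = trans (sz-++ c _) (trans (cong (λ y → sz c + (suc (lv F₁) + y)) (sz-++ c′ _)) (trans (ring (sz c) (lv F₁) (sz c′) (lv F₂)) (levels F)))
      where ring : ∀ a b c d → a + (suc b + (c + (suc d + 0))) ≡ 2 + (a + b + c + d)
            ring = solve-∀
    small : Small h (c ++ F₁ ∷ c′ ++ F₂ ∷ [])
    small = ++⁺ (small-sz c (<⇒≤ li<h)) (l₁<h ∷ ++⁺ (small-sz c′ (<⇒≤ lj<h)) (l₂<h ∷ []))

  advance : ∀ {t z} p E m E′ q {l₂} c c′ → Cell t z (p ++ E ∷ m ++ E′ ∷ q) →
            CentredFlip t (z + 2 * sz p) (lv E) (sz m) (lv E′) l₂ →
            sz c ≡ lv E → Good (P t) (suc (z + 2 * sz p)) c →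
            sz c′ ≡ lv E′ → Good (P t) (suc (z + 2 * sz p + suc (2 * lv E) + suc (2 * sz m))) c′ →
            Cell (suc t) (suc (z + 2 * sz p)) (c ++ opn (sz m) m ∷ c′ ++ opn l₂ (q ++ p) ∷ [])
  advance {t} {z} p E m E′ q {l₂} c c′ cell F sc gc sc′ gc′ =
    new-cell c (opn (sz m) m) c′ (opn l₂ (q ++ p)) (subst₂ (λ a b → CentredFlip t X a (sz m) b l₂) (sym sc) (sym sc′) F)
      gc (subst (λ a → Good (P t) (suc (X + suc (2 * a) + suc (2 * sz m))) c′) (sym sc) gc′)
      (subst (λ a → GoodT (P (suc t)) (X + suc (2 * a)) (opn (sz m) m)) (sym sc) (Quad.new₁ quad , refl , gm))
      (subst₂ (λ a b → GoodT (P (suc t)) (X + suc (2 * a) + suc (2 * sz m) + suc (2 * b)) (opn l₂ (q ++ p))) (sym sc) (sym sc′)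
        (Quad.new₂ quad , sqp , gqp))
    where
    open CentredFlip F
    open Cell cell
    X = z + 2 * sz p
    e = lv E
    e′ = lv E′
    pl = planarP t
    pl′ = planarP (suc t)
    gp = proj₁ (good-++⁻ p good)
    gE = proj₂ (good-++⁻ p good)
    gm₀ = proj₁ (good-++⁻ m (proj₂ gE))
    gE′ = proj₂ (good-++⁻ m (proj₂ gE))
    unit₁ : ∀ x e → x + 2 * suc e ≡ suc (x + suc (2 * e))
    unit₁ = solve-∀
    gm : Good (P (suc t)) (suc (X + suc (2 * e))) m
    gm = good-keep (suc (X + suc (2 * e))) m (λ u u< → subst (λ y → P (suc t) (pt y) ≡ P t (pt y)) (ring X (suc (2 * e)) u)
           (gap₂ pl pl′ quad (m<m+n (suc (2 * e)) z<s) (+-monoʳ-< (suc (2 * e)) (s<s u<))))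
           (subst (λ y → Good (P t) y m) (unit₁ X e) gm₀)
      where ring : ∀ x a u → x + (a + suc u) ≡ suc (x + a) + u
            ring = solve-∀
    sizes : sz p + (suc e + (sz m + (suc e′ + sz q))) ≡ H
    sizes = trans (cong (λ y → sz p + (suc e + y)) (sym (sz-++ m (E′ ∷ q)))) (trans (sym (sz-++ p _)) size)
    sqp : sz (q ++ p) ≡ l₂
    sqp = trans (sz-++ q p) (+-cancelˡ-≡ (2 + (e + sz m + e′)) _ _ (trans (ring (sz p) e (sz m) e′ (sz q)) (trans sizes (sym (levels F)))))
      where ring : ∀ p e m e′ q → 2 + (e + m + e′) + (q + p) ≡ p + (suc e + (m + (suc e′ + q)))
            ring = solve-∀
    x₃ = X + suc (2 * e) + suc (2 * sz m) + suc (2 * e′)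
    -- This row passes the origin of the reading: after `q` one arrives at `p` a full turn later.
    gqp₀ : Good (P t) (suc x₃) (q ++ p)
    gqp₀ = good-++ q (subst (λ y → Good (P t) y q) (ring₁ X e (sz m) e′) (proj₂ gE′))
             (good-move p (sym (trans (cong pt around) (pt-+N z))) gp)
      where
      ring₁ : ∀ x e m e′ → x + 2 * suc e + 2 * m + 2 * suc e′ ≡ suc (x + suc (2 * e) + suc (2 * m) + suc (2 * e′))
      ring₁ = solve-∀
      ring₂ : ∀ z p e m e′ q → suc (z + 2 * p + suc (2 * e) + suc (2 * m) + suc (2 * e′)) + 2 * q ≡ z + 2 * (p + (suc e + (m + (suc e′ + q))))
      ring₂ = solve-∀
      around : suc x₃ + 2 * sz q ≡ z + n
      around = trans (ring₂ z (sz p) e (sz m) e′ (sz q)) (cong (λ y → z + 2 * y) sizes)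
    gqp : Good (P (suc t)) (suc x₃) (q ++ p)
    gqp = good-keep (suc x₃) (q ++ p) (λ u u< → subst (λ y → P (suc t) (pt y) ≡ P t (pt y)) (ring X (suc (2 * e)) (suc (2 * sz m)) (suc (2 * e′)) u)
            (gap₄ pl pl′ quad (m<m+n _ z<s) (<-≤-trans (+-monoʳ-< (suc (2 * e) + suc (2 * sz m) + suc (2 * e′)) (s<s (subst (λ k → u < 2 * k) sqp u<)))
              (≤-reflexive (Quad.total quad))))) gqp₀
      where ring : ∀ x a b c u → x + (a + b + c + suc u) ≡ suc (x + a + b + c) + u
            ring = solve-∀

  arc? : ∀ t a l → Dec (Arc (P t) a (suc (2 * l)))
  arc? t a l = P t (pt a) ≟ pt (a + suc (2 * l))

  enter-move : ∀ {v a b l} → pt a ≡ pt b → Enter v a l → Enter v b l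
  enter-move {v} {a} {b} {l} eq (¬x , y) = (λ x → ¬x (Arc-cong (P v) (suc (2 * l)) (sym eq) x)) , Arc-cong (P (suc v)) (suc (2 * l)) eq y

  exit-move : ∀ {v a b l} → pt a ≡ pt b → Exit v a l → Exit v b l
  exit-move {v} {a} {b} {l} eq (x , ¬y) = Arc-cong (P v) (suc (2 * l)) eq x , (λ y → ¬y (Arc-cong (P (suc v)) (suc (2 * l)) (sym eq) y))

  enters-between : ∀ s d {a l} → ¬ Arc (P s) a (suc (2 * l)) → Arc (P (s + d)) a (suc (2 * l)) → ∃ λ v → s ≤ v × v < s + d × Enter v a l
  enters-between s zero {a} {l} ¬x y = ⊥-elim (¬x (subst (λ u → Arc (P u) a (suc (2 * l))) (+-identityʳ s) y))
  enters-between s (suc d) {a} {l} ¬x y with arc? (suc s) a l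
  ... | yes z = s , ≤-refl , m<m+n s z<s , ¬x , z
  ... | no ¬z with enters-between (suc s) d ¬z (subst (λ u → Arc (P u) a (suc (2 * l))) (+-suc s d) y)
  ...   | v , s<v , v< , e = v , <⇒≤ s<v , subst (v <_) (sym (+-suc s d)) v< , e

  module _ {t X li l₁ lj l₂} (F : CentredFlip t X li l₁ lj l₂) where
    open CentredFlip F
    private
      pl = planarP t
      pl′ = planarP (suc t)
      x₁ = X + suc (2 * li)
      x₂ = x₁ + suc (2 * l₁)
      x₃ = x₂ + suc (2 * lj)

    enter₁ : Enter t x₁ l₁
    enter₁ = (λ a → 0≢₂ pl pl′ quad (trans (sym (P₁ pl pl′ quad)) a)) , Quad.new₁ quad

    enter₃ : Enter t x₃ l₂
    enter₃ = (λ a → 0≢₂ pl pl′ quad (sym (trans (sym (P₃ pl pl′ quad)) (trans a (loop {P = P t} {P′ = P t} X (Quad.total quad)))))) , Quad.new₂ quad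

    exit₀ : Exit t X li
    exit₀ = Quad.old₁ quad , (λ a → 1≢₃ pl pl′ quad (trans (sym a) (P′₀ pl pl′ quad)))

    exit₂ : Exit t x₂ lj
    exit₂ = Quad.old₂ quad , (λ a → 1≢₃ pl pl′ quad (trans (sym (P′₂ pl pl′ quad)) a))

    -- The other two corners are the far ends of the new edges. A clockwise arc of level below `h`
    -- from a far end to its partner would, with the new edge itself, make a closed walk of fewer
    -- than `n` steps.
    entering : ∀ {a l} → l < h → Enter t a l → (pt a ≡ pt x₁ × l ≡ l₁) ⊎ (pt a ≡ pt x₃ × l ≡ l₂)
    entering {a} {l} l<h (¬x , y) with corner pl pl′ quad (pt a)
    ... | at₁ eq = inj₁ (eq , same-level l<h l₁<h (Arc-cong (P (suc t)) (suc (2 * l)) eq y) (Quad.new₁ quad))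
    ... | at₃ eq = inj₂ (eq , same-level l<h l₂<h (Arc-cong (P (suc t)) (suc (2 * l)) eq y) (Quad.new₂ quad))
    ... | else p q r s = ⊥-elim (¬x (trans (sym (Quad.same quad (pt a) p q r s)) y))
    ... | at₂ eq = ⊥-elim (1+n≢0 (sym (pt-inj x₁ (≤-<-trans z≤n (odd<n l<h)) (<-≤-trans (+-mono-< (odd<H l₁<h) (odd<H l<h)) (≤-reflexive (sym n≡H+H)))
          (trans (cong pt (+-identityʳ x₁)) (trans (sym (P′₂ pl pl′ quad)) (trans (Arc-cong (P (suc t)) (suc (2 * l)) eq y) (cong pt (+-assoc x₁ _ _))))))))
    ... | at₀ eq = ⊥-elim (1+n≢0 (sym (pt-inj x₃ (≤-<-trans z≤n (odd<n l<h)) (<-≤-trans (+-mono-< (odd<H l₂<h) (odd<H l<h)) (≤-reflexive (sym n≡H+H)))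
          (trans (cong pt (+-identityʳ x₃)) (trans (sym (P′₀ pl pl′ quad)) (trans (Arc-cong (P (suc t)) (suc (2 * l)) eq y)
            (trans (pt-+-cong (suc (2 * l)) (sym (loop {P = P t} {P′ = P t} X (Quad.total quad)))) (cong pt (+-assoc x₃ _ _)))))))))

  key : ∀ ξ x → pt (ξ + x % n) ≡ pt (ξ + x)
  key ξ x = trans (cong pt (+-comm ξ (x % n))) (trans (pt-+-cong ξ (pt-%N x)) (cong pt (+-comm x ξ)))

  -- The two grids record the edges entering and leaving at times τ ≤ v < t, relative to the origin ξ.
  record Book (τ ξ t : ℕ) (I O : Grid) : Set where
    field
      inS  : ∀ {a l} → l < h → mem I a l ≡ true → ∃ λ v → τ ≤ v × v < t × Enter v (ξ + a) l
      inC  : ∀ {a l v} → a < n → l < h → τ ≤ v → v < t → Enter v (ξ + a) l → mem I a l ≡ true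
      outS : ∀ {a l} → l < h → mem O a l ≡ true → ∃ λ v → τ ≤ v × v < t × Exit v (ξ + a) l

  book-0 : ∀ {τ ξ} → Book τ ξ τ 0 0
  book-0 = record { inS = λ {a} {l} _ eq → ⊥-elim (true≢false (trans (sym eq) (mem-0 a l)))
                  ; inC = λ _ _ τ≤v v<τ _ → ⊥-elim (<⇒≱ v<τ τ≤v)
                  ; outS = λ {a} {l} _ eq → ⊥-elim (true≢false (trans (sym eq) (mem-0 a l))) }

  -- `I` must be exact, because the rules use both presence in it and absence from it; completeness
  -- comes from `entering`. For `O` soundness is enough, as the rules only use presence.
  book-step : ∀ {τ ξ t I O z li l₁ lj l₂} → let x₁ = z + suc (2 * li); x₂ = x₁ + suc (2 * l₁); x₃ = x₂ + suc (2 * lj) in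
              τ ≤ t → Book τ ξ t I O → CentredFlip t (ξ + z) li l₁ lj l₂ →
              Book τ ξ (suc t) (ins (ins I (x₁ % n) l₁) (x₃ % n) l₂) (ins (ins O (z % n) li) (x₂ % n) lj)
  book-step {τ} {ξ} {t} {I} {O} {z} {li} {l₁} {lj} {l₂} τ≤t B F = record { inS = inS′ ; inC = inC′ ; outS = outS′ }
    where
    open Book B
    open CentredFlip F
    x₁ = z + suc (2 * li)
    x₂ = x₁ + suc (2 * l₁)
    x₃ = x₂ + suc (2 * lj)
    a₁ : ξ + z + suc (2 * li) ≡ ξ + x₁
    a₁ = +-assoc ξ z _
    a₂ : ξ + z + suc (2 * li) + suc (2 * l₁) ≡ ξ + x₂
    a₂ = trans (cong (_+ suc (2 * l₁)) a₁) (+-assoc ξ x₁ _)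
    a₃ : ξ + z + suc (2 * li) + suc (2 * l₁) + suc (2 * lj) ≡ ξ + x₃
    a₃ = trans (cong (_+ suc (2 * lj)) a₂) (+-assoc ξ x₂ _)
    <5 : ∀ {l} → l < h → l < 5
    <5 l<h = <-≤-trans l<h h≤5
    I₁ = ins I (x₁ % n) l₁
    O₁ = ins O (z % n) li
    inS′ : ∀ {a l} → l < h → mem (ins I₁ (x₃ % n) l₂) a l ≡ true → ∃ λ v → τ ≤ v × v < suc t × Enter v (ξ + a) l
    inS′ {a} l<h eq with mem-ins⁻ I₁ (x₃ % n) a (<5 l₂<h) (<5 l<h) eq
    ... | inj₂ (refl , refl) = t , τ≤t , ≤-refl , enter-move (trans (cong pt a₃) (sym (key ξ x₃))) (enter₃ F)
    ... | inj₁ eq′ with mem-ins⁻ I (x₁ % n) a (<5 l₁<h) (<5 l<h) eq′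
    ...   | inj₂ (refl , refl) = t , τ≤t , ≤-refl , enter-move (trans (cong pt a₁) (sym (key ξ x₁))) (enter₁ F)
    ...   | inj₁ eq″ with inS l<h eq″
    ...     | v , τ≤v , v<t , e = v , τ≤v , m<n⇒m<1+n v<t , e
    outS′ : ∀ {a l} → l < h → mem (ins O₁ (x₂ % n) lj) a l ≡ true → ∃ λ v → τ ≤ v × v < suc t × Exit v (ξ + a) l
    outS′ {a} l<h eq with mem-ins⁻ O₁ (x₂ % n) a (<5 lj<h) (<5 l<h) eq
    ... | inj₂ (refl , refl) = t , τ≤t , ≤-refl , exit-move (trans (cong pt a₂) (sym (key ξ x₂))) (exit₂ F)
    ... | inj₁ eq′ with mem-ins⁻ O (z % n) a (<5 li<h) (<5 l<h) eq′
    ...   | inj₂ (refl , refl) = t , τ≤t , ≤-refl , exit-move (sym (key ξ z)) (exit₀ F)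
    ...   | inj₁ eq″ with outS l<h eq″
    ...     | v , τ≤v , v<t , e = v , τ≤v , m<n⇒m<1+n v<t , e
    inC′ : ∀ {a l v} → a < n → l < h → τ ≤ v → v < suc t → Enter v (ξ + a) l → mem (ins I₁ (x₃ % n) l₂) a l ≡ true
    inC′ {a} {l} {v} a<n l<h τ≤v v<1+t e with m≤n⇒m<n∨m≡n (s≤s⁻¹ v<1+t)
    ... | inj₁ v<t = mem-ins⁺ I₁ (x₃ % n) l₂ a l (mem-ins⁺ I (x₁ % n) l₁ a l (inC a<n l<h τ≤v v<t e))
    ... | inj₂ refl with entering F l<h e
    ...   | inj₁ (eq , refl) with pt-inj ξ a<n (m%n<n x₁ n) (trans eq (trans (cong pt a₁) (sym (key ξ x₁))))
    ...     | refl = mem-ins⁺ I₁ (x₃ % n) l₂ (x₁ % n) l₁ (mem-ins I (x₁ % n) l₁)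
    inC′ {a} {l} {v} a<n l<h τ≤v v<1+t e | inj₂ refl | inj₂ (eq , refl) with pt-inj ξ a<n (m%n<n x₃ n) (trans eq (trans (cong pt a₃) (sym (key ξ x₃))))
    ...     | refl = mem-ins I₁ (x₃ % n) l₂

  0<h : 0 < h
  0<h = <-trans z<s 1<h

  module _ {τ ξ t I O} (B : Book τ ξ t I O) (τ≤t : τ ≤ t) (t<τ+K : t < τ + K) where
    open Book B

    no-reentry : ∀ {a l} → l < h → mem I a l ≡ true → Enter t (ξ + a) l → ⊥
    no-reentry l<h eq e with inS l<h eq
    ... | v , τ≤v , v<t , e′ = once l<h e′ e v<t (<-≤-trans t<τ+K (+-monoˡ-≤ K τ≤v))

    -- Absence from `I` tells about the future: the entry that the window of `K` steps from `τ` must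
    -- contain has not happened before `t`.
    unmarked-late : ∀ {a l} → a < n → l < h → mem I a l ≡ false → ∃ λ v → t ≤ v × v < τ + K × Enter v (ξ + a) l
    unmarked-late {a} {l} a<n l<h eq with ent τ (ξ + a) l<h
    ... | v , τ≤v , v<τ+K , e with v <? t
    ...   | yes v<t = ⊥-elim (true≢false (trans (sym (inC a<n l<h τ≤v v<t e)) eq))
    ...   | no v≮t = v , ≮⇒≥ v≮t , v<τ+K , e

    -- A length-3 edge is only ever present together with the length-1 edge below it.
    dies-sound : ∀ {a l} → dies I a l ≡ true → Exit t (ξ + a) l → ⊥
    dies-sound {a} {zero} eq x with ∧-true {mem I (a % n) 0} eq
    ... | marked , unmarked with inS 0<h marked | unmarked-late (m%n<n (a + (n ∸ 1)) n) 1<h (not-true unmarked)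
    ... | v₀ , τ≤v₀ , v₀<t , e₀ | v , t≤v , v<τ+K , (_ , arc) = late (m≤n⇒m<n∨m≡n t≤v)
      where
      y = ξ + (a + (n ∸ 1)) % n
      1≤n : 1 ≤ n
      1≤n = ≤-trans (s≤s z≤n) (odd<n 0<h)
      y+1 : pt (y + 1) ≡ pt (ξ + a)
      y+1 = begin
        pt (y + 1)                    ≡⟨ pt-+-cong 1 (key ξ (a + (n ∸ 1))) ⟩
        pt (ξ + (a + (n ∸ 1)) + 1)    ≡⟨ cong pt (ring ξ a (n ∸ 1)) ⟩
        pt (ξ + a + (n ∸ 1 + 1))      ≡⟨ cong (λ k → pt (ξ + a + k)) (m∸n+n≡m 1≤n) ⟩
        pt (ξ + a + n)                ≡⟨ pt-+N (ξ + a) ⟩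
        pt (ξ + a)                    ∎
        where
        open ≡-Reasoning
        ring : ∀ x a b → x + (a + b) + 1 ≡ x + a + (b + 1)
        ring = solve-∀
      below : Arc (P (suc v)) (ξ + a) 1
      below with inside (planarP (suc v)) y {1} {3} z<s (s<s z<s) (odd<n 1<h) arc
      ... | suc zero , _ , _ , eq′ = ⊥-elim (Planar.nofix (planarP (suc v)) _ eq′)
      ... | suc (suc zero) , _ , _ , eq′ = trans (cong (P (suc v)) (sym y+1))
              (trans eq′ (trans (cong pt (sym (+-assoc y 1 1))) (pt-+-cong 1 y+1)))
      ... | suc (suc (suc w)) , _ , s≤s (s≤s (s≤s ())) , _
      late : t < v ⊎ t ≡ v → ⊥
      late (inj₂ refl) = Exit.after x below
      -- The edge of length 1 is absent after `t` and present after `v`, so it enters in between,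
      -- less than `K` steps after its entry at `v₀`.
      late (inj₁ t<v) with m≤n⇒∃[o]m+o≡n (m<n⇒m<1+n t<v)
      ... | d , d≡ with enters-between (suc t) d (Exit.after x) (subst (λ u → Arc (P u) (ξ + a) 1) (sym d≡) below)
      ... | w , t<w , w< , e = once 0<h (enter-move (key ξ a) e₀) e (<-trans v₀<t t<w)
              (<-≤-trans (≤-<-trans (s≤s⁻¹ (subst (w <_) d≡ w<)) v<τ+K) (+-monoˡ-≤ K τ≤v₀))

    rowFull-false : ∀ a l k → rowFull I a l k ≡ false → ∃ λ l′ → l′ < k × l′ ≢ l × mem I a l′ ≡ false
    rowFull-false a l (suc k) eq with l ≡ᵇ k in leq | mem I a k in g
    ... | true | _ with rowFull-false a l k eq
    ...   | l′ , b , ne , q = l′ , m<n⇒m<1+n b , ne , q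
    rowFull-false a l (suc k) eq | false | true with rowFull-false a l k eq
    ...   | l′ , b , ne , q = l′ , m<n⇒m<1+n b , ne , q
    rowFull-false a l (suc k) eq | false | false = k , ≤-refl , (λ { refl → subst T leq (≡⇒≡ᵇ k k refl) }) , g

    -- An edge that left at a time u ≥ τ and enters again at t stays until u + K,
    -- so the other edges at its endpoint must have entered before t.
    reenters-sound : ∀ {a l} → a < n → l < h → reenters O I a l ≡ true → Enter t (ξ + a) l → ⊥
    reenters-sound {a} {l} a<n l<h eq e with ∧-true {mem O a l} eq
    ... | marked , notfull with outS l<h marked | rowFull-false a l h (not-true notfull)
    ... | u , τ≤u , u<t , (gone , _) | l′ , l′<h , l′≢l , unmarked with unmarked-late a<n l′<h unmarked
    ... | v , t≤v , v<τ+K , (_ , arc′) with arc? (suc v) (ξ + a) l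
    ...   | yes arc = l′≢l (same-level l′<h l<h arc′ arc)
    -- The edge was present at time `u`, hence by periodicity also at `u + K`. Displaced after `v`,
    -- it would have to enter again before `u + K < t + K`.
    ...   | no ¬arc with m≤n⇒∃[o]m+o≡n (≤-trans v<τ+K (≤-trans (+-monoˡ-≤ K τ≤u) (≤-reflexive (+-comm u K))))
    ...     | d , d≡ with enters-between (suc v) d ¬arc (subst (λ s → Arc (P s) (ξ + a) (suc (2 * l))) (sym d≡) (trans (period u _) gone))
    ...       | w , v<w , w< , e′ = once l<h e e′ (≤-<-trans t≤v v<w)
                  (<-trans (subst (w <_) (trans d≡ (+-comm K u)) w<) (+-monoˡ-< K u<t))

  -- Quantified over all times and positions: this is why an exclusion found at one place can prune
  -- all later searches.
  NoType : ℕ → ℕ → ℕ → Set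
  NoType li l₁ lj = ∀ {t x l₂} → ¬ CentredFlip t x li l₁ lj l₂

  Forbids : Cube → Set
  Forbids forb = ∀ {li l₁ lj} → mem3 forb li l₁ lj ≡ true → NoType li l₁ lj

  module _ {forb : Cube} (fb : Forbids forb) where

    -- `τ` is the time at which the book was opened and `ξ` the true place of position 0. The
    -- condition `t + f ≤ τ + K` keeps every step of the search within the period in which the rules
    -- are valid.
    refute-sound : ∀ f {τ ξ t z cen I O} → τ ≤ t → t + f ≤ τ + K → Cell t (ξ + z) cen → Book τ ξ t I O →
                   refute forb f z cen I O ≡ true → ⊥
    refute-sound (suc f) {τ} {ξ} {t} {z} {cen} {I} {O} τ≤t t+f≤ cell B eq
      with locate (Cell.good cell) (Cell.small cell) (Cell.size cell)
    ... | record { p = p ; m = m ; q = q ; E = E ; E′ = E′ ; l₂ = l₂ ; shape = refl ; flp = F₀ } with fourth≡ F₀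
    ... | refl = rules (split-try z p E m E′ q eq (CentredFlip.l₁<h F₀))
      where
      open Moves forb (refute forb f) I O
      z′ = z + 2 * sz p
      li = lv E
      l₁ = sz m
      lj = lv E′
      x₁ = z′ + suc (2 * li)
      x₂ = x₁ + suc (2 * l₁)
      x₃ = x₂ + suc (2 * lj)
      F : CentredFlip t (ξ + z′) li l₁ lj l₂
      F = subst (λ y → CentredFlip t y li l₁ lj l₂) (+-assoc ξ z (2 * sz p)) F₀
      open CentredFlip F
      t<τ+K : t < τ + K
      t<τ+K = <-≤-trans (m<m+n t z<s) t+f≤
      a₁ : ξ + z′ + suc (2 * li) ≡ ξ + x₁
      a₁ = +-assoc ξ z′ _
      a₂ : ξ + z′ + suc (2 * li) + suc (2 * l₁) ≡ ξ + x₂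
      a₂ = trans (cong (_+ suc (2 * l₁)) a₁) (+-assoc ξ x₁ _)
      a₃ : ξ + z′ + suc (2 * li) + suc (2 * l₁) + suc (2 * lj) ≡ ξ + x₃
      a₃ = trans (cong (_+ suc (2 * lj)) a₂) (+-assoc ξ x₂ _)
      in₁ : Enter t (ξ + x₁ % n) l₁
      in₁ = enter-move (trans (cong pt a₁) (sym (key ξ x₁))) (enter₁ F)
      in₃ : Enter t (ξ + x₃ % n) l₂
      in₃ = enter-move (trans (cong pt a₃) (sym (key ξ x₃))) (enter₃ F)
      rec : ∀ c c′ → sz c ≡ li → sz c′ ≡ lj →
            Good (P t) (suc (ξ + z + 2 * sz p)) c → Good (P t) (suc (ξ + z + 2 * sz p + suc (2 * li) + suc (2 * l₁))) c′ →
            refute forb f (suc z′ % n) (c ++ opn l₁ m ∷ c′ ++ opn l₂ (q ++ p) ∷ [])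
              (ins (ins I (x₁ % n) l₁) (x₃ % n) l₂) (ins (ins O (z′ % n) li) (x₂ % n) lj) ≡ true → ⊥
      rec c c′ sc sc′ gc gc′ =
        refute-sound f (m≤n⇒m≤1+n τ≤t) (subst (_≤ τ + K) (+-suc t f) t+f≤)
          (record { good = good-move _ pos (Cell.good new) ; size = Cell.size new ; small = Cell.small new })
          (book-step τ≤t B F)
        where
        new = advance p E m E′ q c c′ cell F₀ sc gc sc′ gc′
        pos : pt (suc (ξ + z + 2 * sz p)) ≡ pt (ξ + suc z′ % n)
        pos = trans (cong pt (trans (cong suc (+-assoc ξ z (2 * sz p))) (sym (+-suc ξ z′)))) (sym (key ξ (suc z′)))
      expand : every (λ c → every (λ c′ → refute forb f (suc z′ % n) (c ++ opn l₁ m ∷ c′ ++ opn l₂ (q ++ p) ∷ [])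
                 (ins (ins I (x₁ % n) l₁) (x₃ % n) l₂) (ins (ins O (z′ % n) li) (x₂ % n) lj)) (kids E′)) (kids E) ≡ true → ⊥
      expand eq′ with kids-exist (planarP t) (ξ + z + 2 * sz p) E (odd<n li<h) gE
                    | kids-exist (planarP t) (ξ + z + 2 * sz p + 2 * suc li + 2 * l₁) E′ (odd<n lj<h) gE′
        where
        gE = proj₁ (proj₂ (good-++⁻ p (Cell.good cell)))
        gE′ = proj₁ (proj₂ (good-++⁻ m (proj₂ (proj₂ (good-++⁻ p (Cell.good cell))))))
      ... | c , c∈ , sc , gc | c′ , c′∈ , sc′ , gc′ =
        rec c c′ sc sc′ gc (subst (λ y → Good (P t) (suc y) c′) (ring (ξ + z + 2 * sz p) li l₁) gc′)
          (every-∈ _ (every-∈ _ eq′ c∈) c′∈)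
        where ring : ∀ x e l → x + 2 * suc e + 2 * l ≡ x + suc (2 * e) + suc (2 * l)
              ring = solve-∀
      rules₂ : try₂ p E z′ li (x₁ % n) m l₁ E′ q lj l₂ x₂ (x₃ % n) ≡ true → ⊥
      rules₂ =
        or-⊥ {mem I (x₃ % n) l₂} (λ r → no-reentry B τ≤t t<τ+K l₂<h r in₃) (
        or-⊥ {dies I z′ li} (λ r → dies-sound B τ≤t t<τ+K r (exit₀ F)) (
        or-⊥ {dies I x₂ lj} (λ r → dies-sound B τ≤t t<τ+K r (exit-move (cong pt a₂) (exit₂ F))) (
        or-⊥ {mem3 forb li l₁ lj} (λ r → fb r F) (
        or-⊥ {mem3 forb lj l₂ li} (λ r → fb r (flp-turn F)) (
        or-⊥ {reenters O I (x₁ % n) l₁} (λ r → reenters-sound B τ≤t t<τ+K (m%n<n x₁ n) l₁<h r in₁) (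
        or-⊥ {reenters O I (x₃ % n) l₂} (λ r → reenters-sound B τ≤t t<τ+K (m%n<n x₃ n) l₂<h r in₃)
        expand))))))
      rules : (suc (li + l₁ + lj) <ᵇ h) ∨ mem I (x₁ % n) l₁ ∨ try₂ p E z′ li (x₁ % n) m l₁ E′ q lj l₂ x₂ (x₃ % n) ≡ true → ⊥
      rules = or-⊥ {suc (li + l₁ + lj) <ᵇ h} (λ r → <-irrefl (levels F) (subst₂ _≤_ (ring (li + l₁ + lj) l₂) (cong (h +_) (sym (+-identityʳ h)))
                                                      (+-mono-≤ (<ᵇ⇒< (suc (li + l₁ + lj)) h (≡true⇒T r)) l₂<h)))
                (or-⊥ {mem I (x₁ % n) l₁} (λ r → no-reentry B τ≤t t<τ+K l₁<h r in₁) rules₂)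
        where ring : ∀ a b → suc (suc a) + suc b ≡ suc (2 + (a + b))
              ring = solve-∀

    private
      start-sound : ∀ f {t x li l₁ lj l₂} c c′ → suc f ≤ K → CentredFlip t x li l₁ lj l₂ →
                    sz c ≡ li → Good (P t) (suc x) c → sz c′ ≡ lj → Good (P t) (suc (x + suc (2 * li) + suc (2 * l₁))) c′ →
                    let x₁ = 0 + suc (2 * li); x₂ = x₁ + suc (2 * l₁); x₃ = x₂ + suc (2 * lj) in
                    refute forb f (1 % n) (c ++ hid l₁ ∷ c′ ++ hid l₂ ∷ [])
                      (ins (ins 0 (x₁ % n) l₁) (x₃ % n) l₂) (ins (ins 0 (0 % n) li) (x₂ % n) lj) ≡ true → ⊥
      start-sound f {t} {x} {_} {l₁} {_} {l₂} c c′ f<K F refl gc refl gc′ =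
        -- The book is opened at the flip itself, with `τ = t` and `ξ = x`. That flip uses up one
        -- step of the period, hence `suc f ≤ K`.
        refute-sound f {t} {x} (n≤1+n t) (subst (_≤ t + K) (+-suc t f) (+-monoʳ-≤ t f<K))
          (record { good = good-move (c ++ hid l₁ ∷ c′ ++ hid l₂ ∷ []) pos (Cell.good new) ; size = Cell.size new ; small = Cell.small new })
          (book-step ≤-refl book-0 (subst (λ y → CentredFlip t y (sz c) l₁ (sz c′) l₂) (sym (+-identityʳ x)) F))
        where
        new = new-cell c (hid l₁) c′ (hid l₂) F gc gc′ (Quad.new₁ (CentredFlip.quad F)) (Quad.new₂ (CentredFlip.quad F))
        pos : pt (suc x) ≡ pt (x + 1 % n)
        pos = trans (cong pt (+-comm 1 x)) (sym (key x 1))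

    refuteType-sound : ∀ f {li l₁ lj} → suc f ≤ K → refuteType forb f li l₁ lj ≡ true → NoType li l₁ lj
    refuteType-sound f {li} {l₁} {lj} f<K eq {t} {x} {l₂} F =
      let (c , c∈ , sc , gc) = kids-exist (planarP t) x (hid li) (odd<n (CentredFlip.li<h F)) (Quad.old₁ (CentredFlip.quad F))
          (c′ , c′∈ , sc′ , gc′) = kids-exist (planarP t) (x + suc (2 * li) + suc (2 * l₁)) (hid lj) (odd<n (CentredFlip.lj<h F)) (Quad.old₂ (CentredFlip.quad F))
      in start-sound f c c′ f<K (subst (CentredFlip t x li l₁ lj) (fourth≡ F) F) sc gc sc′ gc′ (every-∈ _ (every-∈ _ eq c∈) c′∈)

  elim-sound : ∀ f qs {forb} → suc f ≤ K → Forbids forb → Forbids (elim f forb qs)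
  elim-sound f [] f<K fb = fb
  elim-sound f ((li , l₁ , lj) ∷ qs) {forb} f<K fb with refuteType forb f li l₁ lj in eq
  ... | false = elim-sound f qs f<K fb
  ... | true = elim-sound f qs f<K fb′
    where
    fb′ : Forbids (ins3 forb li l₁ lj)
    fb′ m with mem3-ins3⁻ forb li l₁ lj m
    ... | inj₁ old = fb old
    ... | inj₂ (refl , refl , refl) = refuteType-sound fb f f<K eq

  -- The edge of level `lev` at point 0 has to enter as one of the two new sides of some flip;
  -- `flp-turn` makes it the one that `covered` speaks of.
  contradiction : ∀ f lev qs → suc f ≤ K → lev < h → covered lev (elim f [] qs) ≡ true → ⊥
  contradiction f lev qs f<K lev<h eq with ent 0 0 lev<h
  ... | v , _ , _ , e with flip v
  ... | x , li , l₁ , lj , l₂ , F = finish (entering F lev<h e)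
    where
    fb : Forbids (elim f [] qs)
    fb = elim-sound f qs f<K (λ ())
    absurd : ∀ {x li lj l₂} → CentredFlip v x li lev lj l₂ → ⊥
    absurd {x} {li} {lj} {l₂} G with fourth≡ G
    ... | refl =
      or-⊥ {h + h ∸ 2 <ᵇ li + lev + lj} (λ r → <⇒≱ (<ᵇ⇒< _ _ (≡true⇒T r))
             (subst (li + lev + lj ≤_) (cong (_∸ 2) (trans (levels G) (cong (h +_) (+-identityʳ h)))) (m≤m+n _ l₂))) (
      or-⊥ {suc (li + lev + lj) <ᵇ h} (λ r → <-irrefl (levels G) (subst₂ _≤_ (ring (li + lev + lj) l₂) (cong (h +_) (sym (+-identityʳ h)))
             (+-mono-≤ (<ᵇ⇒< (suc (li + lev + lj)) h (≡true⇒T r)) (CentredFlip.l₂<h G)))) (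
      or-⊥ {mem3 (elim f [] qs) li lev lj} (λ m → fb m G) (λ m → fb m (flp-turn G))))
        (covered-sound lev (elim f [] qs) (CentredFlip.li<h G) (CentredFlip.lj<h G) eq)
      where ring : ∀ a b → suc (suc a) + suc b ≡ suc (2 + (a + b))
            ring = solve-∀
    finish : (pt 0 ≡ pt (x + suc (2 * li)) × lev ≡ l₁) ⊎ (pt 0 ≡ pt (x + suc (2 * li) + suc (2 * l₁) + suc (2 * lj)) × lev ≡ l₂) → ⊥
    finish (inj₁ (_ , refl)) = absurd F
    finish (inj₂ (_ , refl)) = absurd (flp-turn F)


-- `n` is an argument of its own so that the search runs on a numeral. `h ≤ 5` is the capacity of a
-- grid row, and `f` is one less than the number `2h²` of flips.
no-rainbow : ∀ h n .{{_ : NonZero n}} f lev qs → n ≡ 2 * (2 * h) → 1 < h → h ≤ 5 → lev < h → suc f ≡ 2 * (h * h) →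
             sum {n} (λ i → sum {n} (λ j → opp i j * Lengths.len n i j)) ≡ 8 * (h * h * h) →
             Run.covered h n lev (Run.elim h n f [] qs) ≡ true → ¬ RainbowCycle (2 * h) 1
no-rainbow h _ f lev qs refl 1<h h≤5 lev<h f≡ total searched R =
  Sound.contradiction (EvenCycle.system h total R) 1<h h≤5 f lev qs (≤-reflexive f≡) lev<h searched

-- The orders were chosen to keep the search trees small.
order-6 : List (ℕ × ℕ × ℕ)
order-6 =
    (0 , 2 , 0) ∷ (1 , 1 , 1) ∷ (2 , 0 , 2) ∷ (1 , 1 , 0) ∷ (2 , 0 , 1) ∷ (2 , 1 , 0) ∷ (2 , 0 , 0) ∷
    (1 , 0 , 1) ∷ (0 , 1 , 1) ∷ (1 , 0 , 2) ∷ []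

search-6 : Run.covered 3 12 1 (Run.elim 3 12 17 [] order-6) ≡ true
search-6 = refl

no-rainbow-6 : ¬ RainbowCycle 6 1
-- Here `17 = 2 * 3² - 1`, and the edges of level 1 are found unable to enter, that is, those of
-- length 3. For `m = 8` and `m = 10` it is the edges of lengths 5 and 9.
no-rainbow-6 = no-rainbow 3 12 17 1 order-6 refl (s<s z<s) (≤ᵇ⇒≤ 3 5 _) (<ᵇ⇒< 1 3 _) refl refl search-6

order-8 : List (ℕ × ℕ × ℕ)
order-8 =
    (0 , 3 , 0) ∷ (1 , 2 , 1) ∷ (2 , 1 , 2) ∷ (1 , 1 , 2) ∷ (2 , 1 , 1) ∷ (3 , 0 , 3) ∷ (0 , 2 , 1) ∷
    (1 , 1 , 1) ∷ (2 , 0 , 3) ∷ (3 , 1 , 1) ∷ (3 , 0 , 2) ∷ (1 , 2 , 0) ∷ (2 , 0 , 2) ∷ (2 , 2 , 0) ∷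
    (3 , 1 , 0) ∷ (2 , 1 , 0) ∷ (3 , 0 , 1) ∷ (2 , 0 , 1) ∷ (0 , 1 , 3) ∷ (3 , 0 , 0) ∷ (1 , 0 , 2) ∷
    (1 , 0 , 3) ∷ []

search-8 : Run.covered 4 16 2 (Run.elim 4 16 31 [] order-8) ≡ true
search-8 = refl

no-rainbow-8 : ¬ RainbowCycle 8 1
no-rainbow-8 = no-rainbow 4 16 31 2 order-8 refl (s<s z<s) (≤ᵇ⇒≤ 4 5 _) (<ᵇ⇒< 2 4 _) refl refl search-8

order-10 : List (ℕ × ℕ × ℕ)
order-10 =
    (0 , 4 , 0) ∷ (1 , 3 , 1) ∷ (0 , 3 , 1) ∷ (1 , 3 , 0) ∷ (2 , 2 , 2) ∷ (1 , 2 , 1) ∷ (2 , 1 , 1) ∷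
    (1 , 1 , 2) ∷ (2 , 3 , 0) ∷ (2 , 1 , 2) ∷ (2 , 2 , 0) ∷ (0 , 2 , 2) ∷ (4 , 2 , 0) ∷ (3 , 2 , 0) ∷
    (3 , 0 , 1) ∷ (3 , 1 , 0) ∷ (2 , 2 , 1) ∷ (1 , 0 , 3) ∷ (0 , 1 , 3) ∷ (3 , 1 , 1) ∷ (2 , 0 , 2) ∷
    (3 , 0 , 3) ∷ (0 , 1 , 4) ∷ (1 , 1 , 4) ∷ (4 , 1 , 1) ∷ (4 , 1 , 2) ∷ (4 , 0 , 0) ∷ (0 , 0 , 4) ∷ []

search-10 : Run.covered 5 20 4 (Run.elim 5 20 49 [] order-10) ≡ true
search-10 = refl

no-rainbow-10 : ¬ RainbowCycle 10 1
no-rainbow-10 = no-rainbow 5 20 49 4 order-10 refl (s<s z<s) (≤ᵇ⇒≤ 5 5 _) (<ᵇ⇒< 4 5 _) refl refl search-10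


-- Explicit cycles

-- Row t of the table is the partner function at time t; pivot t is an endpoint of an edge flipped at time t.
module Table (m r k : ℕ) (table : Vec (Vec ℕ (2 * m)) (suc k)) (pivots : Vec ℕ (suc k))
             .{{_ : NonZero (2 * m)}} where

  p : Fin (suc k) → Point m → Point m
  p t x = lookup (lookup table t) x mod (2 * m)

  a c : Fin (suc k) → Point m
  a t = lookup pivots t mod (2 * m)
  c t = p (csuc t) (a t)

  involutive? : Dec (∀ t x → p t (p t x) ≡ x)
  involutive? = all? λ t → all? λ x → p t (p t x) ≟ x

  fixedFree? : Dec (∀ t x → p t x ≢ x)
  fixedFree? = all? λ t → all? λ x → ¬? (p t x ≟ x)

  nonCrossing? : Dec (∀ t x y → toℕ x < toℕ (p t x) → toℕ y < toℕ (p t y) → toℕ x < toℕ y →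
                   toℕ y < toℕ (p t x) → toℕ (p t y) < toℕ (p t x))
  nonCrossing? = all? λ t → all? λ x → all? λ y →
    (toℕ x <? toℕ (p t x)) →-dec ((toℕ y <? toℕ (p t y)) →-dec ((toℕ x <? toℕ y) →-dec
      ((toℕ y <? toℕ (p t x)) →-dec (toℕ (p t y) <? toℕ (p t x)))))

  distinct? : Dec (∀ s t → (∀ x → p s x ≡ p t x) → s ≡ t)
  distinct? = all? λ s → all? λ t → all? (λ x → p s x ≟ p t x) →-dec (s ≟ t)

  arcs? : Dec (∀ t → c t ≢ a t × c t ≢ p t (a t) × p (csuc t) (p t (a t)) ≡ p t (c t) ×
               (∀ x → x ≢ a t → x ≢ p t (a t) → x ≢ c t → x ≢ p t (c t) → p (csuc t) x ≡ p t x))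
  arcs? = all? λ t → ¬? (c t ≟ a t) ×-dec (¬? (c t ≟ p t (a t)) ×-dec ((p (csuc t) (p t (a t)) ≟ p t (c t)) ×-dec
    (
     all? λ x → ¬? (x ≟ a t) →-dec (¬? (x ≟ p t (a t)) →-dec (¬? (x ≟ c t) →-dec (¬? (x ≟ p t (c t)) →-dec (p (csuc t) x ≟ p t x)))))))

  -- The filter has the same decision term as `inLabel?`, so the number checked is by definition the
  -- one in `RainbowCycle`; only `Odd` is replaced by a decidable remainder.
  rainbow? : Dec (∀ i j → toℕ i < toℕ j → (toℕ j ∸ toℕ i) % 2 ≡ 1 →
    length (filter (λ t → (p (csuc t) i ≟ j) ×-dec ¬? (p t i ≟ j)) (allFin (suc k))) ≡ r)
  rainbow? = all? λ i → all? λ j → (toℕ i <? toℕ j) →-dec (((toℕ j ∸ toℕ i) % 2 ℕ.≟ 1) →-dec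
    (length (filter (λ t → (p (csuc t) i ≟ j) ×-dec ¬? (p t i ≟ j)) (allFin (suc k))) ℕ.≟ r))

  cycle : True involutive? → True fixedFree? → True nonCrossing? → True distinct? → True arcs? → True rainbow? → RainbowCycle m r
  cycle inv fix nc dis arc rain = record
    { k = k
    ; C = λ t → record
        { partner = p t ; involutive = toWitness inv t ; fixedFree = toWitness fix t ; nonCrossing = toWitness nc t }
    ; distinct = toWitness dis
    ; arcs = λ t → let (h₁ , h₂ , h₃ , h₄) = toWitness arc t in
        a t , p t (a t) , c t , p t (c t) , refl , refl , h₁ , h₂ , refl , h₃ , h₄
    ; rainbow = λ i j (i<j , odd) → toWitness rain i j i<j (odd% odd) }
    where
    odd% : ∀ {d} → Odd d → d % 2 ≡ 1
    odd% (l , refl) = trans (cong (λ z → suc z % 2) (*-comm 2 l)) ([m+kn]%n≡m%n 1 l 2)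

-- There are `m²` labels and each flip carries two of them, so an `r`-rainbow cycle has `r * m² / 2`
-- flips: here 2, and 8, 36 and 64 in the tables below.
cycle-2 : RainbowCycle 2 1
cycle-2 = Table.cycle 2 1 1
  ( (1 ∷ 0 ∷ 3 ∷ 2 ∷ []) ∷
    (3 ∷ 2 ∷ 1 ∷ 0 ∷ []) ∷ [])
  (0 ∷ 0 ∷ [])
  _ _ _ _ _ _

-- The second half is the first half rotated by four points, a half turn.
cycle-4 : RainbowCycle 4 1
cycle-4 = Table.cycle 4 1 7
  ( (1 ∷ 0 ∷ 3 ∷ 2 ∷ 7 ∷ 6 ∷ 5 ∷ 4 ∷ []) ∷
    (7 ∷ 4 ∷ 3 ∷ 2 ∷ 1 ∷ 6 ∷ 5 ∷ 0 ∷ []) ∷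
    (7 ∷ 6 ∷ 3 ∷ 2 ∷ 5 ∷ 4 ∷ 1 ∷ 0 ∷ []) ∷
    (7 ∷ 2 ∷ 1 ∷ 6 ∷ 5 ∷ 4 ∷ 3 ∷ 0 ∷ []) ∷
    (3 ∷ 2 ∷ 1 ∷ 0 ∷ 5 ∷ 4 ∷ 7 ∷ 6 ∷ []) ∷
    (5 ∷ 2 ∷ 1 ∷ 4 ∷ 3 ∷ 0 ∷ 7 ∷ 6 ∷ []) ∷
    (1 ∷ 0 ∷ 5 ∷ 4 ∷ 3 ∷ 2 ∷ 7 ∷ 6 ∷ []) ∷
    (1 ∷ 0 ∷ 7 ∷ 4 ∷ 3 ∷ 6 ∷ 5 ∷ 2 ∷ []) ∷ [])
  (0 ∷ 1 ∷ 1 ∷ 0 ∷ 0 ∷ 0 ∷ 2 ∷ 2 ∷ [])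
  _ _ _ _ _ _

-- Three blocks of 12 matchings, each the previous block rotated by four points.
cycle-6 : RainbowCycle 6 2
cycle-6 = Table.cycle 6 2 35
  ( (1 ∷ 0 ∷ 3 ∷ 2 ∷ 5 ∷ 4 ∷ 11 ∷ 8 ∷ 7 ∷ 10 ∷ 9 ∷ 6 ∷ []) ∷
    (1 ∷ 0 ∷ 11 ∷ 6 ∷ 5 ∷ 4 ∷ 3 ∷ 8 ∷ 7 ∷ 10 ∷ 9 ∷ 2 ∷ []) ∷
    (1 ∷ 0 ∷ 7 ∷ 6 ∷ 5 ∷ 4 ∷ 3 ∷ 2 ∷ 11 ∷ 10 ∷ 9 ∷ 8 ∷ []) ∷
    (7 ∷ 2 ∷ 1 ∷ 6 ∷ 5 ∷ 4 ∷ 3 ∷ 0 ∷ 11 ∷ 10 ∷ 9 ∷ 8 ∷ []) ∷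
    (3 ∷ 2 ∷ 1 ∷ 0 ∷ 5 ∷ 4 ∷ 7 ∷ 6 ∷ 11 ∷ 10 ∷ 9 ∷ 8 ∷ []) ∷
    (11 ∷ 2 ∷ 1 ∷ 8 ∷ 5 ∷ 4 ∷ 7 ∷ 6 ∷ 3 ∷ 10 ∷ 9 ∷ 0 ∷ []) ∷
    (11 ∷ 8 ∷ 3 ∷ 2 ∷ 5 ∷ 4 ∷ 7 ∷ 6 ∷ 1 ∷ 10 ∷ 9 ∷ 0 ∷ []) ∷
    (11 ∷ 4 ∷ 3 ∷ 2 ∷ 1 ∷ 8 ∷ 7 ∷ 6 ∷ 5 ∷ 10 ∷ 9 ∷ 0 ∷ []) ∷
    (11 ∷ 10 ∷ 3 ∷ 2 ∷ 9 ∷ 8 ∷ 7 ∷ 6 ∷ 5 ∷ 4 ∷ 1 ∷ 0 ∷ []) ∷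
    (11 ∷ 10 ∷ 9 ∷ 4 ∷ 3 ∷ 8 ∷ 7 ∷ 6 ∷ 5 ∷ 2 ∷ 1 ∷ 0 ∷ []) ∷
    (11 ∷ 10 ∷ 5 ∷ 4 ∷ 3 ∷ 2 ∷ 7 ∷ 6 ∷ 9 ∷ 8 ∷ 1 ∷ 0 ∷ []) ∷
    (11 ∷ 2 ∷ 1 ∷ 4 ∷ 3 ∷ 10 ∷ 7 ∷ 6 ∷ 9 ∷ 8 ∷ 5 ∷ 0 ∷ []) ∷
    (11 ∷ 2 ∷ 1 ∷ 10 ∷ 5 ∷ 4 ∷ 7 ∷ 6 ∷ 9 ∷ 8 ∷ 3 ∷ 0 ∷ []) ∷
    (11 ∷ 2 ∷ 1 ∷ 6 ∷ 5 ∷ 4 ∷ 3 ∷ 10 ∷ 9 ∷ 8 ∷ 7 ∷ 0 ∷ []) ∷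
    (3 ∷ 2 ∷ 1 ∷ 0 ∷ 5 ∷ 4 ∷ 11 ∷ 10 ∷ 9 ∷ 8 ∷ 7 ∷ 6 ∷ []) ∷
    (3 ∷ 2 ∷ 1 ∷ 0 ∷ 11 ∷ 6 ∷ 5 ∷ 10 ∷ 9 ∷ 8 ∷ 7 ∷ 4 ∷ []) ∷
    (3 ∷ 2 ∷ 1 ∷ 0 ∷ 7 ∷ 6 ∷ 5 ∷ 4 ∷ 9 ∷ 8 ∷ 11 ∷ 10 ∷ []) ∷
    (7 ∷ 2 ∷ 1 ∷ 4 ∷ 3 ∷ 6 ∷ 5 ∷ 0 ∷ 9 ∷ 8 ∷ 11 ∷ 10 ∷ []) ∷
    (5 ∷ 2 ∷ 1 ∷ 4 ∷ 3 ∷ 0 ∷ 7 ∷ 6 ∷ 9 ∷ 8 ∷ 11 ∷ 10 ∷ []) ∷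
    (9 ∷ 2 ∷ 1 ∷ 4 ∷ 3 ∷ 8 ∷ 7 ∷ 6 ∷ 5 ∷ 0 ∷ 11 ∷ 10 ∷ []) ∷
    (9 ∷ 8 ∷ 5 ∷ 4 ∷ 3 ∷ 2 ∷ 7 ∷ 6 ∷ 1 ∷ 0 ∷ 11 ∷ 10 ∷ []) ∷
    (9 ∷ 6 ∷ 5 ∷ 4 ∷ 3 ∷ 2 ∷ 1 ∷ 8 ∷ 7 ∷ 0 ∷ 11 ∷ 10 ∷ []) ∷
    (1 ∷ 0 ∷ 5 ∷ 4 ∷ 3 ∷ 2 ∷ 9 ∷ 8 ∷ 7 ∷ 6 ∷ 11 ∷ 10 ∷ []) ∷
    (1 ∷ 0 ∷ 9 ∷ 4 ∷ 3 ∷ 6 ∷ 5 ∷ 8 ∷ 7 ∷ 2 ∷ 11 ∷ 10 ∷ []) ∷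
    (1 ∷ 0 ∷ 7 ∷ 4 ∷ 3 ∷ 6 ∷ 5 ∷ 2 ∷ 9 ∷ 8 ∷ 11 ∷ 10 ∷ []) ∷
    (1 ∷ 0 ∷ 11 ∷ 4 ∷ 3 ∷ 6 ∷ 5 ∷ 10 ∷ 9 ∷ 8 ∷ 7 ∷ 2 ∷ []) ∷
    (1 ∷ 0 ∷ 11 ∷ 10 ∷ 7 ∷ 6 ∷ 5 ∷ 4 ∷ 9 ∷ 8 ∷ 3 ∷ 2 ∷ []) ∷
    (1 ∷ 0 ∷ 11 ∷ 8 ∷ 7 ∷ 6 ∷ 5 ∷ 4 ∷ 3 ∷ 10 ∷ 9 ∷ 2 ∷ []) ∷
    (1 ∷ 0 ∷ 3 ∷ 2 ∷ 7 ∷ 6 ∷ 5 ∷ 4 ∷ 11 ∷ 10 ∷ 9 ∷ 8 ∷ []) ∷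
    (1 ∷ 0 ∷ 3 ∷ 2 ∷ 11 ∷ 6 ∷ 5 ∷ 8 ∷ 7 ∷ 10 ∷ 9 ∷ 4 ∷ []) ∷
    (1 ∷ 0 ∷ 3 ∷ 2 ∷ 9 ∷ 6 ∷ 5 ∷ 8 ∷ 7 ∷ 4 ∷ 11 ∷ 10 ∷ []) ∷
    (9 ∷ 4 ∷ 3 ∷ 2 ∷ 1 ∷ 6 ∷ 5 ∷ 8 ∷ 7 ∷ 0 ∷ 11 ∷ 10 ∷ []) ∷
    (5 ∷ 4 ∷ 3 ∷ 2 ∷ 1 ∷ 0 ∷ 9 ∷ 8 ∷ 7 ∷ 6 ∷ 11 ∷ 10 ∷ []) ∷
    (11 ∷ 4 ∷ 3 ∷ 2 ∷ 1 ∷ 10 ∷ 9 ∷ 8 ∷ 7 ∷ 6 ∷ 5 ∷ 0 ∷ []) ∷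
    (11 ∷ 10 ∷ 3 ∷ 2 ∷ 5 ∷ 4 ∷ 9 ∷ 8 ∷ 7 ∷ 6 ∷ 1 ∷ 0 ∷ []) ∷
    (11 ∷ 6 ∷ 3 ∷ 2 ∷ 5 ∷ 4 ∷ 1 ∷ 8 ∷ 7 ∷ 10 ∷ 9 ∷ 0 ∷ []) ∷ [])
  (2 ∷ 2 ∷ 0 ∷ 0 ∷ 0 ∷ 1 ∷ 1 ∷ 1 ∷ 2 ∷ 2 ∷ 1 ∷ 3 ∷ 3 ∷ 0 ∷ 4 ∷ 4 ∷ 0 ∷ 0 ∷ 0 ∷ 1 ∷ 1 ∷ 0 ∷ 2 ∷ 2 ∷ 2 ∷ 3 ∷ 3 ∷ 2 ∷ 4 ∷ 4 ∷ 0 ∷ 0 ∷ 0 ∷ 1 ∷ 1 ∷ 0 ∷ [])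
  _ _ _ _ _ _

-- Four blocks of 16 matchings, again each the previous block rotated by four points.
cycle-8 : RainbowCycle 8 2
cycle-8 = Table.cycle 8 2 63
  ( (1 ∷ 0 ∷ 3 ∷ 2 ∷ 5 ∷ 4 ∷ 7 ∷ 6 ∷ 15 ∷ 10 ∷ 9 ∷ 12 ∷ 11 ∷ 14 ∷ 13 ∷ 8 ∷ []) ∷
    (15 ∷ 8 ∷ 3 ∷ 2 ∷ 5 ∷ 4 ∷ 7 ∷ 6 ∷ 1 ∷ 10 ∷ 9 ∷ 12 ∷ 11 ∷ 14 ∷ 13 ∷ 0 ∷ []) ∷
    (15 ∷ 14 ∷ 3 ∷ 2 ∷ 5 ∷ 4 ∷ 7 ∷ 6 ∷ 13 ∷ 10 ∷ 9 ∷ 12 ∷ 11 ∷ 8 ∷ 1 ∷ 0 ∷ []) ∷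
    (15 ∷ 14 ∷ 3 ∷ 2 ∷ 13 ∷ 8 ∷ 7 ∷ 6 ∷ 5 ∷ 10 ∷ 9 ∷ 12 ∷ 11 ∷ 4 ∷ 1 ∷ 0 ∷ []) ∷
    (15 ∷ 14 ∷ 3 ∷ 2 ∷ 9 ∷ 8 ∷ 7 ∷ 6 ∷ 5 ∷ 4 ∷ 13 ∷ 12 ∷ 11 ∷ 10 ∷ 1 ∷ 0 ∷ []) ∷
    (15 ∷ 4 ∷ 3 ∷ 2 ∷ 1 ∷ 8 ∷ 7 ∷ 6 ∷ 5 ∷ 14 ∷ 13 ∷ 12 ∷ 11 ∷ 10 ∷ 9 ∷ 0 ∷ []) ∷
    (15 ∷ 4 ∷ 3 ∷ 2 ∷ 1 ∷ 14 ∷ 7 ∷ 6 ∷ 9 ∷ 8 ∷ 13 ∷ 12 ∷ 11 ∷ 10 ∷ 5 ∷ 0 ∷ []) ∷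
    (15 ∷ 4 ∷ 3 ∷ 2 ∷ 1 ∷ 10 ∷ 7 ∷ 6 ∷ 9 ∷ 8 ∷ 5 ∷ 12 ∷ 11 ∷ 14 ∷ 13 ∷ 0 ∷ []) ∷
    (15 ∷ 10 ∷ 3 ∷ 2 ∷ 5 ∷ 4 ∷ 7 ∷ 6 ∷ 9 ∷ 8 ∷ 1 ∷ 12 ∷ 11 ∷ 14 ∷ 13 ∷ 0 ∷ []) ∷
    (15 ∷ 2 ∷ 1 ∷ 10 ∷ 5 ∷ 4 ∷ 7 ∷ 6 ∷ 9 ∷ 8 ∷ 3 ∷ 12 ∷ 11 ∷ 14 ∷ 13 ∷ 0 ∷ []) ∷
    (3 ∷ 2 ∷ 1 ∷ 0 ∷ 5 ∷ 4 ∷ 7 ∷ 6 ∷ 9 ∷ 8 ∷ 15 ∷ 12 ∷ 11 ∷ 14 ∷ 13 ∷ 10 ∷ []) ∷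
    (3 ∷ 2 ∷ 1 ∷ 0 ∷ 5 ∷ 4 ∷ 15 ∷ 10 ∷ 9 ∷ 8 ∷ 7 ∷ 12 ∷ 11 ∷ 14 ∷ 13 ∷ 6 ∷ []) ∷
    (3 ∷ 2 ∷ 1 ∷ 0 ∷ 5 ∷ 4 ∷ 11 ∷ 10 ∷ 9 ∷ 8 ∷ 7 ∷ 6 ∷ 15 ∷ 14 ∷ 13 ∷ 12 ∷ []) ∷
    (11 ∷ 2 ∷ 1 ∷ 6 ∷ 5 ∷ 4 ∷ 3 ∷ 10 ∷ 9 ∷ 8 ∷ 7 ∷ 0 ∷ 15 ∷ 14 ∷ 13 ∷ 12 ∷ []) ∷
    (7 ∷ 2 ∷ 1 ∷ 6 ∷ 5 ∷ 4 ∷ 3 ∷ 0 ∷ 9 ∷ 8 ∷ 11 ∷ 10 ∷ 15 ∷ 14 ∷ 13 ∷ 12 ∷ []) ∷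
    (15 ∷ 2 ∷ 1 ∷ 6 ∷ 5 ∷ 4 ∷ 3 ∷ 12 ∷ 9 ∷ 8 ∷ 11 ∷ 10 ∷ 7 ∷ 14 ∷ 13 ∷ 0 ∷ []) ∷
    (15 ∷ 2 ∷ 1 ∷ 12 ∷ 5 ∷ 4 ∷ 7 ∷ 6 ∷ 9 ∷ 8 ∷ 11 ∷ 10 ∷ 3 ∷ 14 ∷ 13 ∷ 0 ∷ []) ∷
    (15 ∷ 2 ∷ 1 ∷ 4 ∷ 3 ∷ 12 ∷ 7 ∷ 6 ∷ 9 ∷ 8 ∷ 11 ∷ 10 ∷ 5 ∷ 14 ∷ 13 ∷ 0 ∷ []) ∷
    (15 ∷ 12 ∷ 5 ∷ 4 ∷ 3 ∷ 2 ∷ 7 ∷ 6 ∷ 9 ∷ 8 ∷ 11 ∷ 10 ∷ 1 ∷ 14 ∷ 13 ∷ 0 ∷ []) ∷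
    (15 ∷ 8 ∷ 5 ∷ 4 ∷ 3 ∷ 2 ∷ 7 ∷ 6 ∷ 1 ∷ 12 ∷ 11 ∷ 10 ∷ 9 ∷ 14 ∷ 13 ∷ 0 ∷ []) ∷
    (15 ∷ 14 ∷ 5 ∷ 4 ∷ 3 ∷ 2 ∷ 7 ∷ 6 ∷ 13 ∷ 12 ∷ 11 ∷ 10 ∷ 9 ∷ 8 ∷ 1 ∷ 0 ∷ []) ∷
    (15 ∷ 14 ∷ 13 ∷ 4 ∷ 3 ∷ 8 ∷ 7 ∷ 6 ∷ 5 ∷ 12 ∷ 11 ∷ 10 ∷ 9 ∷ 2 ∷ 1 ∷ 0 ∷ []) ∷
    (15 ∷ 14 ∷ 9 ∷ 4 ∷ 3 ∷ 8 ∷ 7 ∷ 6 ∷ 5 ∷ 2 ∷ 11 ∷ 10 ∷ 13 ∷ 12 ∷ 1 ∷ 0 ∷ []) ∷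
    (15 ∷ 2 ∷ 1 ∷ 4 ∷ 3 ∷ 8 ∷ 7 ∷ 6 ∷ 5 ∷ 14 ∷ 11 ∷ 10 ∷ 13 ∷ 12 ∷ 9 ∷ 0 ∷ []) ∷
    (15 ∷ 2 ∷ 1 ∷ 4 ∷ 3 ∷ 14 ∷ 7 ∷ 6 ∷ 9 ∷ 8 ∷ 11 ∷ 10 ∷ 13 ∷ 12 ∷ 5 ∷ 0 ∷ []) ∷
    (15 ∷ 2 ∷ 1 ∷ 4 ∷ 3 ∷ 6 ∷ 5 ∷ 14 ∷ 9 ∷ 8 ∷ 11 ∷ 10 ∷ 13 ∷ 12 ∷ 7 ∷ 0 ∷ []) ∷
    (15 ∷ 2 ∷ 1 ∷ 14 ∷ 7 ∷ 6 ∷ 5 ∷ 4 ∷ 9 ∷ 8 ∷ 11 ∷ 10 ∷ 13 ∷ 12 ∷ 3 ∷ 0 ∷ []) ∷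
    (15 ∷ 2 ∷ 1 ∷ 10 ∷ 7 ∷ 6 ∷ 5 ∷ 4 ∷ 9 ∷ 8 ∷ 3 ∷ 14 ∷ 13 ∷ 12 ∷ 11 ∷ 0 ∷ []) ∷
    (3 ∷ 2 ∷ 1 ∷ 0 ∷ 7 ∷ 6 ∷ 5 ∷ 4 ∷ 9 ∷ 8 ∷ 15 ∷ 14 ∷ 13 ∷ 12 ∷ 11 ∷ 10 ∷ []) ∷
    (3 ∷ 2 ∷ 1 ∷ 0 ∷ 15 ∷ 6 ∷ 5 ∷ 10 ∷ 9 ∷ 8 ∷ 7 ∷ 14 ∷ 13 ∷ 12 ∷ 11 ∷ 4 ∷ []) ∷
    (3 ∷ 2 ∷ 1 ∷ 0 ∷ 11 ∷ 6 ∷ 5 ∷ 10 ∷ 9 ∷ 8 ∷ 7 ∷ 4 ∷ 13 ∷ 12 ∷ 15 ∷ 14 ∷ []) ∷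
    (11 ∷ 2 ∷ 1 ∷ 4 ∷ 3 ∷ 6 ∷ 5 ∷ 10 ∷ 9 ∷ 8 ∷ 7 ∷ 0 ∷ 13 ∷ 12 ∷ 15 ∷ 14 ∷ []) ∷
    (7 ∷ 2 ∷ 1 ∷ 4 ∷ 3 ∷ 6 ∷ 5 ∷ 0 ∷ 9 ∷ 8 ∷ 11 ∷ 10 ∷ 13 ∷ 12 ∷ 15 ∷ 14 ∷ []) ∷
    (9 ∷ 2 ∷ 1 ∷ 4 ∷ 3 ∷ 6 ∷ 5 ∷ 8 ∷ 7 ∷ 0 ∷ 11 ∷ 10 ∷ 13 ∷ 12 ∷ 15 ∷ 14 ∷ []) ∷
    (5 ∷ 2 ∷ 1 ∷ 4 ∷ 3 ∷ 0 ∷ 9 ∷ 8 ∷ 7 ∷ 6 ∷ 11 ∷ 10 ∷ 13 ∷ 12 ∷ 15 ∷ 14 ∷ []) ∷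
    (13 ∷ 2 ∷ 1 ∷ 4 ∷ 3 ∷ 12 ∷ 9 ∷ 8 ∷ 7 ∷ 6 ∷ 11 ∷ 10 ∷ 5 ∷ 0 ∷ 15 ∷ 14 ∷ []) ∷
    (13 ∷ 12 ∷ 5 ∷ 4 ∷ 3 ∷ 2 ∷ 9 ∷ 8 ∷ 7 ∷ 6 ∷ 11 ∷ 10 ∷ 1 ∷ 0 ∷ 15 ∷ 14 ∷ []) ∷
    (13 ∷ 6 ∷ 5 ∷ 4 ∷ 3 ∷ 2 ∷ 1 ∷ 8 ∷ 7 ∷ 12 ∷ 11 ∷ 10 ∷ 9 ∷ 0 ∷ 15 ∷ 14 ∷ []) ∷
    (1 ∷ 0 ∷ 5 ∷ 4 ∷ 3 ∷ 2 ∷ 13 ∷ 8 ∷ 7 ∷ 12 ∷ 11 ∷ 10 ∷ 9 ∷ 6 ∷ 15 ∷ 14 ∷ []) ∷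
    (1 ∷ 0 ∷ 13 ∷ 4 ∷ 3 ∷ 6 ∷ 5 ∷ 8 ∷ 7 ∷ 12 ∷ 11 ∷ 10 ∷ 9 ∷ 2 ∷ 15 ∷ 14 ∷ []) ∷
    (1 ∷ 0 ∷ 9 ∷ 4 ∷ 3 ∷ 6 ∷ 5 ∷ 8 ∷ 7 ∷ 2 ∷ 11 ∷ 10 ∷ 13 ∷ 12 ∷ 15 ∷ 14 ∷ []) ∷
    (1 ∷ 0 ∷ 11 ∷ 4 ∷ 3 ∷ 6 ∷ 5 ∷ 8 ∷ 7 ∷ 10 ∷ 9 ∷ 2 ∷ 13 ∷ 12 ∷ 15 ∷ 14 ∷ []) ∷
    (1 ∷ 0 ∷ 7 ∷ 4 ∷ 3 ∷ 6 ∷ 5 ∷ 2 ∷ 11 ∷ 10 ∷ 9 ∷ 8 ∷ 13 ∷ 12 ∷ 15 ∷ 14 ∷ []) ∷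
    (1 ∷ 0 ∷ 15 ∷ 4 ∷ 3 ∷ 6 ∷ 5 ∷ 14 ∷ 11 ∷ 10 ∷ 9 ∷ 8 ∷ 13 ∷ 12 ∷ 7 ∷ 2 ∷ []) ∷
    (1 ∷ 0 ∷ 15 ∷ 14 ∷ 7 ∷ 6 ∷ 5 ∷ 4 ∷ 11 ∷ 10 ∷ 9 ∷ 8 ∷ 13 ∷ 12 ∷ 3 ∷ 2 ∷ []) ∷
    (1 ∷ 0 ∷ 15 ∷ 8 ∷ 7 ∷ 6 ∷ 5 ∷ 4 ∷ 3 ∷ 10 ∷ 9 ∷ 14 ∷ 13 ∷ 12 ∷ 11 ∷ 2 ∷ []) ∷
    (1 ∷ 0 ∷ 3 ∷ 2 ∷ 7 ∷ 6 ∷ 5 ∷ 4 ∷ 15 ∷ 10 ∷ 9 ∷ 14 ∷ 13 ∷ 12 ∷ 11 ∷ 8 ∷ []) ∷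
    (1 ∷ 0 ∷ 3 ∷ 2 ∷ 15 ∷ 6 ∷ 5 ∷ 8 ∷ 7 ∷ 10 ∷ 9 ∷ 14 ∷ 13 ∷ 12 ∷ 11 ∷ 4 ∷ []) ∷
    (1 ∷ 0 ∷ 3 ∷ 2 ∷ 11 ∷ 6 ∷ 5 ∷ 8 ∷ 7 ∷ 10 ∷ 9 ∷ 4 ∷ 13 ∷ 12 ∷ 15 ∷ 14 ∷ []) ∷
    (1 ∷ 0 ∷ 3 ∷ 2 ∷ 13 ∷ 6 ∷ 5 ∷ 8 ∷ 7 ∷ 10 ∷ 9 ∷ 12 ∷ 11 ∷ 4 ∷ 15 ∷ 14 ∷ []) ∷
    (1 ∷ 0 ∷ 3 ∷ 2 ∷ 9 ∷ 6 ∷ 5 ∷ 8 ∷ 7 ∷ 4 ∷ 13 ∷ 12 ∷ 11 ∷ 10 ∷ 15 ∷ 14 ∷ []) ∷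
    (9 ∷ 4 ∷ 3 ∷ 2 ∷ 1 ∷ 6 ∷ 5 ∷ 8 ∷ 7 ∷ 0 ∷ 13 ∷ 12 ∷ 11 ∷ 10 ∷ 15 ∷ 14 ∷ []) ∷
    (5 ∷ 4 ∷ 3 ∷ 2 ∷ 1 ∷ 0 ∷ 9 ∷ 8 ∷ 7 ∷ 6 ∷ 13 ∷ 12 ∷ 11 ∷ 10 ∷ 15 ∷ 14 ∷ []) ∷
    (13 ∷ 4 ∷ 3 ∷ 2 ∷ 1 ∷ 10 ∷ 9 ∷ 8 ∷ 7 ∷ 6 ∷ 5 ∷ 12 ∷ 11 ∷ 0 ∷ 15 ∷ 14 ∷ []) ∷
    (13 ∷ 10 ∷ 3 ∷ 2 ∷ 5 ∷ 4 ∷ 9 ∷ 8 ∷ 7 ∷ 6 ∷ 1 ∷ 12 ∷ 11 ∷ 0 ∷ 15 ∷ 14 ∷ []) ∷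
    (13 ∷ 6 ∷ 3 ∷ 2 ∷ 5 ∷ 4 ∷ 1 ∷ 8 ∷ 7 ∷ 10 ∷ 9 ∷ 12 ∷ 11 ∷ 0 ∷ 15 ∷ 14 ∷ []) ∷
    (1 ∷ 0 ∷ 3 ∷ 2 ∷ 5 ∷ 4 ∷ 13 ∷ 8 ∷ 7 ∷ 10 ∷ 9 ∷ 12 ∷ 11 ∷ 6 ∷ 15 ∷ 14 ∷ []) ∷
    (1 ∷ 0 ∷ 3 ∷ 2 ∷ 5 ∷ 4 ∷ 15 ∷ 8 ∷ 7 ∷ 10 ∷ 9 ∷ 12 ∷ 11 ∷ 14 ∷ 13 ∷ 6 ∷ []) ∷
    (1 ∷ 0 ∷ 3 ∷ 2 ∷ 5 ∷ 4 ∷ 11 ∷ 8 ∷ 7 ∷ 10 ∷ 9 ∷ 6 ∷ 15 ∷ 14 ∷ 13 ∷ 12 ∷ []) ∷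
    (1 ∷ 0 ∷ 11 ∷ 6 ∷ 5 ∷ 4 ∷ 3 ∷ 8 ∷ 7 ∷ 10 ∷ 9 ∷ 2 ∷ 15 ∷ 14 ∷ 13 ∷ 12 ∷ []) ∷
    (1 ∷ 0 ∷ 7 ∷ 6 ∷ 5 ∷ 4 ∷ 3 ∷ 2 ∷ 11 ∷ 10 ∷ 9 ∷ 8 ∷ 15 ∷ 14 ∷ 13 ∷ 12 ∷ []) ∷
    (1 ∷ 0 ∷ 15 ∷ 6 ∷ 5 ∷ 4 ∷ 3 ∷ 12 ∷ 11 ∷ 10 ∷ 9 ∷ 8 ∷ 7 ∷ 14 ∷ 13 ∷ 2 ∷ []) ∷
    (1 ∷ 0 ∷ 15 ∷ 12 ∷ 5 ∷ 4 ∷ 7 ∷ 6 ∷ 11 ∷ 10 ∷ 9 ∷ 8 ∷ 3 ∷ 14 ∷ 13 ∷ 2 ∷ []) ∷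
    (1 ∷ 0 ∷ 15 ∷ 8 ∷ 5 ∷ 4 ∷ 7 ∷ 6 ∷ 3 ∷ 10 ∷ 9 ∷ 12 ∷ 11 ∷ 14 ∷ 13 ∷ 2 ∷ []) ∷ [])
  (0 ∷ 1 ∷ 4 ∷ 4 ∷ 1 ∷ 5 ∷ 5 ∷ 1 ∷ 1 ∷ 0 ∷ 6 ∷ 6 ∷ 0 ∷ 0 ∷ 0 ∷ 3 ∷ 3 ∷ 1 ∷ 1 ∷ 1 ∷ 2 ∷ 2 ∷ 1 ∷ 5 ∷ 5 ∷ 3 ∷ 3 ∷ 0 ∷ 4 ∷ 4 ∷ 0 ∷ 0 ∷ 0 ∷ 0 ∷ 0 ∷ 1 ∷ 1 ∷ 0 ∷ 2 ∷ 2 ∷ 2 ∷ 2 ∷ 2 ∷ 3 ∷ 3 ∷ 2 ∷ 4 ∷ 4 ∷ 4 ∷ 4 ∷ 0 ∷ 0 ∷ 0 ∷ 1 ∷ 1 ∷ 0 ∷ 6 ∷ 6 ∷ 2 ∷ 2 ∷ 2 ∷ 3 ∷ 3 ∷ 2 ∷ [])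
  _ _ _ _ _ _

theorem9 : (m : ℕ) → 2 ≤ m →
    (Odd m → ¬ RainbowCycle m 1) ×
    ((m ≡ 6 ⊎ m ≡ 8 ⊎ m ≡ 10) → ¬ RainbowCycle m 1) ×
    ((m ≡ 2 ⊎ m ≡ 4) → RainbowCycle m 1) ×
    ((m ≡ 6 ⊎ m ≡ 8) → RainbowCycle m 2)
theorem9 m 2≤m =
  (λ odd R → Count.¬odd {{>-nonZero (*-mono-≤ (s≤s {n = 1} z≤n) (≤-trans (n≤1+n 1) 2≤m))}} R odd) ,
  (λ { (inj₁ refl) → no-rainbow-6 ; (inj₂ (inj₁ refl)) → no-rainbow-8 ; (inj₂ (inj₂ refl)) → no-rainbow-10 }) ,
  (λ { (inj₁ refl) → cycle-2 ; (inj₂ refl) → cycle-4 }) ,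
  (λ { (inj₁ refl) → cycle-6 ; (inj₂ refl) → cycle-8 })
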